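{- Let $F=(f_1,\ldots,f_J)$, $J\geq 2$, be an iterated function system consisting of similarities of $\mathbb{R}^d$, with $f_j(\mathbb{Q}^d)\subseteq\mathbb{Q}^d$ for $1\leq j\leq J$, and let $C$ be its attractor, assumed to contain more than one point. Let $\tau_j\in(0,1)$ be the contraction factor of $f_j$, $\tau=\max_{1\leq j\leq J}\tau_j$, and $D=-\log J/\log\tau$. Assume that either $F$ satisfies the open set condition and there is a nonzero vector $\underline{v}\in\mathbb{Z}^d$ such that $C$ contains no line segment parallel to $\underline{v}$, or that $D<1/2$. Then: (1) There exists $K>0$ such that for any $\underline{\xi}\in C$ and any $Q>1$ the inequality $$\Vert\underline{\xi}-\underline{p}/q\Vert\leq\frac{K}{Q}$$ has a solution $\underline{p}/q\in\mathbb{Q}^d\setminus C$ with $1\leq q\leq Q$. (2) For any function $\Phi:\mathbb{N}\to(0,\infty)$ that tends to $0$, there exists $\underline{\xi}\in C\setminus\mathbb{Q}^d$ for which there are arbitrarily large $Q$ such that $$\Vert\underline{\xi}-\underline{p}/q\Vert>\frac{\Phi(Q)}{Q}$$ holds for every $\underline{p}/q\in\mathbb{Q}^d\setminus C$ with $1\leq q\leq Q$. (3) For any function $\Psi:\mathbb{N}\to(0,\infty)$, there are intrinsically $\Psi$-approximable vectors in $C$, i.e. vectors $\underline{\xi}\in C$ for which the inequality $$\Vert\underline{\xi}-\underline{p}/q\Vert<\Psi(q)$$ admits infinitely many solutions $\underline{p}/q\in\mathbb{Q}^d\cap C$. In particular, $C$ contains Liouville vectors.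
   Context: $\mathbb{R}^d$ carries the supremum norm $\Vert\cdot\Vert$. A contracting similarity with contraction factor $\tau_j\in(0,1)$ is a map with $\Vert f_j(\underline{x})-f_j(\underline{y})\Vert=\tau_j\Vert\underline{x}-\underline{y}\Vert$ for all $\underline{x},\underline{y}\in\mathbb{R}^d$. The attractor of a finite family (IFS) of contractions $f_1,\ldots,f_J$ is the unique nonempty compact set $C$ with $\bigcup_{j}f_j(C)=C$. The IFS satisfies the open set condition if there is a nonempty bounded open set $O\subseteq\mathbb{R}^d$ with $f_j(O)\subseteq O$ for all $j$ and $f_i(O)\cap f_j(O)=\emptyset$ for $i\neq j$. Line segments are nondegenerate. Rational vectors are written $\underline{p}/q$ with $\underline{p}\in\mathbb{Z}^d$, $q\in\mathbb{N}$; infinitely many solutions means infinitely many distinct rational vectors. A vector $\underline{\xi}\in\mathbb{R}^d$ is a Liouville vector if for every $N$ the inequality $\Vert\underline{\xi}-\underline{p}/q\Vert<q^{ -N}$ has infinitely many solutions $\underline{p}/q\in\mathbb{Q}^d$. -}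

module Defs where

open import Level using (0ℓ) renaming (suc to lsuc)
open import Algebra.Bundles using (CommutativeRing; Semiring)
open import Data.Fin using (Fin)
open import Data.Integer using (ℤ; +_; -[1+_]; 0ℤ)
open import Data.List using (List)
open import Data.List.Relation.Unary.Any using (Any)
open import Data.Nat as ℕ using (ℕ; NonZero)
open import Data.Nat.Base using (_!)
open import Data.Product using (∃; ∃₂; ∃-syntax; _×_)
open import Data.Rational as ℚ using (ℚ; ↥_; ↧ₙ_)
open import Data.Vec.Functional using (Vector; foldr; map; zipWith)
open import Data.Vec.Functional.Relation.Binary.Pointwise using (Pointwise)
open import Function.Base using (_∘_)
open import Function.Definitions using (Injective)
open import Relation.Binary.Bundles using (StrictTotalOrder)
open import Relation.Binary.Core using (Rel)
open import Relation.Binary.PropositionalEquality using (_≡_; _≢_)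
open import Relation.Binary.Structures using (IsStrictTotalOrder)
open import Relation.Nullary using (¬_)
open import Relation.Unary using (Pred; _∈_; _∉_; _⊆_; Satisfiable)
import Algebra.Construct.NaturalChoice.Max as Max
import Algebra.Definitions.RawSemiring as RawSemiringOps
import Relation.Binary.Properties.StrictTotalOrder as StrictTotalOrderProperties

-- ℝ is presented axiomatically, as a Dedekind-complete ordered field; this
-- determines it up to unique isomorphism. As in a classical treatment, the
-- order is trichotomous and the inverse is total, with x ⁻¹ unspecified at 0.
record RealNumbers : Set (lsuc 0ℓ) where
  field
    commutativeRing : CommutativeRing 0ℓ 0ℓ

  open CommutativeRing commutativeRing public

  infix  4 _<_
  infix  8 _⁻¹

  field
    _<_                : Rel Carrier 0ℓ
    isStrictTotalOrder : IsStrictTotalOrder _≈_ _<_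
    0<1                : 0# < 1#
    +-monoˡ-<          : ∀ z {x y} → x < y → x + z < y + z
    *-pos              : ∀ {x y} → 0# < x → 0# < y → 0# < x * y
    _⁻¹                : Carrier → Carrier
    ⁻¹-inverseʳ        : ∀ {x} → x ≉ 0# → x * x ⁻¹ ≈ 1#

  strictTotalOrder : StrictTotalOrder 0ℓ 0ℓ 0ℓ
  strictTotalOrder = record { isStrictTotalOrder = isStrictTotalOrder }

  open StrictTotalOrderProperties strictTotalOrder public
    using (_≤_; decTotalOrder; totalOrder)

  UpperBound : Pred Carrier 0ℓ → Pred Carrier 0ℓ
  UpperBound S b = ∀ {x} → x ∈ S → x ≤ b

  field
    supremum : (S : Pred Carrier 0ℓ) → Satisfiable S → Satisfiable (UpperBound S) →
               ∃[ s ] s ∈ UpperBound S × (∀ {b} → b ∈ UpperBound S → s ≤ b)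

-- A fraction p / q representing a rational vector, p ∈ ℤᵈ, q ≥ 1; not
-- necessarily in lowest terms, so several fractions have the same value.
record Fraction (d : ℕ) : Set where
  constructor _/_
  field
    num           : Vector ℤ d
    den           : ℕ
    .{{den-nonZero}} : NonZero den

  value : Vector ℚ d
  value i = num i ℚ./ den

open Fraction public using (num; den; value)

-- Infinitely many distinct rational vectors, not merely distinct fractions.
InfinitelyMany : ∀ {d} → Pred (Fraction d) 0ℓ → Set
InfinitelyMany {d} P =
  ∃[ r ] (∀ n → r n ∈ P) × Injective {A = ℕ} _≡_ (Pointwise _≡_) (value {d} ∘ r)

module Real (𝓡 : RealNumbers) where

  open RealNumbers 𝓡 public renaming (Carrier to ℝ)
  open RawSemiringOps (Semiring.rawSemiring semiring) public using (_^_) renaming (_×_ to _·_)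
  open Max totalOrder public using (_⊔_)

  infix  4 _⟶_ _IsLogOf_
  infixl 7 _÷_

  _÷_ : ℝ → ℝ → ℝ
  x ÷ y = x * y ⁻¹

  ∣_∣ : ℝ → ℝ
  ∣ x ∣ = x ⊔ (- x)

  fromℕ : ℕ → ℝ
  fromℕ n = n · 1#

  fromℤ : ℤ → ℝ
  fromℤ (+ n)    = fromℕ n
  fromℤ -[1+ n ] = - fromℕ (ℕ.suc n)

  fromℚ : ℚ → ℝ
  fromℚ x = fromℤ (↥ x) ÷ fromℕ (↧ₙ x)

  ½ : ℝ
  ½ = 1# ÷ fromℕ 2

  -- 0 is the maximum of the empty family. It does not affect the others, as
  -- this is only applied to families of nonnegative numbers.
  maximum : ∀ {n} → Vector ℝ n → ℝ
  maximum = foldr _⊔_ 0#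

  _⟶_ : (ℕ → ℝ) → ℝ → Set
  u ⟶ l = ∀ ε → 0# < ε → ∃[ N ] ∀ n → N ℕ.≤ n → ∣ u n - l ∣ < ε

  expPartialSum : ℝ → ℕ → ℝ
  expPartialSum x ℕ.zero    = 0#
  expPartialSum x (ℕ.suc n) = expPartialSum x n + (x ^ n) ÷ fromℕ (n !)

  -- x = log y, i.e. y = exp x = Σₙ xⁿ / n!.
  _IsLogOf_ : ℝ → ℝ → Set
  x IsLogOf y = expPartialSum x ⟶ y

  -- D = - log J / log t.
  IsDimension : (J : ℕ) (t D : ℝ) → Set
  IsDimension J t D =
    ∃₂ λ logJ logt → logJ IsLogOf fromℕ J × logt IsLogOf t × D ≈ (- logJ) ÷ logt

  ℝ^_ : ℕ → Set
  ℝ^ d = Vector ℝ d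

  module _ {d : ℕ} where

    infix  4 _≋_
    infixl 6 _⊕_ _⊖_
    infixr 7 _⊙_

    _≋_ : Rel (ℝ^ d) 0ℓ
    _≋_ = Pointwise _≈_

    _⊕_ _⊖_ : ℝ^ d → ℝ^ d → ℝ^ d
    _⊕_ = zipWith _+_
    _⊖_ = zipWith _-_

    _⊙_ : ℝ → ℝ^ d → ℝ^ d
    t ⊙ x = map (t *_) x

    ‖_‖ : ℝ^ d → ℝ
    ‖ x ‖ = maximum (map ∣_∣ x)

    Rational : Pred (ℝ^ d) 0ℓ
    Rational x = ∃[ r ] x ≋ map fromℚ r

    ⟦_⟧ : Fraction d → ℝ^ d
    ⟦ r ⟧ = map fromℚ (value r)

    IsOpen : Pred (ℝ^ d) 0ℓ → Set
    IsOpen U = ∀ {x} → x ∈ U → ∃[ ε ] 0# < ε × (∀ {y} → ‖ x ⊖ y ‖ < ε → y ∈ U)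

    IsBounded : Pred (ℝ^ d) 0ℓ → Set
    IsBounded S = ∃[ M ] ∀ {x} → x ∈ S → ‖ x ‖ ≤ M

    IsCompact : Pred (ℝ^ d) 0ℓ → Set (lsuc 0ℓ)
    IsCompact S =
      {I : Set} (U : I → Pred (ℝ^ d) 0ℓ) → (∀ i → IsOpen (U i)) →
      (∀ {x} → x ∈ S → ∃[ i ] x ∈ U i) →
      ∃[ is ] (∀ {x} → x ∈ S → Any (λ i → x ∈ U i) is)

    Image : (ℝ^ d → ℝ^ d) → Pred (ℝ^ d) 0ℓ → Pred (ℝ^ d) 0ℓ
    Image f S y = ∃[ x ] x ∈ S × f x ≋ y

    IsContractingSimilarity : ℝ → (ℝ^ d → ℝ^ d) → Set
    IsContractingSimilarity t f =
      0# < t × t < 1# × (∀ x y → ‖ f x ⊖ f y ‖ ≈ t * ‖ x ⊖ y ‖)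

    -- For an IFS of contractions these properties determine C uniquely.
    IsAttractor : ∀ {J} → (Fin J → ℝ^ d → ℝ^ d) → Pred (ℝ^ d) 0ℓ → Set (lsuc 0ℓ)
    IsAttractor f C =
      Satisfiable C × IsCompact C ×
      (∀ {x} → (∃[ j ] x ∈ Image (f j) C) → x ∈ C) ×
      (∀ {x} → x ∈ C → ∃[ j ] x ∈ Image (f j) C)

    OpenSetCondition : ∀ {J} → (Fin J → ℝ^ d → ℝ^ d) → Set (lsuc 0ℓ)
    OpenSetCondition f =
      ∃[ O ] Satisfiable O × IsBounded O × IsOpen O ×
        (∀ j → Image (f j) O ⊆ O) ×
        (∀ i j → i ≢ j → ∀ x → ¬ (x ∈ Image (f i) O × x ∈ Image (f j) O))

    HasTwoPoints : Pred (ℝ^ d) 0ℓ → Set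
    HasTwoPoints S = ∃₂ λ x y → x ∈ S × y ∈ S × ¬ x ≋ y

    Segment : (a b : ℝ^ d) → Pred (ℝ^ d) 0ℓ
    Segment a b x = ∃[ t ] 0# ≤ t × t ≤ 1# × x ≋ a ⊕ t ⊙ (b ⊖ a)

    ContainsSegmentParallelTo : Pred (ℝ^ d) 0ℓ → Vector ℤ d → Set
    ContainsSegmentParallelTo S v =
      ∃₂ λ a b → ¬ a ≋ b × (∃[ c ] b ⊖ a ≋ c ⊙ map fromℤ v) × Segment a b ⊆ S

    IntrinsicallyApproximable : (ℕ → ℝ) → Pred (ℝ^ d) 0ℓ → Pred (ℝ^ d) 0ℓ
    IntrinsicallyApproximable Ψ C ξ =
      ξ ∈ C × InfinitelyMany λ r → ⟦ r ⟧ ∈ C × ‖ ξ ⊖ ⟦ r ⟧ ‖ < Ψ (den r)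

    Liouville : Pred (ℝ^ d) 0ℓ
    Liouville ξ =
      ∀ N → InfinitelyMany λ r → ‖ ξ ⊖ ⟦ r ⟧ ‖ < (fromℕ (den r) ^ N) ⁻¹

{-# OPTIONS --safe #-}
module Submission where

-- A similarity of the supremum norm is a signed permutation of the coordinates up to scaling and
-- translation: the images of ± R eᵢ are 2 R t apart in some coordinate k, and the distances from
-- a point x to ± R eᵢ then leave only one value for f x k. Hence every f j is onto and, as it
-- preserves ℚᵈ, has a rational fixed point, so that C has rational points, none of them isolated.
--
-- Distinct fractions with denominators q and q′ are at distance at least 1/(q q′). A limit of
-- rational points of C, each extremely close to its predecessor, therefore proves (2) and (3).
--
-- (1) under the open set condition: a ball of radius r meets a bounded number of the cylinders
-- f_w(C) of diameter about r. C has empty interior, so by compactness any ball contains a ball of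
-- proportional radius that misses a given such cylinder. Avoiding the cylinders one after the
-- other leaves a ball of radius e r without points of C, and it contains a vector with any given
-- denominator N > 1/(e r).
--
-- (1) for D < 1/2: then J² t < 1, and there are only J^n ≤ N^(1-δ) cylinders of diameter < N⁻².
-- Take fractions close to ξ with denominators N, N-1, …, N - J^n. If all of them were in C, two
-- would be in the same cylinder and hence equal; but an equality a/b = a′/b′ with b′ < b forces
-- b ≤ gcd(a, b) (b - b′), and a numerator a near b ξ with small gcd(a, b) can be chosen.

open import Defs
open import Algebra.Bundles using (CommutativeRing)
open import Algebra.Solver.Ring.AlmostCommutativeRing using (AlmostCommutativeRing; fromCommutativeRing; _-Raw-AlmostCommutative⟶_)
open import Axiom.ExcludedMiddle using (ExcludedMiddle)
open import Data.Bool using (T)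
open import Data.Empty using (⊥; ⊥-elim)
open import Data.Fin as Fin using (Fin; zero; suc)
open import Data.Integer as ℤ using (ℤ; +_; -[1+_]; 0ℤ; 1ℤ)
open import Data.List using (List; []; _∷_)
open import Data.List.Relation.Unary.Any using (Any; here; there)
open import Data.Maybe as Maybe using (Maybe; just; nothing)
open import Data.Nat as ℕ using (ℕ; zero; suc; NonZero; z≤n; s≤s)
open import Data.Nat.Base using (_!)
open import Data.Product using (Σ-syntax; ∃₂; ∃-syntax; _×_; _,_; proj₁; proj₂)
open import Data.Rational as ℚ using (ℚ; ↥_; ↧_; ↧ₙ_)
open import Data.Sum using (_⊎_; inj₁; inj₂; [_,_]′)
open import Data.Vec using (Vec; []; _∷_)
open import Data.Vec.Functional using (Vector)
open import Function.Base using (_∘_; case_of_)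
open import Level using (0ℓ)
open import Relation.Binary.Definitions using (tri<; tri≈; tri>)
open import Relation.Binary.Structures using (IsStrictTotalOrder)
open import Relation.Binary.PropositionalEquality as ≡ using (_≡_; _≢_)
open import Relation.Nullary using (¬_; Dec; yes; no)
open import Relation.Unary using (Pred; _∈_; _∉_)
import Algebra.Properties.AbelianGroup as AbelianGroupProperties
import Algebra.Properties.Ring as RingProperties
import Algebra.Properties.Semiring.Exp as ExpProperties
import Algebra.Properties.Semiring.Mult as MultProperties
import Algebra.Solver.Ring as RingSolver
import Algebra.Construct.NaturalChoice.Max as Max
import Data.Fin.Properties as FinP
import Data.Integer.GCD as ℤG
import Data.Integer.Properties as ℤP
import Data.Nat.GeneralisedArithmetic as ℕG
import Data.Nat.Divisibility as ℕD
import Data.Nat.GCD as ℕGCD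
import Data.Nat.LCM as ℕLCM
import Data.Nat.Properties as ℕP
import Data.Rational.Properties as ℚP
import Data.Nat.Tactic.RingSolver as ℕSolver
import Relation.Binary.Properties.StrictTotalOrder as StrictTotalOrderProperties

-- The difficulty in (1) is uniformity in ξ and Q. Under the open set condition, each cylinder
-- avoided shrinks the ball by a factor that depends on how many were avoided before, so their
-- number must be bounded in the same way at every scale: the cylinders of one scale carry disjoint
-- balls of comparable radius. For D < 1/2 cylinders may overlap and only their number H is used.
-- The bound N^(1-δ) takes the form H^k ≤ c N^(k-2) in natural numbers, with k = 2 + 2m read off
-- from a power of J² t that is below t. The same k is the number of consecutive numerators tried:
-- the product of their gcds with the denominator q divides q times a constant depending on k alone,
-- so not all of these gcds reach q / H. As logarithms are given by the exponential series only, J²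
-- t < 1 rests on the functional equation of exp. Compactness is defined by open covers; fixed
-- points, limits and uniform constants are all drawn from cluster points of sequences in C.

-- The integers inside ℝ and the solver for ring identities.

module Solver (𝓡 : RealNumbers) where

  open Real 𝓡 hiding (zero)
  open AbelianGroupProperties +-abelianGroup using (ε⁻¹≈ε; ⁻¹-involutive; ⁻¹-∙-comm)
  open RingProperties ring using (-‿distribˡ-*; -‿distribʳ-*)

  private
    module Mult = MultProperties semiring
    open import Relation.Binary.Reasoning.Setoid setoid

  fromℕ-+ : ∀ m n → fromℕ (m ℕ.+ n) ≈ fromℕ m + fromℕ n
  fromℕ-+ = Mult.×-homo-+ 1#

  fromℕ-* : ∀ m n → fromℕ (m ℕ.* n) ≈ fromℕ m * fromℕ n
  fromℕ-* = Mult.×1-homo-*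

  fromℤ-neg : ∀ i → fromℤ (ℤ.- i) ≈ - fromℤ i
  fromℤ-neg (+ zero)  = sym ε⁻¹≈ε
  fromℤ-neg (+ suc n) = refl
  fromℤ-neg -[1+ n ]  = sym (⁻¹-involutive _)

  fromℤ-⊖ : ∀ m n → fromℤ (m ℤ.⊖ n) ≈ fromℕ m - fromℕ n
  fromℤ-⊖ zero    n = begin
    fromℤ (0 ℤ.⊖ n)  ≡⟨ ≡.cong fromℤ (ℤP.⊖-swap 0 n) ⟩
    fromℤ (ℤ.- (+ n)) ≈⟨ fromℤ-neg (+ n) ⟩
    - fromℕ n        ≈⟨ +-identityˡ _ ⟨
    0# - fromℕ n     ∎
  fromℤ-⊖ (suc m) zero    = begin
    fromℕ (suc m)      ≈⟨ +-identityʳ _ ⟨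
    fromℕ (suc m) + 0# ≈⟨ +-congˡ ε⁻¹≈ε ⟨
    fromℕ (suc m) - 0# ∎
  fromℤ-⊖ (suc m) (suc n) = begin
    fromℤ (suc m ℤ.⊖ suc n)             ≡⟨ ≡.cong fromℤ (ℤP.[1+m]⊖[1+n]≡m⊖n m n) ⟩
    fromℤ (m ℤ.⊖ n)                     ≈⟨ fromℤ-⊖ m n ⟩
    fromℕ m - fromℕ n                   ≈⟨ +-congʳ (+-identityˡ _) ⟨
    0# + fromℕ m - fromℕ n              ≈⟨ +-congʳ (+-congʳ (-‿inverseʳ 1#)) ⟨
    1# - 1# + fromℕ m - fromℕ n
        ≈⟨ +-congʳ (trans (+-assoc _ _ _) (trans (+-congˡ (+-comm _ _)) (sym (+-assoc _ _ _)))) ⟩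
    1# + fromℕ m - 1# - fromℕ n         ≈⟨ +-assoc _ _ _ ⟩
    1# + fromℕ m + (- 1# - fromℕ n)     ≈⟨ +-congˡ (⁻¹-∙-comm _ _) ⟩
    1# + fromℕ m - (1# + fromℕ n)       ∎

  fromℤ-+ : ∀ i j → fromℤ (i ℤ.+ j) ≈ fromℤ i + fromℤ j
  fromℤ-+ (+ m)    (+ n)    = fromℕ-+ m n
  fromℤ-+ (+ m)    -[1+ n ] = fromℤ-⊖ m (suc n)
  fromℤ-+ -[1+ m ] (+ n)    = trans (fromℤ-⊖ n (suc m)) (+-comm _ _)
  fromℤ-+ -[1+ m ] -[1+ n ] = begin
    - fromℕ (suc (suc (m ℕ.+ n)))       ≡⟨ ≡.cong (λ k → - fromℕ (suc k)) (≡.sym (ℕP.+-suc m n)) ⟩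
    - fromℕ (suc m ℕ.+ suc n)           ≈⟨ -‿cong (fromℕ-+ (suc m) (suc n)) ⟩
    - (fromℕ (suc m) + fromℕ (suc n))   ≈⟨ ⁻¹-∙-comm _ _ ⟨
    - fromℕ (suc m) + - fromℕ (suc n)   ∎

  fromℤ-* : ∀ i j → fromℤ (i ℤ.* j) ≈ fromℤ i * fromℤ j
  fromℤ-* (+ m) (+ n) = begin
    fromℤ (+ m ℤ.* + n) ≡⟨ ≡.cong fromℤ (ℤP.pos-* m n) ⟨
    fromℕ (m ℕ.* n)     ≈⟨ fromℕ-* m n ⟩
    fromℕ m * fromℕ n   ∎
  fromℤ-* (+ m) -[1+ n ] = begin
    fromℤ (+ m ℤ.* (ℤ.- (+ suc n)))   ≡⟨ ≡.cong fromℤ (ℤP.neg-distribʳ-* (+ m) (+ suc n)) ⟨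
    fromℤ (ℤ.- (+ m ℤ.* + suc n))     ≈⟨ fromℤ-neg (+ m ℤ.* + suc n) ⟩
    - fromℤ (+ m ℤ.* + suc n)         ≈⟨ -‿cong (fromℤ-* (+ m) (+ suc n)) ⟩
    - (fromℕ m * fromℕ (suc n))       ≈⟨ -‿distribʳ-* _ _ ⟩
    fromℕ m * - fromℕ (suc n)         ∎
  fromℤ-* -[1+ m ] (+ n) = begin
    fromℤ ((ℤ.- (+ suc m)) ℤ.* + n)   ≡⟨ ≡.cong fromℤ (ℤP.neg-distribˡ-* (+ suc m) (+ n)) ⟨
    fromℤ (ℤ.- (+ suc m ℤ.* + n))     ≈⟨ fromℤ-neg (+ suc m ℤ.* + n) ⟩
    - fromℤ (+ suc m ℤ.* + n)         ≈⟨ -‿cong (fromℤ-* (+ suc m) (+ n)) ⟩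
    - (fromℕ (suc m) * fromℕ n)       ≈⟨ -‿distribˡ-* _ _ ⟩
    - fromℕ (suc m) * fromℕ n         ∎
  fromℤ-* -[1+ m ] -[1+ n ] = begin
    fromℕ (suc m ℕ.* suc n)             ≈⟨ fromℕ-* (suc m) (suc n) ⟩
    fromℕ (suc m) * fromℕ (suc n)       ≈⟨ ⁻¹-involutive _ ⟨
    - - (fromℕ (suc m) * fromℕ (suc n)) ≈⟨ -‿cong (-‿distribˡ-* _ _) ⟩
    - (- fromℕ (suc m) * fromℕ (suc n)) ≈⟨ -‿distribʳ-* _ _ ⟩
    - fromℕ (suc m) * - fromℕ (suc n)   ∎

  private
    almostCommutativeRing : AlmostCommutativeRing 0ℓ 0ℓ
    almostCommutativeRing = fromCommutativeRing commutativeRing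

    -- Agrees with fromℤ, except that 1 is sent to 1# itself and not to 1# + 0#.
    ι : ℤ → ℝ
    ι (+ 1) = 1#
    ι i     = fromℤ i

    ι≈fromℤ : ∀ i → ι i ≈ fromℤ i
    ι≈fromℤ (+ 0)           = refl
    ι≈fromℤ (+ 1)           = sym (+-identityʳ 1#)
    ι≈fromℤ (+ suc (suc n)) = refl
    ι≈fromℤ -[1+ n ]        = refl

    ℤ⟶ℝ : CommutativeRing.rawRing ℤP.+-*-commutativeRing -Raw-AlmostCommutative⟶ almostCommutativeRing
    ℤ⟶ℝ = record
      { ⟦_⟧    = ι
      ; +-homo = λ i j → trans (ι≈fromℤ (i ℤ.+ j)) (trans (fromℤ-+ i j) (sym (+-cong (ι≈fromℤ i) (ι≈fromℤ j))))
      ; *-homo = λ i j → trans (ι≈fromℤ (i ℤ.* j)) (trans (fromℤ-* i j) (sym (*-cong (ι≈fromℤ i) (ι≈fromℤ j))))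
      ; -‿homo = λ i → trans (ι≈fromℤ (ℤ.- i)) (trans (fromℤ-neg i) (sym (-‿cong (ι≈fromℤ i))))
      ; 0-homo = refl
      ; 1-homo = refl }

    ℤ-≟ : ∀ i j → Maybe (ι i ≈ ι j)
    ℤ-≟ i j with i ℤ.≟ j
    ... | yes ≡.refl = just refl
    ... | no  _      = nothing

    module S = RingSolver (CommutativeRing.rawRing ℤP.+-*-commutativeRing) almostCommutativeRing ℤ⟶ℝ ℤ-≟

  open S public using (Polynomial; con; _:+_; _:*_; _:-_; :-_; _:^_)

  -- The arity is left open, so the same variables serve polynomials in any larger number of atoms.
  x₀ : ∀ {n} → Polynomial (1 ℕ.+ n)
  x₁ : ∀ {n} → Polynomial (2 ℕ.+ n)
  x₂ : ∀ {n} → Polynomial (3 ℕ.+ n)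
  x₃ : ∀ {n} → Polynomial (4 ℕ.+ n)
  x₄ : ∀ {n} → Polynomial (5 ℕ.+ n)
  x₅ : ∀ {n} → Polynomial (6 ℕ.+ n)
  x₆ : ∀ {n} → Polynomial (7 ℕ.+ n)
  x₀ = S.var zero
  x₁ = S.var (suc zero)
  x₂ = S.var (suc (suc zero))
  x₃ = S.var (suc (suc (suc zero)))
  x₄ = S.var (suc (suc (suc (suc zero))))
  x₅ = S.var (suc (suc (suc (suc (suc zero)))))
  x₆ = S.var (suc (suc (suc (suc (suc (suc zero))))))

  -- Comparing the normal forms as data, instead of their values in ℝ, keeps the check independent of the atoms ρ.
  solve : ∀ {n} (ρ : Vec ℝ n) (e₁ e₂ : Polynomial n) →
          {_ : T (Maybe.is-just (S.normalise e₁ S.≟N S.normalise e₂))} →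
          S.⟦ e₁ ⟧ ρ ≈ S.⟦ e₂ ⟧ ρ
  solve ρ e₁ e₂ {p} with S.normalise e₁ S.≟N S.normalise e₂
  ... | just eq = S.prove ρ e₁ e₂ (S.⟦ eq ⟧N-cong ρ)

-- Inequalities, absolute values, integer parts and powers.

module OrderedField (em : ∀ {ℓ} → ExcludedMiddle ℓ) (𝓡 : RealNumbers) where

  open Real 𝓡 hiding (zero)
  open Solver 𝓡

  private
    module M = Max totalOrder
    module O = StrictTotalOrderProperties strictTotalOrder
    module Exp = ExpProperties semiring
    open IsStrictTotalOrder isStrictTotalOrder public using (compare; <-respˡ-≈; <-respʳ-≈)
      renaming (trans to <-trans; irrefl to <-irrefl)

  open O public using (≤-respˡ-≈; ≤-respʳ-≈) renaming
    (reflexive to ≤-reflexive; refl to ≤-refl; trans to ≤-trans; antisym to ≤-antisym; total to ≤-total)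

  private variable a b c d x y z : ℝ

  <⇒≤ : x < y → x ≤ y
  <⇒≤ = inj₁

  <-≤-trans : x < y → y ≤ z → x < z
  <-≤-trans x<y (inj₁ y<z) = <-trans x<y y<z
  <-≤-trans x<y (inj₂ y≈z) = <-respʳ-≈ y≈z x<y

  ≤-<-trans : x ≤ y → y < z → x < z
  ≤-<-trans (inj₁ x<y) y<z = <-trans x<y y<z
  ≤-<-trans (inj₂ x≈y) y<z = <-respˡ-≈ (sym x≈y) y<z

  <-or-≥ : ∀ x y → x < y ⊎ y ≤ x
  <-or-≥ x y with compare x y
  ... | tri< x<y _ _ = inj₁ x<y
  ... | tri≈ _ x≈y _ = inj₂ (inj₂ (sym x≈y))
  ... | tri> _ _ y<x = inj₂ (inj₁ y<x)

  <⇒≱ : x < y → ¬ y ≤ x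
  <⇒≱ x<y y≤x = <-irrefl refl (<-≤-trans x<y y≤x)

  ≮⇒≥ : ¬ x < y → y ≤ x
  ≮⇒≥ {x} {y} x≮y = [ (λ x<y → ⊥-elim (x≮y x<y)) , (λ y≤x → y≤x) ]′ (<-or-≥ x y)

  -- A linear inequality is proved by adding up hypotheses and comparing the differences of the two sides.
  <-by : a < b → d - c ≈ b - a → c < d
  <-by {a} {b} {d} {c} a<b eq = <-respʳ-≈ (solve (d ∷ c ∷ []) (x₀ :- x₁ :+ x₁) x₀)
      (<-respˡ-≈ (solve (c ∷ []) (con 0ℤ :+ x₀) x₀) (+-monoˡ-< c 0<d-c))
    where
    0<d-c : 0# < d - c
    0<d-c = <-respʳ-≈ (sym eq) (<-respˡ-≈ (-‿inverseʳ a) (+-monoˡ-< (- a) a<b))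

  ≤-by : a ≤ b → d - c ≈ b - a → c ≤ d
  ≤-by (inj₁ a<b) eq = inj₁ (<-by a<b eq)
  ≤-by {a} {b} {d} {c} (inj₂ a≈b) eq = inj₂ (begin
    c                ≈⟨ +-identityˡ c ⟨
    0# + c           ≈⟨ +-congʳ (trans eq (trans (+-congʳ (sym a≈b)) (-‿inverseʳ a))) ⟨
    (d - c) + c      ≈⟨ (solve (d ∷ c ∷ []) (x₀ :- x₁ :+ x₁) x₀) ⟩
    d                ∎)
    where open import Relation.Binary.Reasoning.Setoid setoid

  infixl 6 _+≤_ _+<_ _<+_ _≤+_
  infixr 7 _*≤_ _*<_

  _≤+_ : a ≤ b → c < d → a + c < b + d
  _≤+_ {a} {b} {c} {d} (inj₁ a<b) c<d = <-trans (+-monoˡ-< _ a<b)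
      (<-by (+-monoˡ-< 0# c<d) (solve (b ∷ d ∷ c ∷ []) (x₀ :+ x₁ :- (x₀ :+ x₂)) (x₁ :+ con 0ℤ :- (x₂ :+ con 0ℤ))))
  _≤+_ {a} {b} {c} {d} (inj₂ a≈b) c<d = <-respˡ-≈ (+-congʳ (sym a≈b))
      (<-by (+-monoˡ-< 0# c<d) (solve (b ∷ d ∷ c ∷ []) (x₀ :+ x₁ :- (x₀ :+ x₂)) (x₁ :+ con 0ℤ :- (x₂ :+ con 0ℤ))))

  _+<_ : a < b → c < d → a + c < b + d
  a<b +< c<d = <⇒≤ a<b ≤+ c<d

  _<+_ : a < b → c ≤ d → a + c < b + d
  _<+_ {a} {b} {c} {d} a<b c≤d = <-by (c≤d ≤+ a<b)
      (solve (b ∷ d ∷ a ∷ c ∷ []) (x₀ :+ x₁ :- (x₂ :+ x₃)) (x₁ :+ x₀ :- (x₃ :+ x₂)))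

  _+≤_ : a ≤ b → c ≤ d → a + c ≤ b + d
  a≤b +≤ inj₁ c<d = inj₁ (a≤b ≤+ c<d)
  inj₁ a<b +≤ inj₂ c≈d = inj₁ (a<b <+ inj₂ c≈d)
  inj₂ a≈b +≤ inj₂ c≈d = inj₂ (+-cong a≈b c≈d)

  _*<_ : 0# < z → x < y → z * x < z * y
  _*<_ {z} {x} {y} 0<z x<y = <-by (*-pos 0<z (<-by x<y eq))
      (solve (z ∷ y ∷ x ∷ []) (x₀ :* x₁ :- x₀ :* x₂) (x₀ :* (x₁ :- x₂) :- con 0ℤ))
    where
    eq : (y - x) - 0# ≈ y - x
    eq = solve (y ∷ x ∷ []) (x₀ :- x₁ :- con 0ℤ) (x₀ :- x₁)

  0≤x*y : 0# ≤ x → 0# ≤ y → 0# ≤ x * y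
  0≤x*y (inj₁ 0<x) (inj₁ 0<y) = inj₁ (*-pos 0<x 0<y)
  0≤x*y {x} {y} (inj₂ 0≈x) _  = inj₂ (trans (sym (zeroˡ y)) (*-congʳ 0≈x))
  0≤x*y {x} {y} _ (inj₂ 0≈y)  = inj₂ (trans (sym (zeroʳ x)) (*-congˡ 0≈y))

  _*≤_ : 0# ≤ z → x ≤ y → z * x ≤ z * y
  _*≤_ {z} {x} {y} 0≤z x≤y = ≤-by (0≤x*y 0≤z (≤-by x≤y eq))
      (solve (z ∷ y ∷ x ∷ []) (x₀ :* x₁ :- x₀ :* x₂) (x₀ :* (x₁ :- x₂) :- con 0ℤ))
    where
    eq : (y - x) - 0# ≈ y - x
    eq = solve (y ∷ x ∷ []) (x₀ :- x₁ :- con 0ℤ) (x₀ :- x₁)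

  *-mono-≤ : 0# ≤ a → a ≤ b → 0# ≤ c → c ≤ d → a * c ≤ b * d
  *-mono-≤ {a} {b} {c} {d} 0≤a a≤b 0≤c c≤d = ≤-by ((≤-trans 0≤a a≤b) *≤ c≤d +≤ 0≤c *≤ a≤b)
      (solve (b ∷ d ∷ a ∷ c ∷ []) (x₀ :* x₁ :- x₂ :* x₃) (x₀ :* x₁ :+ x₃ :* x₀ :- (x₀ :* x₃ :+ x₃ :* x₂)))

  *-cancelˡ-< : 0# ≤ z → z * x < z * y → x < y
  *-cancelˡ-< {z} {x} {y} 0≤z zx<zy with <-or-≥ x y
  ... | inj₁ x<y = x<y
  ... | inj₂ y≤x = ⊥-elim (<⇒≱ zx<zy (0≤z *≤ y≤x))

  *-cancelˡ-≤ : 0# < z → z * x ≤ z * y → x ≤ y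
  *-cancelˡ-≤ {z} {x} {y} 0<z zx≤zy with <-or-≥ y x
  ... | inj₁ y<x = ⊥-elim (<⇒≱ (0<z *< y<x) zx≤zy)
  ... | inj₂ x≤y = x≤y

  0≤1 : 0# ≤ 1#
  0≤1 = <⇒≤ 0<1

  0<x⇒x≉0 : 0# < x → x ≉ 0#
  0<x⇒x≉0 0<x x≈0 = <-irrefl (sym x≈0) 0<x

  x*x⁻¹≈1 : 0# < x → x * x ⁻¹ ≈ 1#
  x*x⁻¹≈1 0<x = ⁻¹-inverseʳ (0<x⇒x≉0 0<x)

  0<x⁻¹ : 0# < x → 0# < x ⁻¹
  0<x⁻¹ {x} 0<x = *-cancelˡ-< (<⇒≤ 0<x) (<-respʳ-≈ (sym (x*x⁻¹≈1 0<x)) (<-respˡ-≈ (sym (zeroʳ x)) 0<1))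

  x÷y*y≈x : ∀ x → 0# < y → x ÷ y * y ≈ x
  x÷y*y≈x {y} x 0<y = begin
    x * y ⁻¹ * y   ≈⟨ (solve (x ∷ (y ⁻¹) ∷ y ∷ []) (x₀ :* x₁ :* x₂) (x₀ :* (x₂ :* x₁))) ⟩
    x * (y * y ⁻¹) ≈⟨ *-congˡ (x*x⁻¹≈1 0<y) ⟩
    x * 1#         ≈⟨ *-identityʳ x ⟩
    x              ∎
    where open import Relation.Binary.Reasoning.Setoid setoid

  ≤÷ : 0# < z → x * z ≤ y → x ≤ y ÷ z
  ≤÷ {z} {x} {y} 0<z xz≤y = *-cancelˡ-≤ 0<z
      (≤-respʳ-≈ (trans (sym (x÷y*y≈x y 0<z)) (*-comm _ _)) (≤-respˡ-≈ (*-comm x z) xz≤y))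

  ÷≤ : 0# < z → y ≤ x * z → y ÷ z ≤ x
  ÷≤ {z} {y} {x} 0<z y≤xz = *-cancelˡ-≤ 0<z
      (≤-respˡ-≈ (trans (sym (x÷y*y≈x y 0<z)) (*-comm _ _)) (≤-respʳ-≈ (*-comm x z) y≤xz))

  <÷ : 0# < z → x * z < y → x < y ÷ z
  <÷ {z} {x} {y} 0<z xz<y = *-cancelˡ-< (<⇒≤ 0<z)
      (<-respʳ-≈ (trans (sym (x÷y*y≈x y 0<z)) (*-comm _ _)) (<-respˡ-≈ (*-comm x z) xz<y))

  ÷< : 0# < z → y < x * z → y ÷ z < x
  ÷< {z} {y} {x} 0<z y<xz = *-cancelˡ-< (<⇒≤ 0<z)
      (<-respˡ-≈ (trans (sym (x÷y*y≈x y 0<z)) (*-comm _ _)) (<-respʳ-≈ (*-comm x z) y<xz))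

  0<x÷y : 0# < x → 0# < y → 0# < x ÷ y
  0<x÷y 0<x 0<y = *-pos 0<x (0<x⁻¹ 0<y)

  *-cancelʳ-≈ : 0# < z → x * z ≈ y * z → x ≈ y
  *-cancelʳ-≈ {z} {x} {y} 0<z eq = ≤-antisym
    (*-cancelˡ-≤ 0<z (inj₂ (trans (*-comm z x) (trans eq (*-comm y z)))))
    (*-cancelˡ-≤ 0<z (inj₂ (trans (*-comm z y) (trans (sym eq) (*-comm x z)))))

  x≤∣x∣ : ∀ x → x ≤ ∣ x ∣
  x≤∣x∣ x = M.x≤x⊔y x (- x)

  -x≤∣x∣ : ∀ x → - x ≤ ∣ x ∣
  -x≤∣x∣ x = M.x≤y⊔x x (- x)

  0≤∣x∣ : ∀ x → 0# ≤ ∣ x ∣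
  0≤∣x∣ x with ≤-total 0# x
  ... | inj₁ 0≤x = ≤-trans 0≤x (x≤∣x∣ x)
  ... | inj₂ x≤0 = ≤-trans (≤-by x≤0 (solve (x ∷ []) ((:- x₀) :- con 0ℤ) (con 0ℤ :- x₀))) (-x≤∣x∣ x)

  ⊔-lub-< : x < z → y < z → x ⊔ y < z
  ⊔-lub-< {x} {z} {y} x<z y<z with M.⊔-sel x y
  ... | inj₁ eq = <-respˡ-≈ (sym eq) x<z
  ... | inj₂ eq = <-respˡ-≈ (sym eq) y<z

  ∣x∣≤ : x ≤ y → - x ≤ y → ∣ x ∣ ≤ y
  ∣x∣≤ = M.⊔-lub

  ∣x∣< : x < y → - x < y → ∣ x ∣ < y
  ∣x∣< = ⊔-lub-<

  ∣∣-cong : x ≈ y → ∣ x ∣ ≈ ∣ y ∣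
  ∣∣-cong x≈y = M.⊔-cong x≈y (-‿cong x≈y)

  0≤x⇒∣x∣≈x : 0# ≤ x → ∣ x ∣ ≈ x
  0≤x⇒∣x∣≈x {x} 0≤x = ≤-antisym (∣x∣≤ ≤-refl
      (≤-by (0≤x +≤ 0≤x) (solve (x ∷ []) (x₀ :- (:- x₀)) (x₀ :+ x₀ :- (con 0ℤ :+ con 0ℤ))))) (x≤∣x∣ x)

  ∣-x∣≈∣x∣ : ∀ x → ∣ - x ∣ ≈ ∣ x ∣
  ∣-x∣≈∣x∣ x = ≤-antisym (∣x∣≤ (-x≤∣x∣ x)
      (≤-by (x≤∣x∣ x) (solve ((∣ x ∣) ∷ x ∷ []) (x₀ :- (:- (:- x₁))) (x₀ :- x₁))))
        (∣x∣≤ (≤-by (-x≤∣x∣ (- x)) (solve ((∣ (- x) ∣) ∷ x ∷ []) (x₀ :- x₁) (x₀ :- (:- (:- x₁))))) (x≤∣x∣ (- x)))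

  x≤0⇒∣x∣≈-x : x ≤ 0# → ∣ x ∣ ≈ - x
  x≤0⇒∣x∣≈-x {x} x≤0 = trans (sym (∣-x∣≈∣x∣ x))
      (0≤x⇒∣x∣≈x (≤-by x≤0 (solve (x ∷ []) ((:- x₀) :- con 0ℤ) (con 0ℤ :- x₀))))

  ∣x+y∣≤ : ∀ x y → ∣ x + y ∣ ≤ ∣ x ∣ + ∣ y ∣
  ∣x+y∣≤ x y = ∣x∣≤ (x≤∣x∣ x +≤ x≤∣x∣ y)
      (≤-by (-x≤∣x∣ x +≤ -x≤∣x∣ y) (solve ((∣ x ∣) ∷ (∣ y ∣) ∷ x ∷ y ∷ []) (x₀ :+ x₁ :- (:- (x₂ :+ x₃)))
        (x₀ :+ x₁ :- ((:- x₂) :+ (:- x₃)))))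

  ∣x*y∣ : ∀ x y → ∣ x * y ∣ ≈ ∣ x ∣ * ∣ y ∣
  ∣x*y∣ x y with ≤-total 0# x | ≤-total 0# y
  ... | inj₁ p | inj₁ q = trans (0≤x⇒∣x∣≈x (0≤x*y p q)) (*-cong (sym (0≤x⇒∣x∣≈x p)) (sym (0≤x⇒∣x∣≈x q)))
  ... | inj₁ p | inj₂ q = trans (x≤0⇒∣x∣≈-x
      (≤-by (p *≤ q) (solve (x ∷ y ∷ []) (con 0ℤ :- x₀ :* x₁) (x₀ :* con 0ℤ :- x₀ :* x₁))))
        (trans (solve (x ∷ y ∷ []) (:- (x₀ :* x₁)) (x₀ :* (:- x₁))) (*-cong (sym (0≤x⇒∣x∣≈x p)) (sym (x≤0⇒∣x∣≈-x q))))
  ... | inj₂ p | inj₁ q = trans (x≤0⇒∣x∣≈-x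
      (≤-by (q *≤ p) (solve (x ∷ y ∷ []) (con 0ℤ :- x₀ :* x₁) (x₁ :* con 0ℤ :- x₁ :* x₀))))
        (trans (solve (x ∷ y ∷ []) (:- (x₀ :* x₁)) ((:- x₀) :* x₁)) (*-cong (sym (x≤0⇒∣x∣≈-x p)) (sym (0≤x⇒∣x∣≈x q))))
  ... | inj₂ p | inj₂ q = trans (0≤x⇒∣x∣≈x
      (≤-by (0≤x*y (≤-by p eq) (≤-by q eq))
        (solve (x ∷ y ∷ []) (x₀ :* x₁ :- con 0ℤ) ((:- x₀) :* (:- x₁) :- con 0ℤ))))
          (trans (solve (x ∷ y ∷ []) (x₀ :* x₁) ((:- x₀) :* (:- x₁)))
            (*-cong (sym (x≤0⇒∣x∣≈-x p)) (sym (x≤0⇒∣x∣≈-x q))))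
    where
    eq : ∀ {x} → - x - 0# ≈ 0# - x
    eq {x} = solve (x ∷ []) ((:- x₀) :- con 0ℤ) (con 0ℤ :- x₀)

  0≤fromℕ : ∀ n → 0# ≤ fromℕ n
  0≤fromℕ zero    = ≤-refl
  0≤fromℕ (suc n) = ≤-by (0≤1 +≤ 0≤fromℕ n)
      (solve ((fromℕ n) ∷ []) (con 1ℤ :+ x₀ :- con 0ℤ) (con 1ℤ :+ x₀ :- (con 0ℤ :+ con 0ℤ)))

  0<fromℕ : ∀ n .{{_ : NonZero n}} → 0# < fromℕ n
  0<fromℕ (suc n) = <-by (0<1 <+ 0≤fromℕ n)
      (solve ((fromℕ n) ∷ []) (con 1ℤ :+ x₀ :- con 0ℤ) (con 1ℤ :+ x₀ :- (con 0ℤ :+ con 0ℤ)))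

  fromℕ-mono-≤ : ∀ {m n} → m ℕ.≤ n → fromℕ m ≤ fromℕ n
  fromℕ-mono-≤ {_} {n} z≤n = 0≤fromℕ n
  fromℕ-mono-≤ (s≤s m≤n)   = ≤-refl +≤ fromℕ-mono-≤ m≤n

  fromℕ-mono-< : ∀ {m n} → m ℕ.< n → fromℕ m < fromℕ n
  fromℕ-mono-< {m} m<n = <-≤-trans (<-by 0<1 (solve ((fromℕ m) ∷ []) (con 1ℤ :+ x₀ :- x₀) (con 1ℤ :- con 0ℤ)))
      (fromℕ-mono-≤ m<n)

  fromℕ-cancel-< : ∀ {m n} → fromℕ m < fromℕ n → m ℕ.< n
  fromℕ-cancel-< {m} {n} m<n with m ℕ.<? n
  ... | yes p = p
  ... | no ¬p = ⊥-elim (<⇒≱ m<n (fromℕ-mono-≤ (ℕP.≮⇒≥ ¬p)))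

  fromℕ-cancel-≤ : ∀ {m n} → fromℕ m ≤ fromℕ n → m ℕ.≤ n
  fromℕ-cancel-≤ {m} {n} m≤n with m ℕ.≤? n
  ... | yes p = p
  ... | no ¬p = ⊥-elim (<⇒≱ (fromℕ-mono-< (ℕP.≰⇒> ¬p)) m≤n)

  1≤fromℕ : ∀ n .{{_ : NonZero n}} → 1# ≤ fromℕ n
  1≤fromℕ (suc n) = ≤-by (0≤fromℕ n) (solve ((fromℕ n) ∷ []) (con 1ℤ :+ x₀ :- con 1ℤ) (x₀ :- con 0ℤ))

  fromℤ-mono-≤ : ∀ {i j} → i ℤ.≤ j → fromℤ i ≤ fromℤ j
  fromℤ-mono-≤ (ℤ.+≤+ m≤n) = fromℕ-mono-≤ m≤n
  fromℤ-mono-≤ (ℤ.-≤- {m} {n} n≤m) = ≤-by (fromℕ-mono-≤ (s≤s n≤m))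
      (solve ((fromℕ n) ∷ (fromℕ m) ∷ []) ((:- (con 1ℤ :+ x₀)) :- (:- (con 1ℤ :+ x₁)))
        (con 1ℤ :+ x₁ :- (con 1ℤ :+ x₀)))
  fromℤ-mono-≤ (ℤ.-≤+ {m} {n}) = ≤-by (0≤fromℕ (suc m) +≤ 0≤fromℕ n)
      (solve ((fromℕ n) ∷ (fromℕ m) ∷ []) (x₀ :- (:- (con 1ℤ :+ x₁))) (con 1ℤ :+ x₁ :+ x₀ :- (con 0ℤ :+ con 0ℤ)))

  fromℤ-mono-< : ∀ {i j} → i ℤ.< j → fromℤ i < fromℤ j
  fromℤ-mono-< {i} i<j = <-≤-trans
      (<-respʳ-≈ (sym (fromℤ-+ 1ℤ i))
        (<-by 0<1 (solve ((fromℤ i) ∷ []) (con 1ℤ :+ con (+ 0) :+ x₀ :- x₀) (con 1ℤ :- con 0ℤ))))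
          (fromℤ-mono-≤ (ℤP.i<j⇒suc[i]≤j i<j))

  fromℤ-injective : ∀ {i j} → fromℤ i ≈ fromℤ j → i ≡ j
  fromℤ-injective {i} {j} eq with ℤP.<-cmp i j
  ... | tri< i<j _ _ = ⊥-elim (<-irrefl eq (fromℤ-mono-< i<j))
  ... | tri≈ _ i≡j _ = i≡j
  ... | tri> _ _ j<i = ⊥-elim (<-irrefl (sym eq) (fromℤ-mono-< j<i))

  opaque
    -- If the natural numbers were bounded, their supremum s would satisfy n + 1 ≤ s for all n, and
    -- s - 1 would be a smaller upper bound.
    archimedean : ∀ x → ∃[ n ] x < fromℕ n
    archimedean x with em {P = ∃[ n ] x < fromℕ n}
    ... | yes p = p
    ... | no ¬p with supremum (λ y → ∃[ n ] y ≈ fromℕ n) (0# , 0 , refl)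
        (x , λ (n , eq) → ≤-respˡ-≈ (sym eq) (≮⇒≥ (λ x<n → ¬p (n , x<n))))
    ...   | s , ub , least = ⊥-elim
        (<⇒≱ {s - 1#} {s} (<-by 0<1 (solve (s ∷ []) (x₀ :- (x₀ :- con 1ℤ)) (con 1ℤ :- con 0ℤ))) (least ub-1))
      where
      ub-1 : ∀ {y} → ∃[ n ] y ≈ fromℕ n → y ≤ s - 1#
      ub-1 (n , eq) = ≤-respˡ-≈ (sym eq)
          (≤-by (ub (suc n , refl)) (solve (s ∷ (fromℕ n) ∷ []) (x₀ :- con 1ℤ :- x₁) (x₀ :- (con 1ℤ :+ x₁))))

  private
    floor≥0 : ∀ n x → 0# ≤ x → x < fromℕ n → ∃[ m ] fromℕ m ≤ x × x < fromℕ (suc m)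
    floor≥0 zero    x 0≤x x<0 = ⊥-elim (<⇒≱ x<0 0≤x)
    floor≥0 (suc n) x 0≤x x<n with <-or-≥ x (fromℕ n)
    ... | inj₁ x<n′ = floor≥0 n x 0≤x x<n′
    ... | inj₂ n≤x  = n , n≤x , x<n

  opaque
    floorℕ : ∀ x → 0# ≤ x → ∃[ m ] fromℕ m ≤ x × x < fromℕ (suc m)
    floorℕ x 0≤x = let n , x<n = archimedean x in floor≥0 n x 0≤x x<n

  opaque
    -- Adding a natural number above - x reduces this to the nonnegative case.
    floor : ∀ x → ∃[ i ] fromℤ i ≤ x × x < fromℤ i + 1#
    floor x with archimedean (- x)
    ... | n , -x<n with floorℕ (x + fromℕ n)
        (<⇒≤ (<-by -x<n (solve (x ∷ (fromℕ n) ∷ []) (x₀ :+ x₁ :- con 0ℤ) (x₁ :- (:- x₀)))))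
    ...   | m , m≤ , <m = m ℤ.⊖ n , ≤-respˡ-≈ (sym (fromℤ-⊖ m n))
        (≤-by m≤ (solve (x ∷ (fromℕ m) ∷ (fromℕ n) ∷ []) (x₀ :- (x₁ :- x₂)) (x₀ :+ x₂ :- x₁))) , <-respʳ-≈
          (+-congʳ (sym (fromℤ-⊖ m n))) (<-by <m
            (solve ((fromℕ m) ∷ (fromℕ n) ∷ x ∷ []) (x₀ :+ (:- x₁) :+ con 1ℤ :- x₂) (con 1ℤ :+ x₀ :- (x₂ :+ x₁))))

  ^-cong : ∀ n → x ≈ y → x ^ n ≈ y ^ n
  ^-cong n x≈y = Exp.^-congˡ n x≈y

  ^-+ : ∀ x m n → x ^ (m ℕ.+ n) ≈ x ^ m * x ^ n
  ^-+ = Exp.^-homo-*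

  *-^ : ∀ x y n → (x * y) ^ n ≈ x ^ n * y ^ n
  *-^ x y zero    = sym (*-identityˡ 1#)
  *-^ x y (suc n) = trans (*-congˡ (*-^ x y n))
      (solve (x ∷ y ∷ (x ^ n) ∷ (y ^ n) ∷ []) (x₀ :* x₁ :* (x₂ :* x₃)) (x₀ :* x₂ :* (x₁ :* x₃)))

  ^-* : ∀ x m n → x ^ (m ℕ.* n) ≈ (x ^ m) ^ n
  ^-* x m n = sym (Exp.^-assocʳ x m n)

  0<x^n : ∀ n → 0# < x → 0# < x ^ n
  0<x^n zero    0<x = 0<1
  0<x^n (suc n) 0<x = *-pos 0<x (0<x^n n 0<x)

  0≤x^n : ∀ n → 0# ≤ x → 0# ≤ x ^ n
  0≤x^n zero    0≤x = 0≤1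
  0≤x^n (suc n) 0≤x = 0≤x*y 0≤x (0≤x^n n 0≤x)

  ^-mono-≤ : ∀ n → 0# ≤ x → x ≤ y → x ^ n ≤ y ^ n
  ^-mono-≤ zero    0≤x x≤y = ≤-refl
  ^-mono-≤ (suc n) 0≤x x≤y = *-mono-≤ 0≤x x≤y (0≤x^n n 0≤x) (^-mono-≤ n 0≤x x≤y)

  1≤x^n : ∀ n → 1# ≤ x → 1# ≤ x ^ n
  1≤x^n zero    1≤x = ≤-refl
  1≤x^n (suc n) 1≤x = ≤-respˡ-≈ (*-identityˡ 1#) (*-mono-≤ 0≤1 1≤x 0≤1 (1≤x^n n 1≤x))

  x^n≤1 : ∀ n → 0# ≤ x → x ≤ 1# → x ^ n ≤ 1#
  x^n≤1 zero    0≤x x≤1 = ≤-refl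
  x^n≤1 (suc n) 0≤x x≤1 = ≤-respʳ-≈ (*-identityˡ 1#) (*-mono-≤ 0≤x x≤1 (0≤x^n n 0≤x) (x^n≤1 n 0≤x x≤1))

  fromℕ-^ : ∀ m n → fromℕ (m ℕ.^ n) ≈ fromℕ m ^ n
  fromℕ-^ m zero    = +-identityʳ 1#
  fromℕ-^ m (suc n) = trans (fromℕ-* m (m ℕ.^ n)) (*-congˡ (fromℕ-^ m n))

  ^-antitone : ∀ {m n} → 0# ≤ x → x ≤ 1# → m ℕ.≤ n → x ^ n ≤ x ^ m
  ^-antitone {x} {m} {n} 0≤x x≤1 m≤n = ≤-respˡ-≈
      (trans (sym (^-+ x m (n ℕ.∸ m))) (reflexive (≡.cong (x ^_) (ℕP.m+[n∸m]≡n m≤n))))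
    (≤-respʳ-≈ (*-identityʳ _) (0≤x^n m 0≤x *≤ x^n≤1 (n ℕ.∸ m) 0≤x x≤1))

  private
    bernoulli : ∀ n → 0# ≤ x → 1# + fromℕ n * x ≤ (1# + x) ^ n
    bernoulli {x} zero    0≤x = ≤-reflexive (solve (x ∷ []) (con 1ℤ :+ con 0ℤ :* x₀) (con 1ℤ))
    bernoulli {x} (suc n) 0≤x = ≤-trans step (0≤1+x *≤ bernoulli n 0≤x)
      where
      0≤1+x : 0# ≤ 1# + x
      0≤1+x = ≤-by (0≤1 +≤ 0≤x) (solve (x ∷ []) (con 1ℤ :+ x₀ :- con 0ℤ) (con 1ℤ :+ x₀ :- (con 0ℤ :+ con 0ℤ)))
      step : 1# + fromℕ (suc n) * x ≤ (1# + x) * (1# + fromℕ n * x)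
      step = ≤-by (0≤x*y (0≤fromℕ n) (0≤x*y 0≤x 0≤x))
          (solve (x ∷ (fromℕ n) ∷ []) ((con 1ℤ :+ x₀) :* (con 1ℤ :+ x₁ :* x₀) :-
            (con 1ℤ :+ (con 1ℤ :+ x₁) :* x₀)) (x₁ :* (x₀ :* x₀) :- con 0ℤ))

  -- By Bernoulli's inequality for 1/t = 1 + u.
  opaque
    ^-small : ∀ {t ε} → 0# < t → t < 1# → 0# < ε → ∃[ n ] t ^ n < ε
    ^-small {t} {ε} 0<t t<1 0<ε = n , *-cancelˡ-< (<⇒≤ (0<x^n n (0<x⁻¹ 0<t))) (<-respˡ-≈ (sym one) 1<)
      where
      u : ℝ
      u = t ⁻¹ - 1#
      0<u : 0# < u
      0<u = *-cancelˡ-< (<⇒≤ 0<t) (<-by t<1 (begin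
        t * u - t * 0#             ≈⟨ (solve (t ∷ (t ⁻¹) ∷ []) (x₀ :* (x₁ :+ (:- con 1ℤ)) :- x₀ :* con 0ℤ)
            (x₀ :* x₁ :- x₀)) ⟩
        t * t ⁻¹ - t               ≈⟨ +-congʳ (x*x⁻¹≈1 0<t) ⟩
        1# - t                     ∎))
        where open import Relation.Binary.Reasoning.Setoid setoid
      e : ∃[ n ] (ε * u) ⁻¹ < fromℕ n
      e = archimedean ((ε * u) ⁻¹)
      n : ℕ
      n = proj₁ e
      one : (t ⁻¹) ^ n * t ^ n ≈ 1#
      one = trans (sym (*-^ (t ⁻¹) t n)) (trans (^-cong n (trans (*-comm _ _) (x*x⁻¹≈1 0<t))) (1^ n))
        where
        1^ : ∀ n → 1# ^ n ≈ 1#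
        1^ zero    = refl
        1^ (suc n) = trans (*-identityˡ _) (1^ n)
      1<n*εu : 1# < fromℕ n * (ε * u)
      1<n*εu = <-respˡ-≈ (x*x⁻¹≈1 (*-pos 0<ε 0<u)) (<-respʳ-≈ (*-comm _ _) (*-pos 0<ε 0<u *< proj₂ e))
      1+u≈t⁻¹ : 1# + u ≈ t ⁻¹
      1+u≈t⁻¹ = solve ((t ⁻¹) ∷ []) (con 1ℤ :+ (x₀ :+ (:- con 1ℤ))) x₀
      step : fromℕ n * (ε * u) ≤ ε * (1# + fromℕ n * u)
      step = ≤-by (<⇒≤ 0<ε) (solve (ε ∷ (fromℕ (n)) ∷ (t ⁻¹) ∷ [])
          (x₀ :* (con 1ℤ :+ x₁ :* (x₂ :+ (:- con 1ℤ))) :- x₁ :* (x₀ :* (x₂ :+ (:- con 1ℤ)))) (x₀ :- con 0ℤ))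
      1< : 1# < (t ⁻¹) ^ n * ε
      1< = <-≤-trans 1<n*εu (≤-trans step
        (≤-respʳ-≈ (trans (*-congˡ (^-cong n 1+u≈t⁻¹)) (*-comm _ _)) (<⇒≤ 0<ε *≤ bernoulli n (<⇒≤ 0<u))))

-- Classical logic.

module Classical (em : ∀ {ℓ} → ExcludedMiddle ℓ) where

  opaque
    ¬∀⇒∃¬ : ∀ {a b} {A : Set a} {B : A → Set b} → ¬ (∀ x → B x) → ∃[ x ] ¬ B x
    ¬∀⇒∃¬ {A = A} {B} ¬∀ with em {P = ∃[ x ] ¬ B x}
    ... | yes p = p
    ... | no ¬∃ = ⊥-elim (¬∀ λ x → case em {P = B x} of λ where
      (yes b) → b
      (no ¬b) → ⊥-elim (¬∃ (x , ¬b)))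

  opaque
    by-contradiction : ∀ {a} {A : Set a} → ¬ ¬ A → A
    by-contradiction {A = A} ¬¬a with em {P = A}
    ... | yes a = a
    ... | no ¬a = ⊥-elim (¬¬a ¬a)

-- The supremum metric and compact sets.

module Space (em : ∀ {ℓ} → ExcludedMiddle ℓ) (𝓡 : RealNumbers) where

  open Real 𝓡 hiding (zero)
  open Solver 𝓡
  open OrderedField em 𝓡
  open Classical em

  private
    module M = Max totalOrder
    variable
      d : ℕ
      x y z x′ y′ : ℝ^ d

  0≤maximum : ∀ {n} (x : Vector ℝ n) → 0# ≤ maximum x
  0≤maximum {zero}  x = ≤-refl
  0≤maximum {suc n} x = ≤-trans (0≤maximum (x ∘ suc)) (M.x≤y⊔x (x zero) _)

  ≤maximum : ∀ {n} (x : Vector ℝ n) i → x i ≤ maximum x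
  ≤maximum x zero    = M.x≤x⊔y (x zero) _
  ≤maximum x (suc i) = ≤-trans (≤maximum (x ∘ suc) i) (M.x≤y⊔x (x zero) _)

  maximum≤ : ∀ {n} (x : Vector ℝ n) {b} → 0# ≤ b → (∀ i → x i ≤ b) → maximum x ≤ b
  maximum≤ {zero}  x 0≤b x≤b = 0≤b
  maximum≤ {suc n} x 0≤b x≤b = M.⊔-lub (x≤b zero) (maximum≤ (x ∘ suc) 0≤b (x≤b ∘ suc))

  maximum< : ∀ {n} (x : Vector ℝ n) {b} → 0# < b → (∀ i → x i < b) → maximum x < b
  maximum< {zero}  x 0<b x<b = 0<b
  maximum< {suc n} x 0<b x<b = ⊔-lub-< (x<b zero) (maximum< (x ∘ suc) 0<b (x<b ∘ suc))

  ∣xᵢ∣≤‖x‖ : (x : ℝ^ d) → ∀ i → ∣ x i ∣ ≤ ‖ x ‖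
  ∣xᵢ∣≤‖x‖ x = ≤maximum (λ i → ∣ x i ∣)

  ‖‖≤ : ∀ {b} → 0# ≤ b → (∀ i → ∣ x i ∣ ≤ b) → ‖ x ‖ ≤ b
  ‖‖≤ {x = x} = maximum≤ (λ i → ∣ x i ∣)

  ‖‖< : ∀ {b} → 0# < b → (∀ i → ∣ x i ∣ < b) → ‖ x ‖ < b
  ‖‖< {x = x} = maximum< (λ i → ∣ x i ∣)

  0≤‖x‖ : (x : ℝ^ d) → 0# ≤ ‖ x ‖
  0≤‖x‖ x = 0≤maximum (λ i → ∣ x i ∣)

  ‖‖-mono : (∀ i → ∣ x i ∣ ≤ ∣ y i ∣) → ‖ x ‖ ≤ ‖ y ‖
  ‖‖-mono {x = x} {y = y} x≤y = ‖‖≤ {x = x} (0≤‖x‖ y) (λ i → ≤-trans (x≤y i) (∣xᵢ∣≤‖x‖ y i))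

  ‖‖-cong : x ≋ y → ‖ x ‖ ≈ ‖ y ‖
  ‖‖-cong x≋y = ≤-antisym (‖‖-mono (λ i → inj₂ (∣∣-cong (x≋y i)))) (‖‖-mono (λ i → inj₂ (∣∣-cong (sym (x≋y i)))))

  ≋-sym : x ≋ y → y ≋ x
  ≋-sym p i = sym (p i)

  ≋-trans : x ≋ y → y ≋ z → x ≋ z
  ≋-trans p q i = trans (p i) (q i)

  ≋-refl : x ≋ x
  ≋-refl i = refl

  -- Opaque, so that the type checker compares distances without unfolding the norm.
  opaque

    dist : ℝ^ d → ℝ^ d → ℝ
    dist x y = ‖ x ⊖ y ‖

    dist≡‖⊖‖ : (x y : ℝ^ d) → dist x y ≡ ‖ x ⊖ y ‖
    dist≡‖⊖‖ x y = ≡.refl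

    0≤dist : (x y : ℝ^ d) → 0# ≤ dist x y
    0≤dist x y = 0≤‖x‖ (x ⊖ y)

    ∣-∣≤dist : (x y : ℝ^ d) → ∀ i → ∣ x i - y i ∣ ≤ dist x y
    ∣-∣≤dist x y = ∣xᵢ∣≤‖x‖ (x ⊖ y)

    dist≤ : (x y : ℝ^ d) → ∀ {b} → 0# ≤ b → (∀ i → ∣ x i - y i ∣ ≤ b) → dist x y ≤ b
    dist≤ x y = ‖‖≤ {x = x ⊖ y}

    dist< : (x y : ℝ^ d) → ∀ {b} → 0# < b → (∀ i → ∣ x i - y i ∣ < b) → dist x y < b
    dist< x y = ‖‖< {x = x ⊖ y}

    dist-cong : x ≋ x′ → y ≋ y′ → dist x y ≈ dist x′ y′
    dist-cong p q = ‖‖-cong (λ i → +-cong (p i) (-‿cong (q i)))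

  dist-sym : (x y : ℝ^ d) → dist x y ≈ dist y x
  dist-sym x y = ≤-antisym (half x y) (half y x)
    where
    half : ∀ x y → dist x y ≤ dist y x
    half x y = dist≤ x y (0≤dist y x) λ i → ≤-respˡ-≈ (trans (sym (∣-x∣≈∣x∣ _)) (∣∣-cong (lem (y i) (x i))))
        (∣-∣≤dist y x i)
      where
      lem : ∀ a b → - (a - b) ≈ b - a
      lem a b = solve (a ∷ b ∷ []) (:- (x₀ :- x₁)) (x₁ :- x₀)

  dist-triangle : (x y z : ℝ^ d) → dist x z ≤ dist x y + dist y z
  dist-triangle x y z = dist≤ x z
      (≤-by (0≤dist x y +≤ 0≤dist y z)
        (solve ((dist x y) ∷ (dist y z) ∷ []) (x₀ :+ x₁ :- con 0ℤ) (x₀ :+ x₁ :- (con 0ℤ :+ con 0ℤ)))) λ i →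
    ≤-respˡ-≈ (∣∣-cong (lem (x i) (y i) (z i)))
        (≤-trans (∣x+y∣≤ (x i - y i) (y i - z i)) (∣-∣≤dist x y i +≤ ∣-∣≤dist y z i))
    where
    lem : ∀ a b c → (a - b) + (b - c) ≈ a - c
    lem a b c = solve (a ∷ b ∷ c ∷ []) (x₀ :- x₁ :+ (x₁ :- x₂)) (x₀ :- x₂)

  ≋⇒dist≈0 : x ≋ y → dist x y ≈ 0#
  ≋⇒dist≈0 {x = x} {y = y} x≋y = ≤-antisym
    (dist≤ x y ≤-refl λ i → inj₂ (trans (∣∣-cong (trans (+-congʳ (x≋y i)) (-‿inverseʳ (y i)))) (0≤x⇒∣x∣≈x ≤-refl)))
    (0≤dist x y)

  dist≤0⇒≋ : dist x y ≤ 0# → x ≋ y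
  dist≤0⇒≋ {x = x} {y = y} le i = ≤-antisym
    (≤-by (≤-trans (x≤∣x∣ (x i - y i)) (≤-trans (∣-∣≤dist x y i) le))
        (solve ((y i) ∷ (x i) ∷ []) (x₀ :- x₁) (con 0ℤ :- (x₁ :- x₀))))
    (≤-by (≤-trans (-x≤∣x∣ (x i - y i)) (≤-trans (∣-∣≤dist x y i) le))
        (solve ((x i) ∷ (y i) ∷ []) (x₀ :- x₁) (con 0ℤ :- (:- (x₀ :- x₁)))))

  0<dist : ¬ x ≋ y → 0# < dist x y
  0<dist x≉y = [ (λ p → p) , (λ p → ⊥-elim (x≉y (dist≤0⇒≋ p))) ]′ (<-or-≥ 0# _)

  ≤-ε⇒≤0 : ∀ {a} → (∀ ε → 0# < ε → a ≤ ε) → a ≤ 0#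
  ≤-ε⇒≤0 {a} a≤ε with <-or-≥ 0# a
  ... | inj₂ p = p
  ... | inj₁ 0<a = ⊥-elim (<⇒≱ half<a (a≤ε half (0<x÷y 0<a 0<2)))
    where
    0<2 : 0# < fromℕ 2
    0<2 = 0<fromℕ 2
    half : ℝ
    half = a ÷ fromℕ 2
    half<a : half < a
    half<a = ÷< 0<2 (<-by 0<a (solve (a ∷ []) (x₀ :* con (+ 2) :- x₀) (x₀ :- con 0ℤ)))

  opaque
    halve : ∀ {ε} → 0# < ε → ∃[ δ ] 0# < δ × δ + δ ≈ ε
    halve {ε} 0<ε = ε ÷ fromℕ 2 , 0<x÷y 0<ε (0<fromℕ 2) , trans lem (x÷y*y≈x ε (0<fromℕ 2))
      where
      lem : ε ÷ fromℕ 2 + ε ÷ fromℕ 2 ≈ ε ÷ fromℕ 2 * fromℕ 2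
      lem = solve (ε ∷ ((fromℕ (2)) ⁻¹) ∷ []) (x₀ :* x₁ :+ x₀ :* x₁) (x₀ :* x₁ :* con (+ 2))

  1/1+_ : ℕ → ℝ
  1/1+ n = fromℕ (suc n) ⁻¹

  0<1/1+n : ∀ n → 0# < 1/1+ n
  0<1/1+n n = 0<x⁻¹ (0<fromℕ (suc n))

  opaque
    1/1+n-small : ∀ {ε} → 0# < ε → ∃[ N ] ∀ n → N ℕ.≤ n → 1/1+ n < ε
    1/1+n-small {ε} 0<ε with archimedean (ε ⁻¹)
    ... | N , ε⁻¹<N = N , λ n N≤n → *-cancelˡ-< (0≤fromℕ (suc n)) (<-respˡ-≈ (sym (x*x⁻¹≈1 (0<fromℕ (suc n))))
      (<-respˡ-≈ (x*x⁻¹≈1 0<ε) (<-respʳ-≈ (*-comm ε _)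
          (0<ε *< <-≤-trans ε⁻¹<N (fromℕ-mono-≤ (ℕP.≤-trans N≤n (ℕP.n≤1+n n)))))))

  -- Cluster points take the place of limits: compactness yields them directly, without choosing a
  -- subsequence.
  IsClusterPoint : (ℕ → ℝ^ d) → ℝ^ d → Set
  IsClusterPoint u z = ∀ ε → 0# < ε → ∀ N → ∃[ n ] N ℕ.≤ n × dist z (u n) < ε

  ball-open : (z : ℝ^ d) (ε : ℝ) → IsOpen (λ y → dist z y < ε)
  ball-open z ε {y} zy<ε = ε - dist z y , <-by zy<ε (solve (ε ∷ (dist z y) ∷ []) (x₀ :- x₁ :- con 0ℤ) (x₀ :- x₁)) , λ {w} yw< →
    ≤-<-trans (dist-triangle z y w)
        (<-by (≡.subst (_< ε - dist z y) (≡.sym (dist≡‖⊖‖ y w)) yw<)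
          (solve (ε ∷ (dist z y) ∷ (dist y w) ∷ []) (x₀ :- (x₁ :+ x₂)) (x₀ :- x₁ :- x₂)))

  module Compact {d} {S : Pred (ℝ^ d) 0ℓ} (compact : IsCompact S) (resp : ∀ {x y} → x ≋ y → x ∈ S → y ∈ S) where

    opaque
      -- Otherwise every point of S has a ball that the sequence leaves for good from some index on.
      -- Finitely many of these balls cover S, and past the sum of their indices the sequence would
      -- have no place left in S.
      cluster : (u : ℕ → ℝ^ d) → (∀ n → u n ∈ S) → ∃[ z ] z ∈ S × IsClusterPoint u z
      cluster u u∈S = by-contradiction absurd
        where
        -- The index of a ball carries the proof that the sequence leaves it, so a finite subcover
        -- brings its bounds along.
        I : Set
        I = ∃[ z ] ∃[ ε ] ∃[ N ] 0# < ε × (∀ n → N ℕ.≤ n → ε ≤ dist z (u n))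
        U : I → Pred (ℝ^ d) 0ℓ
        U (z , ε , _) y = dist z y < ε
        bound : List I → ℕ
        bound []                     = 0
        bound ((_ , _ , N , _) ∷ is) = N ℕ.+ bound is
        avoids : ∀ is n → bound is ℕ.≤ n → ¬ Any (λ i → U i (u n)) is
        avoids ((z , ε , N , _ , far) ∷ is) n b≤n (here zu<ε) = <⇒≱ zu<ε (far n (ℕP.≤-trans (ℕP.m≤m+n N _) b≤n))
        avoids ((z , ε , N , _) ∷ is) n b≤n (there a) = avoids is n (ℕP.≤-trans (ℕP.m≤n+m _ N) b≤n) a
        absurd : ¬ (∃[ z ] z ∈ S × IsClusterPoint u z) → ⊥
        absurd ¬cluster = avoids (proj₁ subcover) (bound (proj₁ subcover)) ℕP.≤-refl (proj₂ subcover (u∈S _))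
          where
          cover : ∀ {z} → z ∈ S → ∃[ i ] U i z
          cover {z} z∈S = case ¬∀⇒∃¬ (λ c → ¬cluster (z , z∈S , c)) of λ where
            (ε , p) → case ¬∀⇒∃¬ p of λ where
              (0<ε , q) → case ¬∀⇒∃¬ q of λ where
                (N , r) → (z , ε , N , 0<ε , λ n N≤n → ≮⇒≥ (λ lt → r (n , N≤n , lt))) ,
                  <-respˡ-≈ (sym (≋⇒dist≈0 {x = z} {y = z} ≋-refl)) 0<ε
          subcover : ∃[ is ] (∀ {z} → z ∈ S → Any (λ i → U i z) is)
          subcover = compact U (λ (z , ε , _) → ball-open z ε) cover

    -- Not an isolated point of S: x has positive distance from all of S and so lies outside it.
    Isolated : ℝ^ d → Set
    Isolated x = ∃[ ε ] 0# < ε × (∀ {y} → y ∈ S → ε ≤ dist x y)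

    Adherent : ℝ^ d → Set
    Adherent x = ∀ n → ∃[ y ] y ∈ S × dist x y < 1/1+ n

    -- A sequence in S approaching x has a cluster point in S, and this can only be x.
    adherent⇒∈ : ∀ {x} → Adherent x → x ∈ S
    adherent⇒∈ {x} near = case cluster (proj₁ ∘ near) (λ n → proj₁ (proj₂ (near n))) of λ where
        (z , z∈S , close) → resp (dist≤0⇒≋ {x = z} {y = x} (≤-ε⇒≤0 (zx≤ε z close))) z∈S
      where
      zx≤ε : ∀ z → IsClusterPoint (proj₁ ∘ near) z → ∀ ε → 0# < ε → dist z x ≤ ε
      zx≤ε z close ε 0<ε = case halve 0<ε of λ where
        (δ , 0<δ , δ+δ≈ε) → case 1/1+n-small 0<δ of λ where
          (N , small) → case close δ 0<δ N of λ where
            (n , N≤n , zy<δ) → ≤-respʳ-≈ δ+δ≈ε (≤-trans (dist-triangle z (proj₁ (near n)) x)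
               (<⇒≤ zy<δ +≤ ≤-respˡ-≈ (dist-sym x _) (<⇒≤ (<-trans (proj₂ (proj₂ (near n))) (small n N≤n)))))

    ¬isolated⇒adherent : ∀ {x} → ¬ Isolated x → Adherent x
    ¬isolated⇒adherent ¬isolated n = by-contradiction λ ¬near →
      ¬isolated (1/1+ n , 0<1/1+n n , λ {y} y∈S → ≮⇒≥ λ lt → ¬near (y , y∈S , lt))

    opaque
      closed : ∀ {x} → x ∉ S → Isolated x
      closed x∉S = by-contradiction λ ¬isolated → x∉S (adherent⇒∈ (¬isolated⇒adherent ¬isolated))

    opaque
      -- Points of S at distance more than n from c, one for each n, could not cluster anywhere.
      bounded : (c : ℝ^ d) → ∃[ M ] 0# ≤ M × (∀ {x} → x ∈ S → dist c x ≤ M)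
      bounded c = by-contradiction λ unbounded → absurd λ n → by-contradiction λ ¬far →
        unbounded (fromℕ n , 0≤fromℕ n , λ {x} x∈S → ≮⇒≥ λ lt → ¬far (x , x∈S , lt))
        where
        absurd : (∀ n → ∃[ x ] x ∈ S × fromℕ n < dist c x) → ⊥
        absurd far = case cluster (proj₁ ∘ far) (λ n → proj₁ (proj₂ (far n))) of λ where
          (z , _ , close) → case archimedean (dist c z + 1#) of λ where
            (N , cz+1<N) → case close 1# 0<1 N of λ where
              (n , N≤n , zx<1) → <⇒≱ (<-trans (<-≤-trans cz+1<N (fromℕ-mono-≤ N≤n)) (proj₂ (proj₂ (far n))))
                (≤-trans (dist-triangle c z (proj₁ (far n))) (≤-refl +≤ <⇒≤ zx<1))

-- Orbits of an injection of a finite set.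

fold-injective : ∀ {a} {A : Set a} (k : A → A) → (∀ {i j} → k i ≡ k j → i ≡ j) →
                 ∀ n {i j} → ℕG.fold i k n ≡ ℕG.fold j k n → i ≡ j
fold-injective k inj zero    eq = eq
fold-injective k inj (suc n) eq = fold-injective k inj n (inj eq)

opaque
  -- Two of the first d + 1 iterates of i agree, and cancelling the steps before the earlier one
  -- moves the repetition back to i.
  injective⇒periodic : ∀ {d} (k : Fin d → Fin d) → (∀ {i j} → k i ≡ k j → i ≡ j) →
                       ∀ i → ∃[ c ] ℕG.fold i k (suc c) ≡ i
  injective⇒periodic {d} k inj i
    with a , b , a<b , eq ← FinP.pigeonhole (ℕP.n<1+n d) (λ n → ℕG.fold i k (Fin.toℕ n))
    with c , b≡ ← ℕP.m≤n⇒∃[o]m+o≡n a<b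
    = c , ≡.sym (fold-injective k inj (Fin.toℕ a)
        (≡.trans eq (≡.trans (≡.cong (ℕG.fold i k) (≡.trans (≡.sym b≡) (≡.sym (ℕP.+-suc _ c))))
        (ℕG.fold-+ i k (Fin.toℕ a)))))

-- The field of rational numbers inside ℝ.

module Rationals (em : ∀ {ℓ} → ExcludedMiddle ℓ) (𝓡 : RealNumbers) where

  open Real 𝓡 hiding (zero)
  open Solver 𝓡
  open OrderedField em 𝓡
  private
    module ≈R where open import Relation.Binary.Reasoning.Setoid setoid public
    variable x y z : ℝ

  IsRational : ℝ → Set
  IsRational x = ∃[ p ] ∃[ n ] x * fromℕ (suc n) ≈ fromℤ p

  isRational : ∀ p n → 0# < fromℕ n → x * fromℕ n ≈ fromℤ p → IsRational x
  isRational p zero    0<0 eq = ⊥-elim (<-irrefl refl 0<0)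
  isRational p (suc n) _   eq = p , n , eq

  -- The quotient is stored in lowest terms, so the cancelled gcd has to be multiplied back.
  fromℚ-/ : ∀ i n .{{_ : NonZero n}} → fromℚ (i ℚ./ n) * fromℕ n ≈ fromℤ i
  fromℚ-/ i n = begin
    fromℚ q * fromℤ (+ n)                ≡⟨ ≡.cong (λ m → fromℚ q * fromℤ m) (ℚP.↧-/ i n) ⟨
    fromℚ q * fromℤ (↧ q ℤ.* g)          ≈⟨ *-congˡ (fromℤ-* (↧ q) g) ⟩
    fromℚ q * (fromℤ (↧ q) * fromℤ g)    ≈⟨ *-assoc _ _ _ ⟨
    fromℚ q * fromℕ (↧ₙ q) * fromℤ g     ≈⟨ *-congʳ (x÷y*y≈x (fromℤ (↥ q)) (0<fromℕ (↧ₙ q))) ⟩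
    fromℤ (↥ q) * fromℤ g                ≈⟨ fromℤ-* (↥ q) g ⟨
    fromℤ (↥ q ℤ.* g)                    ≡⟨ ≡.cong fromℤ (ℚP.↥-/ i n) ⟩
    fromℤ i                              ∎
    where
    open ≈R
    q : ℚ
    q = i ℚ./ n
    g : ℤ
    g = ℤG.gcd i (+ n)

  opaque
    IsRational⇒ℚ : IsRational x → ∃[ q ] x ≈ fromℚ q
    IsRational⇒ℚ (p , n , eq) = p ℚ./ suc n , *-cancelʳ-≈ (0<fromℕ (suc n)) (trans eq (sym (fromℚ-/ p (suc n))))

  opaque
    ℚ⇒IsRational : ∀ q → IsRational (fromℚ q)
    ℚ⇒IsRational (ℚ.mkℚ p n _) = p , n , x÷y*y≈x (fromℤ p) (0<fromℕ (suc n))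

  IsRational-resp : x ≈ y → IsRational x → IsRational y
  IsRational-resp x≈y (p , n , eq) = p , n , trans (*-congʳ (sym x≈y)) eq

  IsRational-ℤ : ∀ i → IsRational (fromℤ i)
  IsRational-ℤ i = i , 0 , (solve ((fromℤ i) ∷ []) (x₀ :* (con 1ℤ :+ con (+ 0))) x₀)

  IsRational-+ : IsRational x → IsRational y → IsRational (x + y)
  IsRational-+ {x} {y} (p , m , eq) (q , n , eq′) =
    isRational (p ℤ.* + suc n ℤ.+ q ℤ.* + suc m) (suc m ℕ.* suc n)
        (<-respʳ-≈ (sym (fromℕ-* (suc m) (suc n))) (*-pos (0<fromℕ (suc m)) (0<fromℕ (suc n)))) (begin
      (x + y) * fromℕ (suc m ℕ.* suc n)                             ≈⟨ *-congˡ (fromℕ-* (suc m) (suc n)) ⟩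
      (x + y) * (M * N)                                             ≈⟨ lem x y M N ⟩
      x * M * N + y * N * M                                         ≈⟨ +-cong (*-congʳ eq) (*-congʳ eq′) ⟩
      fromℤ p * N + fromℤ q * M
          ≈⟨ +-cong (fromℤ-* p (+ suc n)) (fromℤ-* q (+ suc m)) ⟨
      fromℤ (p ℤ.* + suc n) + fromℤ (q ℤ.* + suc m)                 ≈⟨ fromℤ-+ (p ℤ.* + suc n) (q ℤ.* + suc m) ⟨
      fromℤ (p ℤ.* + suc n ℤ.+ q ℤ.* + suc m)                       ∎)
    where
    open ≈R
    M N : ℝ
    M = fromℕ (suc m)
    N = fromℕ (suc n)
    lem : ∀ x y M N → (x + y) * (M * N) ≈ x * M * N + y * N * M
    lem x y M N = solve (x ∷ y ∷ M ∷ N ∷ []) ((x₀ :+ x₁) :* (x₂ :* x₃)) (x₀ :* x₂ :* x₃ :+ x₁ :* x₃ :* x₂)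

  IsRational-* : IsRational x → IsRational y → IsRational (x * y)
  IsRational-* {x} {y} (p , m , eq) (q , n , eq′) =
    isRational (p ℤ.* q) (suc m ℕ.* suc n)
        (<-respʳ-≈ (sym (fromℕ-* (suc m) (suc n))) (*-pos (0<fromℕ (suc m)) (0<fromℕ (suc n)))) (begin
      x * y * fromℕ (suc m ℕ.* suc n)          ≈⟨ *-congˡ (fromℕ-* (suc m) (suc n)) ⟩
      x * y * (M * N)                          ≈⟨ lem x y M N ⟩
      (x * M) * (y * N)                        ≈⟨ *-cong eq eq′ ⟩
      fromℤ p * fromℤ q                        ≈⟨ fromℤ-* p q ⟨
      fromℤ (p ℤ.* q)                          ∎)
    where
    open ≈R
    M N : ℝ
    M = fromℕ (suc m)
    N = fromℕ (suc n)
    lem : ∀ x y M N → x * y * (M * N) ≈ (x * M) * (y * N)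
    lem x y M N = solve (x ∷ y ∷ M ∷ N ∷ []) (x₀ :* x₁ :* (x₂ :* x₃)) (x₀ :* x₂ :* (x₁ :* x₃))

  IsRational-neg : IsRational x → IsRational (- x)
  IsRational-neg {x} (p , n , eq) = ℤ.- p , n , trans (lem x (fromℕ (suc n))) (trans (-‿cong eq) (sym (fromℤ-neg p)))
    where
    lem : ∀ a b → - a * b ≈ - (a * b)
    lem a b = solve (a ∷ b ∷ []) ((:- x₀) :* x₁) (:- (x₀ :* x₁))

  IsRational-⁻¹ : x ≉ 0# → IsRational x → IsRational (x ⁻¹)
  IsRational-⁻¹ {x} x≉0 (p , n , eq) = go p eq
    where
    open ≈R
    N : ℝ
    N = fromℕ (suc n)
    step : ∀ P → x * N ≈ P → x ⁻¹ * P ≈ N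
    step P eq = begin
      x ⁻¹ * P         ≈⟨ *-congˡ eq ⟨
      x ⁻¹ * (x * N)   ≈⟨ lem (x ⁻¹) x N ⟩
      x * x ⁻¹ * N     ≈⟨ *-congʳ (⁻¹-inverseʳ x≉0) ⟩
      1# * N           ≈⟨ *-identityˡ N ⟩
      N                ∎
      where
      lem : ∀ a b c → a * (b * c) ≈ b * a * c
      lem a b c = solve (a ∷ b ∷ c ∷ []) (x₀ :* (x₁ :* x₂)) (x₁ :* x₀ :* x₂)
    go : ∀ p → x * N ≈ fromℤ p → IsRational (x ⁻¹)
    go (+ zero)  eq = ⊥-elim (x≉0 (*-cancelʳ-≈ (0<fromℕ (suc n)) (trans eq (sym (zeroˡ N)))))
    go (+ suc m) eq = + suc n , m , step _ eq
    go -[1+ m ]  eq = -[1+ n ] , m , trans (lem (x ⁻¹) (fromℕ (suc m))) (-‿cong (step _ eq))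
      where
      lem : ∀ a b → a * b ≈ - (a * (- b))
      lem a b = solve (a ∷ b ∷ []) (x₀ :* x₁) (:- (x₀ :* (:- x₁)))

  -- The equation has the solution z = x / (1 - y). It is used for a coordinate of a fixed point,
  -- once around a cycle of coordinates.
  IsRational-fixed : IsRational x → IsRational y → y ≉ 1# → z ≈ x + y * z → IsRational z
  IsRational-fixed {x} {y} {z} rx ry y≉1 eq = IsRational-resp (sym z≈)
      (IsRational-* rx (IsRational-⁻¹ 1-y≉0 (IsRational-+ r1 (IsRational-neg ry))))
    where
    open ≈R
    r1 : IsRational 1#
    r1 = IsRational-resp (+-identityʳ 1#) (IsRational-ℤ 1ℤ)
    1-y≉0 : 1# - y ≉ 0#
    1-y≉0 eq = y≉1 (begin
      y                ≈⟨ lem y ⟩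
      1# - (1# - y)    ≈⟨ +-congˡ (-‿cong eq) ⟩
      1# - 0#          ≈⟨ (solve [] (con 1ℤ :- con 0ℤ) (con 1ℤ)) ⟩
      1#               ∎)
      where
      lem : ∀ y → y ≈ 1# - (1# - y)
      lem y = solve (y ∷ []) x₀ (con 1ℤ :- (con 1ℤ :- x₀))
    z≈ : z ≈ x * (1# - y) ⁻¹
    z≈ = begin
      z                                ≈⟨ *-identityʳ z ⟨
      z * 1#                           ≈⟨ *-congˡ (⁻¹-inverseʳ 1-y≉0) ⟨
      z * ((1# - y) * w)               ≈⟨ lem z y w ⟩
      z * w - y * z * w                ≈⟨ +-congʳ (*-congʳ eq) ⟩
      (x + y * z) * w - y * z * w      ≈⟨ lem′ x (y * z) w ⟩
      x * w                            ∎
      where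
      w : ℝ
      w = (1# - y) ⁻¹
      lem : ∀ z y w → z * ((1# - y) * w) ≈ z * w - y * z * w
      lem z y w = solve (z ∷ y ∷ w ∷ []) (x₀ :* ((con 1ℤ :- x₁) :* x₂)) (x₀ :* x₂ :- x₁ :* x₀ :* x₂)
      lem′ : ∀ x t w → (x + t) * w - t * w ≈ x * w
      lem′ x t w = solve (x ∷ t ∷ w ∷ []) ((x₀ :+ x₁) :* x₂ :- x₁ :* x₂) (x₀ :* x₂)

-- Similarities of the supremum norm.

module Similarity
  (em : ∀ {ℓ} → ExcludedMiddle ℓ) (𝓡 : RealNumbers) {d : ℕ} (f : Real.ℝ^_ 𝓡 d → Real.ℝ^_ 𝓡 d) (t : Real.ℝ 𝓡)
  (0<t : Real._<_ 𝓡 (Real.0# 𝓡) t) (similar : ∀ x y → Real._≈_ 𝓡 (Space.dist em 𝓡 (f x) (f y)) (Real._*_ 𝓡 t (Space.dist em 𝓡 x y))) where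

  open Real 𝓡 hiding (zero)
  open Space em 𝓡
  open Solver 𝓡
  open OrderedField em 𝓡
  open Rationals em 𝓡
  open Classical em
  private
    module ≈R where open import Relation.Binary.Reasoning.Setoid setoid public

  f-cong : ∀ {x y} → x ≋ y → f x ≋ f y
  f-cong {x} {y} x≋y = dist≤0⇒≋ (inj₂ (trans (similar x y) (trans (*-congˡ (≋⇒dist≈0 x≋y)) (zeroʳ t))))

  f-injective : ∀ {x y} → f x ≋ f y → x ≋ y
  f-injective {x} {y} fx≋fy = dist≤0⇒≋
      (*-cancelˡ-≤ 0<t (inj₂ (trans (sym (similar x y)) (trans (≋⇒dist≈0 fx≋fy) (sym (zeroʳ t))))))

  private
    0≤t : 0# ≤ t
    0≤t = <⇒≤ 0<t

    axis : ℝ → Fin d → ℝ^ d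
    axis R i j with i FinP.≟ j
    ... | yes _ = R
    ... | no  _ = 0#

    axis-diag : ∀ R i → axis R i i ≈ R
    axis-diag R i with i FinP.≟ i
    ... | yes _ = refl
    ... | no ¬p = ⊥-elim (¬p ≡.refl)

    axis-off : ∀ R {i j} → i ≢ j → axis R i j ≈ 0#
    axis-off R {i} {j} i≢j with i FinP.≟ j
    ... | yes p = ⊥-elim (i≢j p)
    ... | no  _ = refl

    o : ℝ^ d
    o _ = 0#

    axis-elim : ∀ {p} (P : Fin d → ℝ → Set p) R i → P i R → (∀ j → P j 0#) → ∀ j → P j (axis R i j)
    axis-elim P R i pR p0 j with i FinP.≟ j
    ... | yes ≡.refl = pR
    ... | no  _      = p0 j

    -- The ball of radius R / 2, in which the i-th coordinate alone decides the distances R - xᵢ and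
    -- R + xᵢ to the points ± R eᵢ.
    _InBall_ : ℝ^ d → ℝ → Set
    x InBall R = ∀ j → ∣ x j ∣ + ∣ x j ∣ ≤ R

    IsSign : ℝ → Set
    IsSign s = s ≈ 1# ⊎ s ≈ - 1#

    sign² : ∀ {s} → IsSign s → s * s ≈ 1#
    sign² {s} (inj₁ eq) = trans (*-cong eq eq) (solve [] (con 1ℤ :* con 1ℤ) (con 1ℤ))
    sign² {s} (inj₂ eq) = trans (*-cong eq eq) (solve [] ((:- con 1ℤ) :* (:- con 1ℤ)) (con 1ℤ))

    sign-rational : ∀ {s} → IsSign s → IsRational s
    sign-rational (inj₁ eq) = IsRational-resp (trans (+-identityʳ 1#) (sym eq)) (IsRational-ℤ 1ℤ)
    sign-rational (inj₂ eq) = IsRational-resp (trans (-‿cong (+-identityʳ 1#)) (sym eq)) (IsRational-ℤ -[1+ 0 ])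

    sign*≤∣∣ : ∀ {s} → IsSign s → ∀ x → s * x ≤ ∣ x ∣
    sign*≤∣∣ {s} (inj₁ eq) x = ≤-respˡ-≈ (sym (trans (*-congʳ eq) (*-identityˡ x))) (x≤∣x∣ x)
    sign*≤∣∣ {s} (inj₂ eq) x = ≤-respˡ-≈ (sym (trans (*-congʳ eq) (solve (x ∷ []) ((:- con 1ℤ) :* x₀) (:- x₀))))
        (-x≤∣x∣ x)

    ∣sign*∣≤ : ∀ {s} → IsSign s → ∀ x → ∣ s * x ∣ ≤ ∣ x ∣
    ∣sign*∣≤ {s} sg x = ∣x∣≤ (sign*≤∣∣ sg x)
        (≤-respˡ-≈ (solve (s ∷ x ∷ []) (x₀ :* (:- x₁)) (:- (x₀ :* x₁))) (≤-respʳ-≈ (∣-x∣≈∣x∣ x) (sign*≤∣∣ sg (- x))))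

    opaque
      -- If all signed differences of coordinates stayed strictly below the distance, so would their
      -- maximum. Positivity excludes the default value 0 of the maximum.
      ∣∣-attained : ∀ {x y : ℝ^ d} → 0# < dist x y → ∃[ k ] ∃[ s ] IsSign s × dist x y ≤ s * (x k - y k)
      ∣∣-attained {x} {y} 0<xy = by-contradiction λ ¬p → <-irrefl refl (dist< x y 0<xy λ k → ∣x∣<
          ([ (λ lt → lt) , (λ le → ⊥-elim (¬p (k , 1# , inj₁ refl , ≤-respʳ-≈ (sym (*-identityˡ _)) le))) ]′
              (<-or-≥ (x k - y k) (dist x y)))
          ([ (λ lt → lt) , (λ le → ⊥-elim (¬p (k , - 1# , inj₂ refl , ≤-respʳ-≈ (lem (x k - y k)) le))) ]′
              (<-or-≥ (- (x k - y k)) (dist x y))))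
        where
        lem : ∀ x → - x ≈ - 1# * x
        lem x = solve (x ∷ []) (:- x₀) ((:- con 1ℤ) :* x₀)

  -- The images of the two points ± R eᵢ are at distance 2 R t, so they differ by that much in some coordinate k;
  -- the distances from a point x of the smaller ball to them leave only one possibility for f x k.
  record Coordinate (R : ℝ) (i : Fin d) : Set where
    field
      k     : Fin d
      s     : ℝ
      sign  : IsSign s
      formula : ∀ x → x InBall R → s * (f x k - f o k) ≈ t * x i

  opaque
    coordinate : ∀ R → 0# < R → ∀ i → Coordinate R i
    coordinate R 0<R i = case ∣∣-attained {f p} {f m} 0<fpm of λ where
        (k , s , sg , far) → record { k = k ; s = s ; sign = sg ; formula = exact k s sg far }
      where
      p m : ℝ^ d
      p = axis R i
      m = axis (- R) i
      2R≤ : R + R ≤ ∣ R - (- R) ∣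
      2R≤ = ≤-respˡ-≈ R--R (x≤∣x∣ (R - (- R)))
        where
        R--R : R - (- R) ≈ R + R
        R--R = solve (R ∷ []) (x₀ :- (:- x₀)) (x₀ :+ x₀)
      2R≤pm : R + R ≤ dist p m
      2R≤pm = ≤-trans (≤-respʳ-≈ (∣∣-cong (+-cong (sym (axis-diag R i)) (-‿cong (sym (axis-diag (- R) i)))))
          2R≤) (∣-∣≤dist p m i)
      0<fpm : 0# < dist (f p) (f m)
      0<fpm = <-respʳ-≈ (sym (similar p m))
          (*-pos 0<t (<-≤-trans (<-by (0<R +< 0<R)
            (solve (R ∷ []) (x₀ :+ x₀ :- con 0ℤ) (x₀ :+ x₀ :- (con 0ℤ :+ con 0ℤ)))) 2R≤pm))
      near : ∀ x → x InBall R → dist p x ≤ R - x i × dist x m ≤ R + x i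
      near x inB = dist≤ p x 0≤R-x R-x≤ , dist≤ x m 0≤R+x R+x≤
        where
        2x≤R : x i + x i ≤ R
        2x≤R = ≤-trans (x≤∣x∣ (x i) +≤ x≤∣x∣ (x i)) (inB i)
        -2x≤R : - x i + - x i ≤ R
        -2x≤R = ≤-trans (-x≤∣x∣ (x i) +≤ -x≤∣x∣ (x i)) (inB i)
        cancel2 : ∀ {a b} → a + a ≤ b + b → a ≤ b
        cancel2 {a} {b} le = *-cancelˡ-≤ (0<fromℕ 2)
            (≤-by le (solve (b ∷ a ∷ []) (con (+ 2) :* x₀ :- con (+ 2) :* x₁) (x₀ :+ x₀ :- (x₁ :+ x₁))))
        0≤R : 0# ≤ R
        0≤R = <⇒≤ 0<R
        0≤R-x : 0# ≤ R - x i
        0≤R-x = cancel2 (≤-by (2x≤R +≤ 0≤R)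
            (solve (R ∷ (x i) ∷ []) (x₀ :- x₁ :+ (x₀ :- x₁) :- (con 0ℤ :+ con 0ℤ))
              (x₀ :+ x₀ :- (x₁ :+ x₁ :+ con 0ℤ))))
        0≤R+x : 0# ≤ R + x i
        0≤R+x = cancel2 (≤-by (-2x≤R +≤ 0≤R)
            (solve (R ∷ (x i) ∷ []) (x₀ :+ x₁ :+ (x₀ :+ x₁) :- (con 0ℤ :+ con 0ℤ))
              (x₀ :+ x₀ :- ((:- x₁) :+ (:- x₁) :+ con 0ℤ))))
        R-x≤ : ∀ j → ∣ p j - x j ∣ ≤ R - x i
        R-x≤ = axis-elim (λ j pj → ∣ pj - x j ∣ ≤ R - x i) R i
            (∣x∣≤ ≤-refl (≤-by (0≤R-x +≤ 0≤R-x)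
              (solve (R ∷ (x i) ∷ []) (x₀ :- x₁ :- (:- (x₀ :- x₁)))
                (x₀ :- x₁ :+ (x₀ :- x₁) :- (con 0ℤ :+ con 0ℤ))))) λ j →
          ∣x∣≤ (cancel2 (≤-by (≤-trans (-x≤∣x∣ (x j) +≤ -x≤∣x∣ (x j)) (inB j) +≤ 2x≤R)
              (solve (R ∷ (x i) ∷ (x j) ∷ []) (x₀ :- x₁ :+ (x₀ :- x₁) :- (con 0ℤ :- x₂ :+ (con 0ℤ :- x₂)))
                (x₀ :+ x₀ :- ((:- x₂) :+ (:- x₂) :+ (x₁ :+ x₁))))))
               (cancel2 (≤-by (≤-trans (x≤∣x∣ (x j) +≤ x≤∣x∣ (x j)) (inB j) +≤ 2x≤R)
                   (solve (R ∷ (x i) ∷ (x j) ∷ [])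
                     (x₀ :- x₁ :+ (x₀ :- x₁) :- ((:- (con 0ℤ :- x₂)) :+ (:- (con 0ℤ :- x₂))))
                       (x₀ :+ x₀ :- (x₂ :+ x₂ :+ (x₁ :+ x₁))))))
        R+x≤ : ∀ j → ∣ x j - m j ∣ ≤ R + x i
        R+x≤ = axis-elim (λ j mj → ∣ x j - mj ∣ ≤ R + x i) (- R) i
            (∣x∣≤ (≤-reflexive (solve ((x i) ∷ R ∷ []) (x₀ :- (:- x₁)) (x₁ :+ x₀)))
              (≤-by (0≤R+x +≤ 0≤R+x) (solve (R ∷ (x i) ∷ []) (x₀ :+ x₁ :- (:- (x₁ :- (:- x₀))))
                (x₀ :+ x₁ :+ (x₀ :+ x₁) :- (con 0ℤ :+ con 0ℤ))))) λ j →
          ∣x∣≤ (cancel2 (≤-by (≤-trans (x≤∣x∣ (x j) +≤ x≤∣x∣ (x j)) (inB j) +≤ -2x≤R)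
              (solve (R ∷ (x i) ∷ (x j) ∷ []) (x₀ :+ x₁ :+ (x₀ :+ x₁) :- (x₂ :- con 0ℤ :+ (x₂ :- con 0ℤ)))
                (x₀ :+ x₀ :- (x₂ :+ x₂ :+ ((:- x₁) :+ (:- x₁)))))))
               (cancel2 (≤-by (≤-trans (-x≤∣x∣ (x j) +≤ -x≤∣x∣ (x j)) (inB j) +≤ -2x≤R)
                   (solve (R ∷ (x i) ∷ (x j) ∷ [])
                     (x₀ :+ x₁ :+ (x₀ :+ x₁) :- ((:- (x₂ :- con 0ℤ)) :+ (:- (x₂ :- con 0ℤ))))
                       (x₀ :+ x₀ :- ((:- x₂) :+ (:- x₂) :+ ((:- x₁) :+ (:- x₁)))))))
      o-inBall : o InBall R
      o-inBall j = ≤-respˡ-≈ (sym (trans (+-cong (0≤x⇒∣x∣≈x ≤-refl) (0≤x⇒∣x∣≈x ≤-refl)) (+-identityʳ 0#))) (<⇒≤ 0<R)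
      module _ (k : Fin d) (s : ℝ) (sg : IsSign s) (far : dist (f p) (f m) ≤ s * (f p k - f m k)) where
        -- The upper bounds for the signed differences from `f p` to `f x` and from `f x` to `f m`
        -- add up to t (R + R), which is reached between `f p` and `f m`; hence both are equalities.
        lower : ∀ x → x InBall R → s * (f x k - f m k) ≈ t * (R + x i)
        lower x inB = ≤-antisym upper (≤-by (far′ +≤ upper′)
            (solve (s ∷ (f x k) ∷ (f (m) k) ∷ t ∷ R ∷ (x i) ∷ (f (p) k) ∷ [])
              (x₀ :* (x₁ :- x₂) :- x₃ :* (x₄ :+ x₅))
                (x₀ :* (x₆ :- x₂) :+ x₃ :* (x₄ :- x₅) :- (x₃ :* (x₄ :+ x₄) :+ x₀ :* (x₆ :- x₁)))))
          where
          upper : s * (f x k - f m k) ≤ t * (R + x i)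
          upper = ≤-trans (sign*≤∣∣ sg _)
              (≤-trans (∣-∣≤dist (f x) (f m) k) (≤-respˡ-≈ (sym (similar x m)) (0≤t *≤ proj₂ (near x inB))))
          upper′ : s * (f p k - f x k) ≤ t * (R - x i)
          upper′ = ≤-trans (sign*≤∣∣ sg _)
              (≤-trans (∣-∣≤dist (f p) (f x) k) (≤-respˡ-≈ (sym (similar p x)) (0≤t *≤ proj₁ (near x inB))))
          far′ : t * (R + R) ≤ s * (f p k - f m k)
          far′ = ≤-trans (0≤t *≤ 2R≤pm) (≤-respˡ-≈ (similar p m) far)
        exact : ∀ x → x InBall R → s * (f x k - f o k) ≈ t * x i
        exact x inB = begin
          s * (f x k - f o k)                          ≈⟨ lem s (f x k) (f o k) (f m k) ⟩
          s * (f x k - f m k) - s * (f o k - f m k)    ≈⟨ +-cong (lower x inB) (-‿cong (lower o o-inBall)) ⟩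
          t * (R + x i) - t * (R + 0#)                 ≈⟨ lem′ t R (x i) ⟩
          t * x i                                      ∎
          where
          open ≈R
          lem : ∀ s a b c → s * (a - b) ≈ s * (a - c) - s * (b - c)
          lem s a b c = solve (s ∷ a ∷ b ∷ c ∷ []) (x₀ :* (x₁ :- x₂)) (x₀ :* (x₁ :- x₃) :- x₀ :* (x₂ :- x₃))
          lem′ : ∀ t R x → t * (R + x) - t * (R + 0#) ≈ t * x
          lem′ t R x = solve (t ∷ R ∷ x ∷ []) (x₀ :* (x₁ :+ x₂) :- x₀ :* (x₁ :+ con 0ℤ)) (x₀ :* x₂)

  open Coordinate

  private
    solve-coordinate : ∀ {R i} (c : Coordinate R i) x → x InBall R → f x (k c) ≈ f o (k c) + s c * t * x i
    solve-coordinate {R} {i} c x inB = begin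
      f x (k c)                                              ≈⟨ lem (f x (k c)) (f o (k c)) ⟩
      f o (k c) + 1# * (f x (k c) - f o (k c))               ≈⟨ +-congˡ (*-congʳ (sign² (sign c))) ⟨
      f o (k c) + s c * s c * (f x (k c) - f o (k c))        ≈⟨ +-congˡ (*-assoc _ _ _) ⟩
      f o (k c) + s c * (s c * (f x (k c) - f o (k c)))      ≈⟨ +-congˡ (*-congˡ (formula c x inB)) ⟩
      f o (k c) + s c * (t * x i)                            ≈⟨ +-congˡ (*-assoc _ _ _) ⟨
      f o (k c) + s c * t * x i                              ∎
      where
      open ≈R
      lem : ∀ a b → a ≈ b + 1# * (a - b)
      lem a b = solve (a ∷ b ∷ []) x₀ (x₁ :+ con 1ℤ :* (x₀ :- x₁))

    axis-inBall : ∀ {R r} i → 0# ≤ r → r + r ≤ R → axis r i InBall R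
    axis-inBall {R} {r} i 0≤r 2r≤R = axis-elim (λ _ a → ∣ a ∣ + ∣ a ∣ ≤ R) r i
      (≤-respˡ-≈ (sym (+-cong (0≤x⇒∣x∣≈x 0≤r) (0≤x⇒∣x∣≈x 0≤r))) 2r≤R)
      (λ _ → ≤-respˡ-≈ (sym (+-cong (0≤x⇒∣x∣≈x ≤-refl) (0≤x⇒∣x∣≈x ≤-refl))) (≤-trans (0≤r +≤ 0≤r) 2r≤R))

    -- Otherwise the values of f at a multiple of eᵢ would force t r = 0.
    k-injective : ∀ {R} (0<R : 0# < R) {i j} → k (coordinate R 0<R i) ≡ k (coordinate R 0<R j) → i ≡ j
    k-injective {R} 0<R {i} {j} eq = case i FinP.≟ j of λ where
        (yes i≡j) → i≡j
        (no  i≢j) → case halve 0<R of λ where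
          (r , 0<r , r+r≈R) → ⊥-elim (<-irrefl refl (absurd i≢j r 0<r (≤-reflexive r+r≈R)))
      where
      open ≈R
      ci : Coordinate R i
      ci = coordinate R 0<R i
      cj : Coordinate R j
      cj = coordinate R 0<R j
      absurd : i ≢ j → ∀ r → 0# < r → r + r ≤ R → 0# < 0#
      absurd i≢j r 0<r le = <-respʳ-≈ (begin
        t * r                                     ≈⟨ *-congˡ (axis-diag r i) ⟨
        t * u i                                   ≈⟨ formula ci u inB ⟨
        s ci * (f u (k ci) - f o (k ci))          ≈⟨ *-congˡ (begin
          f u (k ci) - f o (k ci)                   ≡⟨ ≡.cong (λ l → f u l - f o l) eq ⟩
          f u (k cj) - f o (k cj)                   ≈⟨ +-congʳ (solve-coordinate cj u inB) ⟩
          f o (k cj) + s cj * t * u j - f o (k cj)  ≈⟨ +-congʳ (+-congˡ (*-congˡ (axis-off r i≢j))) ⟩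
          f o (k cj) + s cj * t * 0# - f o (k cj)   ≈⟨ lem (f o (k cj)) (s cj * t) ⟩
          0#                                        ∎) ⟩
        s ci * 0#                                 ≈⟨ zeroʳ _ ⟩
        0#                                        ∎) (*-pos 0<t 0<r)
        where
        u : ℝ^ d
        u = axis r i
        inB : u InBall R
        inB = axis-inBall i (<⇒≤ 0<r) le
        lem : ∀ a b → a + b * 0# - a ≈ 0#
        lem a b = solve (a ∷ b ∷ []) (x₀ :+ x₁ :* con 0ℤ :- x₀) (con 0ℤ)

  -- The coordinate formula prescribes the preimage: `x i` undoes translation, sign and scaling in
  -- the coordinate `k (c i)`, and these coordinates exhaust all of them because k is injective.
  surjective : ∀ y → ∃[ x ] f x ≋ y
  surjective y = x , fx≋y
    where
    open ≈R
    B : ℝ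
    B = t ⁻¹ * dist y (f o)
    R : ℝ
    -- B bounds the coordinates of the point x defined below, and the coordinate formula holds up to
    -- radius R / 2.
    R = B + B + 1#
    0≤B : 0# ≤ B
    0≤B = 0≤x*y (<⇒≤ (0<x⁻¹ 0<t)) (0≤dist y (f o))
    0<R : 0# < R
    0<R = <-by (0≤B +≤ 0≤B ≤+ 0<1)
        (solve ((t ⁻¹) ∷ (dist y (f (o))) ∷ []) (x₀ :* x₁ :+ x₀ :* x₁ :+ con 1ℤ :- con 0ℤ)
          (x₀ :* x₁ :+ x₀ :* x₁ :+ con 1ℤ :- (con 0ℤ :+ con 0ℤ :+ con 0ℤ)))
    c : ∀ i → Coordinate R i
    c = coordinate R 0<R
    x : ℝ^ d
    x i = t ⁻¹ * (s (c i) * (y (k (c i)) - f o (k (c i))))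
    ∣x∣≤B : ∀ i → ∣ x i ∣ ≤ B
    ∣x∣≤B i = ≤-respˡ-≈ (sym (trans (∣x*y∣ _ _) (*-congʳ (0≤x⇒∣x∣≈x (<⇒≤ (0<x⁻¹ 0<t))))))
      (<⇒≤ (0<x⁻¹ 0<t) *≤ ≤-trans (∣sign*∣≤ (sign (c i)) _) (∣-∣≤dist y (f o) (k (c i))))
    x-inBall : x InBall R
    x-inBall i = ≤-trans (∣x∣≤B i +≤ ∣x∣≤B i)
        (≤-by 0≤1 (solve ((t ⁻¹) ∷ (dist y (f (o))) ∷ [])
          (x₀ :* x₁ :+ x₀ :* x₁ :+ con 1ℤ :- (x₀ :* x₁ :+ x₀ :* x₁)) (con 1ℤ :- con 0ℤ)))
    at-k : ∀ i → f x (k (c i)) ≈ y (k (c i))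
    at-k i = begin
      f x (k (c i))                                      ≈⟨ solve-coordinate (c i) x x-inBall ⟩
      b + s (c i) * t * (t ⁻¹ * (s (c i) * (a - b)))     ≈⟨ lem a b (s (c i)) t (t ⁻¹) ⟩
      b + t * t ⁻¹ * (s (c i) * s (c i)) * (a - b)
          ≈⟨ +-congˡ (*-congʳ (*-cong (x*x⁻¹≈1 0<t) (sign² (sign (c i))))) ⟩
      b + 1# * 1# * (a - b)                              ≈⟨ lem′ a b ⟩
      a                                                  ∎
      where
      a b : ℝ
      a = y (k (c i))
      b = f o (k (c i))
      lem : ∀ a b s t u → b + s * t * (u * (s * (a - b))) ≈ b + t * u * (s * s) * (a - b)
      lem a b s t u = (solve (b ∷ s ∷ t ∷ u ∷ a ∷ []) (x₀ :+ x₁ :* x₂ :* (x₃ :* (x₁ :* (x₄ :- x₀))))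
          (x₀ :+ x₂ :* x₃ :* (x₁ :* x₁) :* (x₄ :- x₀)))
      lem′ : ∀ a b → b + 1# * 1# * (a - b) ≈ a
      lem′ a b = solve (b ∷ a ∷ []) (x₀ :+ con 1ℤ :* con 1ℤ :* (x₁ :- x₀)) x₁
    fx≋y : f x ≋ y
    fx≋y j = case injective⇒periodic (k ∘ c) (k-injective 0<R) j of λ where
      -- Being periodic under `k ∘ c`, the index j is one of its values.
      (n , eq) → ≡.subst (λ l → f x l ≈ y l) eq (at-k _)

  -- Along a cycle of the permutation k, the fixed point equation becomes zᵢ = A + B zᵢ with A, B rational and ∣B∣ < 1.
  fixed-rational : t < 1# → (∀ x → x ∈ Rational → f x ∈ Rational) → ∀ {z} → f z ≋ z → z ∈ Rational
  fixed-rational t<1 f-rational {z} fz≋z = (λ i → proj₁ (IsRational⇒ℚ (z-rational i))) ,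
      (λ i → proj₂ (IsRational⇒ℚ (z-rational i)))
    where
    open ≈R
    at : ∀ {x} → x ∈ Rational → ∀ i → IsRational (x i)
    at (r , eq) i = IsRational-resp (sym (eq i)) (ℚ⇒IsRational (r i))
    pointwise : ∀ {x} → (∀ i → IsRational (x i)) → x ∈ Rational
    pointwise rx = (λ i → proj₁ (IsRational⇒ℚ (rx i))) , (λ i → proj₂ (IsRational⇒ℚ (rx i)))
    R : ℝ
    -- Large enough for the fixed point z as well as for the unit vectors from which t is read off.
    R = fromℕ 2 + (dist z o + dist z o)
    0<R : 0# < R
    0<R = <-by (0<fromℕ 2 <+ (0≤dist z o +≤ 0≤dist z o))
        (solve ((dist z (o)) ∷ []) (con (+ 2) :+ (x₀ :+ x₀) :- con 0ℤ)
          (con (+ 2) :+ (x₀ :+ x₀) :- (con 0ℤ :+ (con 0ℤ :+ con 0ℤ))))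
    c : ∀ i → Coordinate R i
    c = coordinate R 0<R
    r0 : IsRational 0#
    r0 = IsRational-ℤ 0ℤ
    r1 : IsRational 1#
    r1 = IsRational-resp (+-identityʳ 1#) (IsRational-ℤ 1ℤ)
    fo-rational : ∀ i → IsRational (f o i)
    fo-rational = at (f-rational o (pointwise (λ i → r0)))
    axis-rational : ∀ i j → IsRational (axis 1# i j)
    axis-rational i = axis-elim (λ _ → IsRational) 1# i r1 (λ _ → r0)
    -- Up to sign, t is a coordinate of the rational vector f(eᵢ) - f(0); the argument supplies a
    -- coordinate i.
    t-rational : Fin d → IsRational t
    t-rational i = IsRational-resp (begin
        s (c i) * (f e (k (c i)) - f o (k (c i)))
            ≈⟨ formula (c i) e (axis-inBall i 0≤1
              (≤-by (0≤dist z o +≤ 0≤dist z o)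
                (solve ((dist z (o)) ∷ []) (con (+ 2) :+ (x₀ :+ x₀) :- (con 1ℤ :+ con 1ℤ))
                  (x₀ :+ x₀ :- (con 0ℤ :+ con 0ℤ))))) ⟩
        t * e i                                       ≈⟨ *-congˡ (axis-diag 1# i) ⟩
        t * 1#                                        ≈⟨ *-identityʳ t ⟩
        t                                             ∎)
      (IsRational-* (sign-rational (sign (c i)))
          (IsRational-+ (at (f-rational e (pointwise (axis-rational i))) _) (IsRational-neg (fo-rational _))))
      where
      e : ℝ^ d
      e = axis 1# i
    z-inBall : z InBall R
    z-inBall i = ≤-trans (∣z∣≤ +≤ ∣z∣≤)
        (≤-by (0≤fromℕ 2) (solve ((dist z (o)) ∷ []) (con (+ 2) :+ (x₀ :+ x₀) :- (x₀ :+ x₀)) (con (+ 2) :- con 0ℤ)))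
      where
      ∣z∣≤ : ∣ z i ∣ ≤ dist z o
      ∣z∣≤ = ≤-respˡ-≈ (∣∣-cong (solve ((z i) ∷ []) (x₀ :- con 0ℤ) x₀)) (∣-∣≤dist z o i)
    σ : Fin d → Fin d
    σ i = k (c i)
    u : Fin d → ℝ
    u i = s (c i) * t
    u-rational : ∀ i → IsRational (u i)
    u-rational i = IsRational-* (sign-rational (sign (c i))) (t-rational i)
    u² : ∀ i → u i * u i ≈ t * t
    u² i = trans (lem (s (c i)) t) (trans (*-congʳ (sign² (sign (c i)))) (*-identityˡ (t * t)))
      where
      lem : ∀ s t → s * t * (s * t) ≈ (s * s) * (t * t)
      lem s t = solve (s ∷ t ∷ []) (x₀ :* x₁ :* (x₀ :* x₁)) (x₀ :* x₀ :* (x₁ :* x₁))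
    step : ∀ j → z (σ j) ≈ f o (σ j) + u j * z j
    step j = trans (sym (fz≋z (σ j))) (solve-coordinate (c j) z z-inBall)
    -- B is a product of n factors ± t. Its square forgets the signs and still shows that B is not
    -- 1.
    record Chain (i : Fin d) (n : ℕ) : Set where
      field
        A B   : ℝ
        A-rat : IsRational A
        B-rat : IsRational B
        B²    : B * B ≈ t ^ n * t ^ n
        at-n  : z (ℕG.fold i σ n) ≈ A + B * z i
    extend : ∀ {i n} → Chain i n → Chain i (suc n)
    extend {i} {n} ch = record
      { A = b + v * A ; B = v * B ; A-rat = IsRational-+ (fo-rational _) (IsRational-* (u-rational j) A-rat)
      ; B-rat = IsRational-* (u-rational j) B-rat
      ; B² = trans (lem v B) (trans (*-cong (u² j) B²) (lem′ t (t ^ n)))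
      ; at-n = trans (step j) (trans (+-congˡ (*-congˡ at-n)) (lem″ b v A B (z i))) }
      where
      open Chain ch
      j : Fin d
      j = ℕG.fold i σ n
      b v : ℝ
      b = f o (σ j)
      v = u j
      lem : ∀ v B → v * B * (v * B) ≈ (v * v) * (B * B)
      lem v B = solve (v ∷ B ∷ []) (x₀ :* x₁ :* (x₀ :* x₁)) (x₀ :* x₀ :* (x₁ :* x₁))
      lem′ : ∀ t T → (t * t) * (T * T) ≈ t * T * (t * T)
      lem′ t T = solve (t ∷ T ∷ []) (x₀ :* x₀ :* (x₁ :* x₁)) (x₀ :* x₁ :* (x₀ :* x₁))
      lem″ : ∀ b u A B z → b + u * (A + B * z) ≈ b + u * A + u * B * z
      lem″ b u A B z = (solve (b ∷ u ∷ A ∷ B ∷ z ∷ []) (x₀ :+ x₁ :* (x₂ :+ x₃ :* x₄))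
          (x₀ :+ x₁ :* x₂ :+ x₁ :* x₃ :* x₄))
    chain : ∀ i n → Chain i n
    chain i zero    = record { A = 0# ; B = 1# ; A-rat = r0 ; B-rat = r1 ; B² = refl ; at-n = lem (z i) }
      where
      lem : ∀ a → a ≈ 0# + 1# * a
      lem a = solve (a ∷ []) x₀ (con 0ℤ :+ con 1ℤ :* x₀)
    chain i (suc n) = extend (chain i n)
    B≉1 : ∀ n {B} → B * B ≈ t ^ suc n * t ^ suc n → B ≉ 1#
    B≉1 n {B} B² B≈1 = <-irrefl (trans (sym B²) (trans (*-cong B≈1 B≈1) (*-identityʳ 1#)))
      (≤-<-trans (*-mono-≤ (0≤x^n (suc n) 0≤t) t^n≤t (0≤x^n (suc n) 0≤t) t^n≤t)
        (≤-<-trans (0≤t *≤ <⇒≤ t<1) (<-respˡ-≈ (sym (*-identityʳ t)) t<1)))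
      where
      t^n≤t : t ^ suc n ≤ t
      t^n≤t = ≤-respʳ-≈ (*-identityʳ t) (0≤t *≤ x^n≤1 n 0≤t (<⇒≤ t<1))
    z-rational : ∀ i → IsRational (z i)
    z-rational i = case injective⇒periodic σ (k-injective 0<R) i of λ where
        (n , eq) → cyclic n eq (chain i (suc n))
      where
      cyclic : ∀ n → ℕG.fold i σ (suc n) ≡ i → Chain i (suc n) → IsRational (z i)
      cyclic n eq ch = IsRational-fixed A-rat B-rat (B≉1 n B²) (≡.subst (λ j → z j ≈ A + B * z i) eq at-n)
        where open Chain ch

-- Rational vectors with a common denominator.

module Fractions (em : ∀ {ℓ} → ExcludedMiddle ℓ) (𝓡 : RealNumbers) where

  open Real 𝓡 hiding (zero)
  open Solver 𝓡
  open OrderedField em 𝓡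
  open Classical em
  open Space em 𝓡
  open Rationals em 𝓡
  private
    module ≈R where open import Relation.Binary.Reasoning.Setoid setoid public

  0<den : ∀ {d} (r : Fraction d) → 0# < fromℕ (den r)
  0<den (p / q) = 0<fromℕ q

  1≤den : ∀ {d} (r : Fraction d) → 1 ℕ.≤ den r
  1≤den (p / suc q) = s≤s z≤n

  ⟦⟧*den : ∀ {d} (r : Fraction d) i → ⟦ r ⟧ i * fromℕ (den r) ≈ fromℤ (num r i)
  ⟦⟧*den (p / q) i = fromℚ-/ (p i) q

  HasDenominator : ∀ {d} → ℝ^ d → Set
  HasDenominator {d} x = Σ[ n ∈ ℕ ] Σ[ p ∈ Vector ℤ d ] (∀ i → x i * fromℕ (suc n) ≈ fromℤ (p i))

  common-denominator : ∀ {d} (x : ℝ^ d) → (∀ i → IsRational (x i)) → HasDenominator x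
  common-denominator {zero}  x rx = 0 , (λ _ → 0ℤ) , λ ()
  common-denominator {suc d} x rx = combine (rx zero) (common-denominator (x ∘ suc) (rx ∘ suc))
    where
    combine : IsRational (x zero) → HasDenominator (x ∘ suc) → HasDenominator x
    combine (p , m , eq) (n , q , eqs) = n ℕ.+ m ℕ.* suc n , num′ , eq′
      where
      open ≈R
      num′ : Fin (suc d) → ℤ
      num′ zero    = p ℤ.* + suc n
      num′ (suc i) = q i ℤ.* + suc m
      eq′ : ∀ i → x i * fromℕ (suc m ℕ.* suc n) ≈ fromℤ (num′ i)
      eq′ zero    = trans (*-congˡ (fromℕ-* (suc m) (suc n)))
          (trans (sym (*-assoc _ _ _)) (trans (*-congʳ eq) (sym (fromℤ-* p (+ suc n)))))
      eq′ (suc i) = trans (*-congˡ (trans (fromℕ-* (suc m) (suc n)) (*-comm _ _)))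
        (trans (sym (*-assoc _ _ _)) (trans (*-congʳ (eqs i)) (sym (fromℤ-* (q i) (+ suc m)))))

  toFraction : ∀ {d} {x : ℝ^ d} → x ∈ Rational → ∃[ r ] ⟦ r ⟧ ≋ x
  toFraction {d} {x} (q , x≋q) = go (common-denominator x λ i → IsRational-resp (sym (x≋q i)) (ℚ⇒IsRational (q i)))
    where
    go : HasDenominator x → ∃[ r ] ⟦ r ⟧ ≋ x
    go (n , p , eq) = p / suc n , λ i → *-cancelʳ-≈ (0<fromℕ (suc n)) (trans (⟦⟧*den (p / suc n) i) (sym (eq i)))

  1≤∣fromℤ∣ : ∀ {i} → i ≢ 0ℤ → 1# ≤ ∣ fromℤ i ∣
  1≤∣fromℤ∣ {+ zero}   i≢0 = ⊥-elim (i≢0 ≡.refl)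
  1≤∣fromℤ∣ {+ suc n}  i≢0 = ≤-trans (1≤fromℕ (suc n)) (x≤∣x∣ (fromℕ (suc n)))
  1≤∣fromℤ∣ { -[1+ n ]} i≢0 = ≤-trans (1≤fromℕ (suc n)) (≤-respˡ-≈ (lem (fromℕ (suc n))) (-x≤∣x∣ (- fromℕ (suc n))))
    where
    lem : ∀ a → - - a ≈ a
    lem a = solve (a ∷ []) (:- (:- x₀)) x₀

  -- Clearing denominators turns the difference in some coordinate into a nonzero integer.
  separation : ∀ {d} (r s : Fraction d) → ¬ ⟦ r ⟧ ≋ ⟦ s ⟧ → 1# ≤ dist ⟦ r ⟧ ⟦ s ⟧ * (fromℕ (den r) * fromℕ (den s))
  separation r s r≉s = at (¬∀⇒∃¬ r≉s)
    where
    open ≈R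
    M N : ℝ
    M = fromℕ (den r)
    N = fromℕ (den s)
    0<MN : 0# < M * N
    0<MN = *-pos (0<den r) (0<den s)
    at : (∃[ i ] ¬ ⟦ r ⟧ i ≈ ⟦ s ⟧ i) → 1# ≤ dist ⟦ r ⟧ ⟦ s ⟧ * (M * N)
    at (i , ≉) = ≤-trans (1≤∣fromℤ∣ k≢0)
        (≤-respˡ-≈ (trans (*-congˡ (sym (0≤x⇒∣x∣≈x (<⇒≤ 0<MN)))) (trans (sym (∣x*y∣ _ _)) (∣∣-cong eq)))
        (≤-respˡ-≈ (*-comm _ _) (≤-respʳ-≈ (*-comm _ _) (<⇒≤ 0<MN *≤ ∣-∣≤dist ⟦ r ⟧ ⟦ s ⟧ i))))
      where
      k : ℤ
      k = num r i ℤ.* + den s ℤ.- num s i ℤ.* + den r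
      eq : (⟦ r ⟧ i - ⟦ s ⟧ i) * (M * N) ≈ fromℤ k
      eq = begin
        (⟦ r ⟧ i - ⟦ s ⟧ i) * (M * N)                                   ≈⟨ lem (⟦ r ⟧ i) (⟦ s ⟧ i) M N ⟩
        (⟦ r ⟧ i * M) * N - (⟦ s ⟧ i * N) * M
            ≈⟨ +-cong (*-congʳ (⟦⟧*den r i)) (-‿cong (*-congʳ (⟦⟧*den s i))) ⟩
        fromℤ (num r i) * N - fromℤ (num s i) * M
            ≈⟨ +-cong (fromℤ-* (num r i) (+ den s)) (-‿cong (fromℤ-* (num s i) (+ den r))) ⟨
        fromℤ (num r i ℤ.* + den s) - fromℤ (num s i ℤ.* + den r)       ≈⟨ +-congˡ (fromℤ-neg (num s i ℤ.* + den r)) ⟨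
        fromℤ (num r i ℤ.* + den s) + fromℤ (ℤ.- (num s i ℤ.* + den r))
            ≈⟨ fromℤ-+ (num r i ℤ.* + den s) (ℤ.- (num s i ℤ.* + den r)) ⟨
        fromℤ k                                                         ∎
        where
        lem : ∀ a b M N → (a - b) * (M * N) ≈ (a * M) * N - (b * N) * M
        lem a b M N = solve (a ∷ b ∷ M ∷ N ∷ []) ((x₀ :- x₁) :* (x₂ :* x₃)) (x₀ :* x₂ :* x₃ :- x₁ :* x₃ :* x₂)
      k≢0 : k ≢ 0ℤ
      k≢0 k≡0 = ≉ (*-cancelʳ-≈ 0<MN (begin
        ⟦ r ⟧ i * (M * N)                                        ≈⟨ lem (⟦ r ⟧ i) (⟦ s ⟧ i) (M * N) ⟩
        (⟦ r ⟧ i - ⟦ s ⟧ i) * (M * N) + ⟦ s ⟧ i * (M * N)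
            ≈⟨ +-congʳ (trans eq (reflexive (≡.cong fromℤ k≡0))) ⟩
        0# + ⟦ s ⟧ i * (M * N)                                   ≈⟨ +-identityˡ _ ⟩
        ⟦ s ⟧ i * (M * N)                                        ∎))
        where
        lem : ∀ a b c → a * c ≈ (a - b) * c + b * c
        lem a b c = solve (a ∷ c ∷ b ∷ []) (x₀ :* x₁) ((x₀ :- x₂) :* x₁ :+ x₂ :* x₁)

  infinitelyMany : ∀ {d} {P : Pred (Fraction d) 0ℓ} (r : ℕ → Fraction d) → (∀ n → r n ∈ P) →
                   (∀ {m n} → m ℕ.< n → ¬ ⟦ r m ⟧ ≋ ⟦ r n ⟧) → InfinitelyMany P
  infinitelyMany r r∈P distinct = r , r∈P , λ {m} {n} eq → inj m n eq
    where
    inj : ∀ m n → (∀ i → value (r m) i ≡ value (r n) i) → m ≡ n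
    inj m n eq with ℕP.<-cmp m n
    ... | tri< m<n _ _ = ⊥-elim (distinct m<n λ i → reflexive (≡.cong fromℚ (eq i)))
    ... | tri≈ _ m≡n _ = m≡n
    ... | tri> _ _ n<m = ⊥-elim (distinct n<m λ i → reflexive (≡.cong fromℚ (≡.sym (eq i))))

-- The attractor, its rational points and limits of them.

module IteratedFunctionSystem
  (em : ∀ {ℓ} → ExcludedMiddle ℓ) (𝓡 : RealNumbers)
  {d J : ℕ} (2≤J : 2 ℕ.≤ J) (f : Fin J → Real.ℝ^_ 𝓡 d → Real.ℝ^_ 𝓡 d) (τ : Fin J → Real.ℝ 𝓡)
  (contracting : ∀ j → Real.IsContractingSimilarity 𝓡 (τ j) (f j))
  (f-rational : ∀ j x → x ∈ Real.Rational 𝓡 → f j x ∈ Real.Rational 𝓡)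
  (C : Pred (Real.ℝ^_ 𝓡 d) 0ℓ) (attractor : Real.IsAttractor 𝓡 f C) (two-points : Real.HasTwoPoints 𝓡 C) where

  open Real 𝓡 hiding (zero)
  open Solver 𝓡
  open OrderedField em 𝓡
  open Classical em
  open Space em 𝓡
  open Fractions em 𝓡

  0<τ : ∀ j → 0# < τ j
  0<τ j = proj₁ (contracting j)

  τ<1 : ∀ j → τ j < 1#
  τ<1 j = proj₁ (proj₂ (contracting j))

  similar : ∀ j x y → dist (f j x) (f j y) ≈ τ j * dist x y
  similar j x y = trans (reflexive (dist≡‖⊖‖ (f j x) (f j y)))
    (trans (proj₂ (proj₂ (contracting j)) x y) (*-congˡ (reflexive (≡.sym (dist≡‖⊖‖ x y)))))

  module F (j : Fin J) = Similarity em 𝓡 (f j) (τ j) (0<τ j) (similar j)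

  C-image : ∀ j {x} → x ∈ C → f j x ∈ C
  C-image j {x} x∈C = proj₁ (proj₂ (proj₂ attractor)) (j , x , x∈C , ≋-refl)

  C-preimage : ∀ {x} → x ∈ C → ∃[ j ] ∃[ y ] y ∈ C × f j y ≋ x
  C-preimage = proj₂ (proj₂ (proj₂ attractor))

  -- A bare predicate need not respect `≋`; C does, because x is the image of a point of C and
  -- `Image` is defined up to `≋`.
  C-resp : ∀ {x y} → x ≋ y → x ∈ C → y ∈ C
  C-resp {x} {y} x≋y x∈C = via (C-preimage x∈C)
    where
    via : (∃[ j ] ∃[ c ] c ∈ C × f j c ≋ x) → y ∈ C
    via (j , c , c∈C , eq) = proj₁ (proj₂ (proj₂ attractor))
        (j , c , c∈C , ≋-trans {x = f j c} {y = x} {z = y} eq x≋y)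

  open Compact (proj₁ (proj₂ attractor)) C-resp public

  j₀ : Fin J
  j₀ = Fin.fromℕ< (ℕP.≤-trans (s≤s z≤n) 2≤J)

  t : ℝ
  t = maximum τ

  τ≤t : ∀ j → τ j ≤ t
  τ≤t = ≤maximum τ

  0<t : 0# < t
  0<t = <-≤-trans (0<τ j₀) (τ≤t j₀)

  t<1 : t < 1#
  t<1 = maximum< τ 0<1 τ<1

  c₀ : ℝ^ d
  c₀ = proj₁ (proj₁ attractor)

  c₀∈C : c₀ ∈ C
  c₀∈C = proj₂ (proj₁ attractor)

  opaque
    diameter : ∃[ Δ ] 0# < Δ × (∀ {x y} → x ∈ C → y ∈ C → dist x y ≤ Δ)
    diameter = go (bounded c₀)
      where
      go : (∃[ M ] 0# ≤ M × (∀ {x} → x ∈ C → dist c₀ x ≤ M)) → ∃[ Δ ] 0# < Δ ×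
          (∀ {x y} → x ∈ C → y ∈ C → dist x y ≤ Δ)
      -- Adding 1 makes Δ positive, so that it can be divided by.
      go (M , 0≤M , ≤M) = M + M + 1# , <-by (0≤M +≤ 0≤M ≤+ 0<1) (solve (M ∷ []) (x₀ :+ x₀ :+ con 1ℤ :- con 0ℤ) (x₀ :+ x₀ :+ con 1ℤ :- (con 0ℤ :+ con 0ℤ :+ con 0ℤ))) , λ {x} {y} x∈C y∈C →
        ≤-trans (dist-triangle x c₀ y)
            (≤-trans (≤-respˡ-≈ (dist-sym c₀ x) (≤M x∈C) +≤ ≤M y∈C)
              (≤-by 0≤1 (solve (M ∷ []) (x₀ :+ x₀ :+ con 1ℤ :- (x₀ :+ x₀)) (con 1ℤ :- con 0ℤ))))

  Δ : ℝ
  Δ = proj₁ diameter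

  0<Δ : 0# < Δ
  0<Δ = proj₁ (proj₂ diameter)

  dist≤Δ : ∀ {x y} → x ∈ C → y ∈ C → dist x y ≤ Δ
  dist≤Δ = proj₂ (proj₂ diameter)

  opaque
    t^nΔ-small : ∀ {s ε} → 0# < s → s < 1# → 0# < ε → ∃[ N ] ∀ n → N ℕ.≤ n → s ^ n * Δ < ε
    t^nΔ-small {s} {ε} 0<s s<1 0<ε = go (^-small 0<s s<1 (0<x÷y 0<ε 0<Δ))
      where
      go : (∃[ N ] s ^ N < ε ÷ Δ) → ∃[ N ] ∀ n → N ℕ.≤ n → s ^ n * Δ < ε
      go (N , small) = N , λ n N≤n → <-respˡ-≈ (*-comm Δ _) (<-respʳ-≈ (trans (*-comm _ _) (x÷y*y≈x ε 0<Δ))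
        (0<Δ *< ≤-<-trans (^-antitone (<⇒≤ 0<s) (<⇒≤ s<1) N≤n) small))

    -- The n-th step of an orbit in C has length at most `τ j ^ n * Δ`, so the map moves a cluster
    -- point of the orbit by arbitrarily little, that is, not at all.
    fixed-point : ∀ j → ∃[ z ] z ∈ C × f j z ≋ z
    fixed-point j = go (cluster u u∈C)
      where
      u : ℕ → ℝ^ d
      u = ℕG.fold c₀ (f j)
      u∈C : ∀ n → u n ∈ C
      u∈C zero    = c₀∈C
      u∈C (suc n) = C-image j (u∈C n)
      moves : ∀ n → dist (u (suc n)) (u n) ≤ τ j ^ n * Δ
      moves zero    = ≤-respʳ-≈ (sym (*-identityˡ Δ)) (dist≤Δ (u∈C 1) (u∈C 0))
      moves (suc n) = ≤-respˡ-≈ (sym (similar j (u (suc n)) (u n)))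
          (≤-respʳ-≈ (sym (*-assoc _ _ _)) (<⇒≤ (0<τ j) *≤ moves n))
      go : (∃[ z ] z ∈ C × IsClusterPoint u z) → ∃[ z ] z ∈ C × f j z ≋ z
      go (z , z∈C , close) = z , z∈C , dist≤0⇒≋ (≤-ε⇒≤0 λ ε 0<ε → bound ε (halve 0<ε))
        where
        bound : ∀ ε → (∃[ δ ] 0# < δ × δ + δ ≈ ε) → dist (f j z) z ≤ ε
        bound ε (δ , 0<δ , 2δ≈ε) = bound′ (halve 0<δ)
          where
          bound′ : (∃[ η ] 0# < η × η + η ≈ δ) → dist (f j z) z ≤ ε
          bound′ (η , 0<η , 2η≈δ) = from (t^nΔ-small (0<τ j) (τ<1 j) 0<η)
            where
            from : (∃[ N ] ∀ n → N ℕ.≤ n → τ j ^ n * Δ < η) → dist (f j z) z ≤ ε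
            from (N , small) = at (close η 0<η N)
              where
              at : (∃[ n ] N ℕ.≤ n × dist z (u n) < η) → dist (f j z) z ≤ ε
              at (n , N≤n , zu<η) = ≤-trans (dist-triangle (f j z) (u (suc n)) z)
                  (≤-trans (fz-u +≤ dist-triangle (u (suc n)) (u n) z)
                (≤-trans (≤-refl +≤ (≤-trans (moves n) (<⇒≤ (small n N≤n)) +≤ u-z))
                    (≤-respʳ-≈ 2δ≈ε (≤-respʳ-≈ (+-cong 2η≈δ 2η≈δ)
                      (≤-by (<⇒≤ 0<η) (solve (η ∷ []) (x₀ :+ x₀ :+ (x₀ :+ x₀) :- (x₀ :+ (x₀ :+ x₀)))
                        (x₀ :- con 0ℤ)))))))
                where
                u-z : dist (u n) z ≤ η
                u-z = ≤-respˡ-≈ (dist-sym z (u n)) (<⇒≤ zu<η)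
                fz-u : dist (f j z) (f j (u n)) ≤ η
                fz-u = ≤-respˡ-≈ (sym (similar j z (u n))) (≤-trans (≤-respʳ-≈ (*-identityˡ _)
                  (*-mono-≤ (<⇒≤ (0<τ j)) (<⇒≤ (τ<1 j)) (0≤dist z (u n)) ≤-refl)) (<⇒≤ zu<η))

  fixed-rational : ∀ j {z} → f j z ≋ z → z ∈ Rational
  fixed-rational j {z} = F.fixed-rational j (τ<1 j) (f-rational j) {z}

  RationalC : Pred (ℝ^ d) 0ℓ
  RationalC x = x ∈ C × x ∈ Rational

  r₀ : ℝ^ d
  r₀ = proj₁ (fixed-point j₀)

  r₀∈ : r₀ ∈ RationalC
  r₀∈ = proj₁ (proj₂ (fixed-point j₀)) , fixed-rational j₀ {r₀} (proj₂ (proj₂ (fixed-point j₀)))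

  image∈ : ∀ j {x} → x ∈ RationalC → f j x ∈ RationalC
  image∈ j {x} (x∈C , rx) = C-image j x∈C , f-rational j x rx

  -- A common fixed point of all the f j would be the only point of C.
  opaque
    moved : ∃[ j ] ¬ f j r₀ ≋ r₀
    moved = ¬∀⇒∃¬ λ fixed → proj₂ (proj₂ (proj₂ (proj₂ two-points)))
        (≋-trans {y = r₀} (collapse fixed (proj₁ (proj₂ (proj₂ two-points))))
          (≋-sym {y = r₀} (collapse fixed (proj₁ (proj₂ (proj₂ (proj₂ two-points)))))))
      where
      near : (∀ j → f j r₀ ≋ r₀) → ∀ n {x} → x ∈ C → dist x r₀ ≤ t ^ n * Δ
      near fixed zero    x∈C = ≤-respʳ-≈ (sym (*-identityˡ Δ)) (dist≤Δ x∈C (proj₁ r₀∈))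
      near fixed (suc n) {x} x∈C = via (C-preimage x∈C)
        where
        via : (∃[ j ] ∃[ y ] y ∈ C × f j y ≋ x) → dist x r₀ ≤ t * t ^ n * Δ
        via (j , y , y∈C , eq) = ≤-respˡ-≈ (dist-cong {x = f j y} {y = f j r₀} eq (fixed j))
            (≤-respˡ-≈ (sym (similar j y r₀)) (≤-respʳ-≈ (sym (*-assoc _ _ _))
          (*-mono-≤ (<⇒≤ (0<τ j)) (τ≤t j) (0≤dist y r₀) (near fixed n y∈C))))
      collapse : (∀ j → f j r₀ ≋ r₀) → ∀ {x} → x ∈ C → x ≋ r₀
      collapse fixed {x} x∈C = dist≤0⇒≋ (≤-ε⇒≤0 λ ε 0<ε → from ε (t^nΔ-small 0<t t<1 0<ε))
        where
        from : ∀ ε → (∃[ N ] ∀ n → N ℕ.≤ n → t ^ n * Δ < ε) → dist x r₀ ≤ ε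
        from ε (N , small) = ≤-trans (near fixed N x∈C) (<⇒≤ (small N ℕP.≤-refl))

    -- Of two distinct points at least one differs from x. They are `r₀` and its displaced image,
    -- carried by injective maps into an n-th level cylinder around x.
    two-rational : ∀ n {x} → x ∈ C → ∃₂ λ a b → a ∈ RationalC × b ∈ RationalC × ¬ a ≋ b × dist x a ≤ t ^ n * Δ ×
        dist x b ≤ t ^ n * Δ
    two-rational zero {x} x∈C = r₀ , f (proj₁ moved) r₀ , r₀∈ , image∈ (proj₁ moved) r₀∈ ,
        (λ eq → proj₂ moved (≋-sym {x = r₀} eq)) ,
      ≤-respʳ-≈ (sym (*-identityˡ Δ)) (dist≤Δ x∈C (proj₁ r₀∈)) , ≤-respʳ-≈ (sym (*-identityˡ Δ))
          (dist≤Δ x∈C (C-image (proj₁ moved) (proj₁ r₀∈)))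
    two-rational (suc n) {x} x∈C = via (C-preimage x∈C)
      where
      via : (∃[ j ] ∃[ y ] y ∈ C × f j y ≋ x) →
            ∃₂ λ a b → a ∈ RationalC × b ∈ RationalC × ¬ a ≋ b × dist x a ≤ t * t ^ n * Δ × dist x b ≤ t * t ^ n * Δ
      via (j , y , y∈C , eq) = via′ (two-rational n y∈C)
        where
        scaled : ∀ a → dist y a ≤ t ^ n * Δ → dist x (f j a) ≤ t * t ^ n * Δ
        scaled a le = ≤-respˡ-≈ (dist-cong {x = f j y} {y = f j a} {y′ = f j a} eq ≋-refl)
            (≤-respˡ-≈ (sym (similar j y a)) (≤-respʳ-≈ (sym (*-assoc _ _ _))
          (*-mono-≤ (<⇒≤ (0<τ j)) (τ≤t j) (0≤dist y a) le)))
        via′ : (∃₂ λ a b → a ∈ RationalC × b ∈ RationalC × ¬ a ≋ b × dist y a ≤ t ^ n * Δ × dist y b ≤ t ^ n * Δ) →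
               ∃₂ λ a b → a ∈ RationalC × b ∈ RationalC × ¬ a ≋ b × dist x a ≤ t * t ^ n * Δ × dist x b ≤ t * t
                   ^ n * Δ
        via′ (a , b , a∈ , b∈ , a≉b , la , lb) = f j a , f j b , image∈ j a∈ , image∈ j b∈ ,
            (λ e → a≉b (F.f-injective j e)) , scaled a la , scaled b lb

    another-rational : ∀ {x} → x ∈ C → ∀ {ε} → 0# < ε → ∃[ y ] y ∈ RationalC × ¬ x ≋ y × dist x y < ε
    another-rational {x} x∈C {ε} 0<ε = from (t^nΔ-small 0<t t<1 0<ε)
      where
      from : (∃[ N ] ∀ n → N ℕ.≤ n → t ^ n * Δ < ε) → ∃[ y ] y ∈ RationalC × ¬ x ≋ y × dist x y < ε
      from (N , small) = choose (two-rational N x∈C)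
        where
        choose : (∃₂ λ a b → a ∈ RationalC × b ∈ RationalC × ¬ a ≋ b × dist x a ≤ t ^ N * Δ × dist x b ≤ t ^ N * Δ) →
                 ∃[ y ] y ∈ RationalC × ¬ x ≋ y × dist x y < ε
        choose (a , b , a∈ , b∈ , a≉b , la , lb) = case em {P = x ≋ a} of λ where
          (no x≉a)  → a , a∈ , x≉a , ≤-<-trans la (small N ℕP.≤-refl)
          (yes x≋a) → b , b∈ , (λ x≋b → a≉b (≋-trans {y = x} (≋-sym {y = a} x≋a) x≋b)) , ≤-<-trans lb
              (small N ℕP.≤-refl)

  smaller : ∀ {a b c} → 0# < a → 0# < b → 0# < c → ∃[ ρ ] 0# < ρ × ρ < a × ρ < b × ρ < c
  smaller {a} {b} {c} 0<a 0<b 0<c = go (below 0<b 0<c)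
    where
    below : ∀ {a b} → 0# < a → 0# < b → ∃[ ρ ] 0# < ρ × ρ < a × ρ < b
    below {a} {b} 0<a 0<b with <-or-≥ a b
    ... | inj₁ a<b = half (halve 0<a)
      where
      half : (∃[ δ ] 0# < δ × δ + δ ≈ a) → ∃[ ρ ] 0# < ρ × ρ < a × ρ < b
      half (δ , 0<δ , eq) = δ , 0<δ , δ<a , <-trans δ<a a<b
        where
        δ<a : δ < a
        δ<a = <-respʳ-≈ eq (<-by 0<δ (solve (δ ∷ []) (x₀ :+ x₀ :- x₀) (x₀ :- con 0ℤ)))
    ... | inj₂ b≤a = half (halve 0<b)
      where
      half : (∃[ δ ] 0# < δ × δ + δ ≈ b) → ∃[ ρ ] 0# < ρ × ρ < a × ρ < b
      half (δ , 0<δ , eq) = δ , 0<δ , <-≤-trans δ<b b≤a , δ<b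
        where
        δ<b : δ < b
        δ<b = <-respʳ-≈ eq (<-by 0<δ (solve (δ ∷ []) (x₀ :+ x₀ :- x₀) (x₀ :- con 0ℤ)))
    go : (∃[ ρ ] 0# < ρ × ρ < b × ρ < c) → ∃[ ρ ] 0# < ρ × ρ < a × ρ < b × ρ < c
    go (σ , 0<σ , σ<b , σ<c) = go′ (below 0<a 0<σ)
      where
      go′ : (∃[ ρ ] 0# < ρ × ρ < a × ρ < σ) → ∃[ ρ ] 0# < ρ × ρ < a × ρ < b × ρ < c
      go′ (ρ , 0<ρ , ρ<a , ρ<σ) = ρ , 0<ρ , ρ<a , <-trans ρ<σ σ<b , <-trans ρ<σ σ<c

  -- ξ is the limit of rational points of C, each chosen within the prescribed distance of its predecessor.
  module Nested (Ψ : ℕ → ℕ → ℝ) (0<Ψ : ∀ n q → 1 ℕ.≤ q → 0# < Ψ n q) where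

    record Stage (n : ℕ) : Set where
      field
        centre   : Fraction d
        centre∈C : ⟦ centre ⟧ ∈ C
        ρ        : ℝ
        0<ρ      : 0# < ρ
        ρ<Ψ      : ρ < Ψ n (den centre)
    open Stage

    -- `nested` puts the next closed ball inside the current one, and `outside` keeps the current
    -- centre out of it, which makes all centres distinct.
    record Next {n} (s : Stage n) : Set where
      field
        stage   : Stage (suc n)
        nested  : dist ⟦ centre s ⟧ ⟦ centre stage ⟧ + ρ stage ≤ ρ s
        outside : ρ stage < dist ⟦ centre s ⟧ ⟦ centre stage ⟧
    open Next

    opaque
      start : Stage 0
      start = go (toFraction (proj₂ r₀∈))
        where
        go : (∃[ r ] ⟦ r ⟧ ≋ r₀) → Stage 0
        go (r , eq) = go′ (smaller 0<1 (0<Ψ 0 (den r) (1≤den r)) (0<Ψ 0 (den r) (1≤den r)))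
          where
          go′ : (∃[ ρ ] 0# < ρ × ρ < 1# × ρ < Ψ 0 (den r) × ρ < Ψ 0 (den r)) → Stage 0
          go′ (ρ , 0<ρ , _ , ρ<Ψ , _) = record
              { centre = r ; centre∈C = C-resp (≋-sym {y = r₀} eq) (proj₁ r₀∈) ; ρ = ρ ; 0<ρ = 0<ρ ; ρ<Ψ = ρ<Ψ }

      next : ∀ {n} (s : Stage n) → Next s
      next {n} s = go (another-rational (centre∈C s) (0<ρ s))
        where
        go : (∃[ y ] y ∈ RationalC × ¬ ⟦ centre s ⟧ ≋ y × dist ⟦ centre s ⟧ y < ρ s) → Next s
        go (y , (y∈C , ry) , ≉y , <ρ) = go′ (toFraction ry)
          where
          go′ : (∃[ r ] ⟦ r ⟧ ≋ y) → Next s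
          go′ (r , eq) = go″ (smaller 0<ρ-δ 0<δ (0<Ψ (suc n) (den r) (1≤den r)))
            where
            δ : ℝ
            δ = dist ⟦ centre s ⟧ ⟦ r ⟧
            δ<ρ : δ < ρ s
            δ<ρ = <-respˡ-≈ (dist-cong {x = ⟦ centre s ⟧} {x′ = ⟦ centre s ⟧} {y = y} {y′ = ⟦ r ⟧} ≋-refl
                (≋-sym {y = y} eq)) <ρ
            0<δ : 0# < δ
            0<δ = 0<dist λ e → ≉y (≋-trans {y = ⟦ r ⟧} e eq)
            0<ρ-δ : 0# < ρ s - δ
            0<ρ-δ = <-by δ<ρ (solve ((ρ s) ∷ δ ∷ []) (x₀ :- x₁ :- con 0ℤ) (x₀ :- x₁))
            go″ : (∃[ σ ] 0# < σ × σ < ρ s - δ × σ < δ × σ < Ψ (suc n) (den r)) → Next s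
            go″ (σ , 0<σ , σ<ρ-δ , σ<δ , σ<Ψ) = record
              { stage   = record { centre = r ; centre∈C = C-resp (≋-sym {y = y} eq) y∈C ; ρ = σ ; 0<ρ = 0<σ ;
                  ρ<Ψ = σ<Ψ }
              ; nested  = δ+σ≤ρ
              ; outside = σ<δ }
              where
              δ+σ≤ρ : δ + σ ≤ ρ s
              δ+σ≤ρ = <⇒≤ (<-by σ<ρ-δ (solve ((ρ s) ∷ δ ∷ σ ∷ []) (x₀ :- (x₁ :+ x₂)) (x₀ :- x₁ :- x₂)))

    stages : ∀ n → Stage n
    stages zero    = start
    stages (suc n) = stage (next (stages n))

    r : ℕ → Fraction d
    r n = centre (stages n)

    P : ℕ → ℝ^ d
    P n = ⟦ r n ⟧

    radius : ℕ → ℝ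
    radius n = ρ (stages n)

    0<radius : ∀ n → 0# < radius n
    0<radius n = 0<ρ (stages n)

    nested-+ : ∀ k n → dist (P n) (P (k ℕ.+ n)) + radius (k ℕ.+ n) ≤ radius n
    nested-+ zero    n = ≤-reflexive (trans (+-congʳ (≋⇒dist≈0 {x = P n} {y = P n} ≋-refl)) (+-identityˡ _))
    nested-+ (suc k) n = ≤-trans (dist-triangle (P n) (P (k ℕ.+ n)) (P (suc k ℕ.+ n)) +≤ ≤-refl)
      (≤-trans (≤-by step (solve ((dist (P n) (P (k ℕ.+ n))) ∷ (radius (k ℕ.+ n)) ∷
          (dist (P (k ℕ.+ n)) (P ((suc k) ℕ.+ n))) ∷ (radius ((suc k) ℕ.+ n)) ∷ [])
            (x₀ :+ x₁ :- (x₀ :+ x₂ :+ x₃)) (x₁ :- (x₂ :+ x₃)))) (nested-+ k n))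
      where
      step : dist (P (k ℕ.+ n)) (P (suc k ℕ.+ n)) + radius (suc k ℕ.+ n) ≤ radius (k ℕ.+ n)
      step = nested (next (stages (k ℕ.+ n)))

    within : ∀ {m n} → n ℕ.≤ m → dist (P n) (P m) + radius m ≤ radius n
    within {m} {n} n≤m = ≡.subst (λ m → dist (P n) (P m) + radius m ≤ radius n) (ℕP.m∸n+n≡m n≤m)
        (nested-+ (m ℕ.∸ n) n)

    distinct : ∀ {m n} → m ℕ.< n → ¬ P m ≋ P n
    distinct {m} {n} m<n eq = <⇒≱ (outside (next (stages m))) (≤-trans
      (≤-respˡ-≈ (trans (dist-cong {x = P (suc m)} {y = P n} {y′ = P m} ≋-refl (≋-sym {x = P m} eq))
          (dist-sym (P (suc m)) (P m))) (≤-by (<⇒≤ (0<ρ (stages n))) lem))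
      (within m<n))
      where
      lem : ∀ {a b} → a + b - a ≈ b - 0#
      lem {a} {b} = solve (a ∷ b ∷ []) (x₀ :+ x₁ :- x₀) (x₁ :- con 0ℤ)

    opaque
      -- All later centres stay in the n-th closed ball, hence so does a cluster point. The
      -- inequality is strict because the radius was chosen strictly below Ψ.
      limit : ∃[ ξ ] ξ ∈ C × (∀ n → dist ξ (P n) < Ψ n (den (r n)))
      limit = go (cluster P (λ n → centre∈C (stages n)))
        where
        go : (∃[ ξ ] ξ ∈ C × IsClusterPoint P ξ) → ∃[ ξ ] ξ ∈ C × (∀ n → dist ξ (P n) < Ψ n (den (r n)))
        go (ξ , ξ∈C , close) = ξ , ξ∈C , λ n → ≤-<-trans (le n) (ρ<Ψ (stages n))
          where
          le : ∀ n → dist ξ (P n) ≤ radius n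
          le n = ≤-by (≤-ε⇒≤0 {dist ξ (P n) - radius n} λ ε 0<ε → at ε (close ε 0<ε n))
              (solve ((radius n) ∷ (dist ξ (P n)) ∷ []) (x₀ :- x₁) (con 0ℤ :- (x₁ :- x₀)))
            where
            at : ∀ ε → (∃[ m ] n ℕ.≤ m × dist ξ (P m) < ε) → dist ξ (P n) - radius n ≤ ε
            at ε (m , n≤m , lt) = ≤-by (dist-triangle ξ (P m) (P n) +≤ <⇒≤ lt +≤ within n≤m +≤ <⇒≤ (0<radius m)
                +≤ ≤-reflexive (dist-sym (P m) (P n)))
                  (solve (ε ∷ (dist ξ (P n)) ∷ (radius n) ∷ (dist ξ (P m)) ∷ (dist (P m) (P n)) ∷ (radius m) ∷
                    (dist (P n) (P m)) ∷ []) (x₀ :- (x₁ :- x₂))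
                      (x₃ :+ x₄ :+ x₀ :+ x₂ :+ x₅ :+ x₆ :- (x₁ :+ x₃ :+ (x₆ :+ x₅) :+ con 0ℤ :+ x₄)))

-- Statements (2) and (3), and the reduction of (1) to large denominators.

module Approximation
  (em : ∀ {ℓ} → ExcludedMiddle ℓ) (𝓡 : RealNumbers)
  {d J : ℕ} (2≤J : 2 ℕ.≤ J) (f : Fin J → Real.ℝ^_ 𝓡 d → Real.ℝ^_ 𝓡 d) (τ : Fin J → Real.ℝ 𝓡)
  (contracting : ∀ j → Real.IsContractingSimilarity 𝓡 (τ j) (f j))
  (f-rational : ∀ j x → x ∈ Real.Rational 𝓡 → f j x ∈ Real.Rational 𝓡)
  (C : Pred (Real.ℝ^_ 𝓡 d) 0ℓ) (attractor : Real.IsAttractor 𝓡 f C) (two-points : Real.HasTwoPoints 𝓡 C) where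

  open Real 𝓡 hiding (zero)
  open Solver 𝓡
  open OrderedField em 𝓡
  open Classical em
  open Space em 𝓡
  open Fractions em 𝓡
  open IteratedFunctionSystem em 𝓡 2≤J f τ contracting f-rational C attractor two-points

  ⁻¹-antitone : ∀ {a b} → 0# < a → a ≤ b → b ⁻¹ ≤ a ⁻¹
  ⁻¹-antitone {a} {b} 0<a a≤b = *-cancelˡ-≤ 0<a (≤-respʳ-≈ (sym (x*x⁻¹≈1 0<a)) (≤-respʳ-≈ (x*x⁻¹≈1 0<b)
      (≤-respˡ-≈ (*-comm _ _) (≤-respʳ-≈ (*-comm _ _) (<⇒≤ (0<x⁻¹ 0<b) *≤ a≤b)))))
    where
    0<b : 0# < b
    0<b = <-≤-trans 0<a a≤b

  0<den′ : ∀ q → 1 ℕ.≤ q → 0# < fromℕ q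
  0<den′ (suc q) _ = 0<fromℕ (suc q)

  intrinsic : (Ψ : ℕ → ℝ) → (∀ n → 1 ℕ.≤ n → 0# < Ψ n) → ∃[ ξ ] ξ ∈ IntrinsicallyApproximable Ψ C
  intrinsic Ψ 0<Ψ = ξ , proj₁ (proj₂ limit) , infinitelyMany {P = λ s → ⟦ s ⟧ ∈ C × ‖ ξ ⊖ ⟦ s ⟧ ‖ < Ψ (den s)} r
      (λ n → Stage.centre∈C (stages n) , ≡.subst (_< Ψ (den (r n))) (dist≡‖⊖‖ ξ (P n)) (proj₂ (proj₂ limit) n))
          distinct
    where
    open Nested (λ _ → Ψ) (λ _ → 0<Ψ)
    ξ : ℝ^ d
    ξ = proj₁ limit

  -- The exponent grows with the stage, so one limit serves every N: from stage N on the exponent is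
  -- at least N.
  liouville : ∃[ ξ ] ξ ∈ C × ξ ∈ Liouville
  liouville = ξ , proj₁ (proj₂ limit) , λ N → infinitelyMany {P = λ s → ‖ ξ ⊖ ⟦ s ⟧ ‖ < (fromℕ (den s) ^ N) ⁻¹}
      (λ n → r (n ℕ.+ N))
      (λ n → ≡.subst (_< (fromℕ (den (r (n ℕ.+ N))) ^ N) ⁻¹) (dist≡‖⊖‖ ξ (P (n ℕ.+ N)))
        (<-≤-trans (proj₂ (proj₂ limit) (n ℕ.+ N))
            (⁻¹-antitone (0<x^n N (0<den (r (n ℕ.+ N)))) (mono n N (r (n ℕ.+ N))))))
      (λ m<n → distinct (ℕP.+-monoˡ-< N m<n))
    where
    open Nested (λ n q → (fromℕ q ^ n) ⁻¹) (λ n q 1≤q → 0<x⁻¹ (0<x^n n (0<den′ q 1≤q)))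
    ξ : ℝ^ d
    ξ = proj₁ limit
    mono : ∀ n N (s : Fraction d) → fromℕ (den s) ^ N ≤ fromℕ (den s) ^ (n ℕ.+ N)
    mono n N s = ≤-respʳ-≈ (sym (^-+ (fromℕ (den s)) n N)) (≤-respˡ-≈ (*-identityˡ _)
      (*-mono-≤ 0≤1 (1≤x^n n (≤-respˡ-≈ (+-identityʳ 1#) (fromℕ-mono-≤ (1≤den s)))) (0≤x^n N (<⇒≤ (0<den s))) ≤-refl))

  module Extrinsic (Φ : ℕ → ℝ) (0<Φ : ∀ n → 1 ℕ.≤ n → 0# < Φ n) (Φ→0 : Φ ⟶ 0#) where

    -- A centre with denominator q is at distance at least 1 / (q Q) from every fraction outside C
    -- with denominator up to Q. Of this, ξ uses up less than 1 / (w Q) and Φ(Q) / Q must fit into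
    -- the rest; as w = 2 (q + 1) exceeds 2 q, it does when Φ(Q) < 1 / w.
    w : ℕ → ℝ
    w q = fromℕ 2 * fromℕ (suc q)

    0<w : ∀ q → 0# < w q
    0<w q = *-pos (0<fromℕ 2) (0<fromℕ (suc q))

    threshold : ∀ q → ∃[ M ] ∀ n → M ℕ.≤ n → ∣ Φ n - 0# ∣ < w q ⁻¹
    threshold q = Φ→0 (w q ⁻¹) (0<x⁻¹ (0<w q))

    -- Past the threshold of Φ for the denominator q, and also past n, so that arbitrarily large
    -- values occur.
    Q : ℕ → ℕ → ℕ
    Q n q = proj₁ (threshold q) ℕ.+ suc n

    ΦQ*w<1 : ∀ n q → Φ (Q n q) * w q < 1#
    ΦQ*w<1 n q = <-respʳ-≈ (trans (*-comm _ _) (x*x⁻¹≈1 (0<w q)))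
        (<-respˡ-≈ (*-comm _ _) (<-respʳ-≈ (*-comm _ _)
            (0<w q *< ≤-<-trans Φ≤ (proj₂ (threshold q) (Q n q) (ℕP.m≤m+n _ (suc n))))))
      where
      Φ≤ : Φ (Q n q) ≤ ∣ Φ (Q n q) - 0# ∣
      Φ≤ = ≤-by (x≤∣x∣ (Φ (Q n q) - 0#))
          (solve ((∣ ((Φ (Q n q)) - 0#) ∣) ∷ (Φ (Q n q)) ∷ []) (x₀ :- x₁) (x₀ :- (x₁ :- con 0ℤ)))

    n<Q : ∀ n q → n ℕ.< Q n q
    n<Q n q = ℕP.m≤n+m (suc n) (proj₁ (threshold q))

    0<Q : ∀ n q → 0# < fromℕ (Q n q)
    0<Q n q = 0<den′ (Q n q) (ℕP.≤-trans (s≤s z≤n) (n<Q n q))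

    0<wQ : ∀ n q → 0# < w q * fromℕ (Q n q)
    0<wQ n q = *-pos (0<w q) (0<Q n q)

    open Nested (λ n q → (w q * fromℕ (Q n q)) ⁻¹) (λ n q _ → 0<x⁻¹ (0<wQ n q))

    lim : ∃[ ξ ] ξ ∈ C × (∀ n → dist ξ (P n) < (w (den (r n)) * fromℕ (Q n (den (r n)))) ⁻¹)
    lim = limit

    ξ : ℝ^ d
    ξ = proj₁ lim

    q : ℕ → ℕ
    q n = den (r n)

    Qₙ : ℕ → ℕ
    Qₙ n = Q n (q n)

    close : ∀ n → dist ξ (P n) * (w (q n) * fromℕ (Qₙ n)) < 1#
    close n = <-respˡ-≈ (*-comm _ _) (<-respʳ-≈ (x*x⁻¹≈1 (0<wQ n (q n))) (0<wQ n (q n) *< proj₂ (proj₂ limit) n))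

    1≤Q : ∀ n → 1 ℕ.≤ Qₙ n
    1≤Q n = ℕP.≤-trans (s≤s z≤n) (n<Q n (q n))

    far : ∀ n s → ⟦ s ⟧ ∉ C → den s ℕ.≤ Qₙ n → Φ (Qₙ n) ÷ fromℕ (Qₙ n) < dist ξ ⟦ s ⟧
    far n s s∉C s≤Q = ÷< (0<Q n (q n)) (*-cancelˡ-< (0≤x*y (0≤fromℕ 2) 0≤q)
        (from X Y B q′ (0≤dist ξ (P n)) 0≤B (0<Φ (Qₙ n) (1≤Q n)) sep (ΦQ*w<1 n (q n)) (close n)))
      where
      X Y B q′ : ℝ
      X = dist ξ ⟦ s ⟧
      Y = dist ξ (P n)
      B = fromℕ (Qₙ n)
      q′ = fromℕ (q n)
      0≤B : 0# ≤ B
      0≤B = 0≤fromℕ (Qₙ n)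
      0≤q : 0# ≤ q′
      0≤q = 0≤fromℕ (q n)
      sep : 1# ≤ (Y + X) * (q′ * B)
      sep = ≤-trans (separation (r n) s (λ e → s∉C (C-resp e (Stage.centre∈C (stages n)))))
        (*-mono-≤ (0≤dist (P n) ⟦ s ⟧) tri (0≤x*y 0≤q (0≤fromℕ (den s))) (0≤q *≤ fromℕ-mono-≤ s≤Q))
        where
        tri : dist (P n) ⟦ s ⟧ ≤ Y + X
        tri = ≤-trans (dist-triangle (P n) ξ ⟦ s ⟧) (≤-reflexive (dist-sym (P n) ξ) +≤ ≤-refl)
      from : ∀ X Y B q {φ} → 0# ≤ Y → 0# ≤ B → 0# < φ → 1# ≤ (Y + X) * (q * B) →
             φ * (fromℕ 2 * (1# + q)) < 1# → Y * (fromℕ 2 * (1# + q) * B) < 1# → fromℕ 2 * q * φ < fromℕ 2 * q *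
                 (X * B)
      from X Y B q {φ} 0≤Y 0≤B 0<φ 1≤ φ<1 Y<1 =
        <-by (φ<1 <+ (<⇒≤ 0<φ +≤ <⇒≤ 0<φ) <+ (1≤ +≤ 1≤) <+ <⇒≤ Y<1 <+ (0≤x*y 0≤Y 0≤B +≤ 0≤x*y 0≤Y 0≤B))
            (solve (q ∷ X ∷ B ∷ φ ∷ Y ∷ []) (con (+ 2) :* x₀ :* (x₁ :* x₂) :- con (+ 2) :* x₀ :* x₃)
              (con 1ℤ :+ (x₃ :+ x₃) :+ ((x₄ :+ x₁) :* (x₀ :* x₂) :+ (x₄ :+ x₁) :* (x₀ :* x₂)) :+ con 1ℤ :+
                (x₄ :* x₂ :+ x₄ :* x₂) :- (x₃ :* (con (+ 2) :* (con 1ℤ :+ x₀)) :+ (con 0ℤ :+ con 0ℤ) :+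
                  (con 1ℤ :+ con 1ℤ) :+ x₄ :* (con (+ 2) :* (con 1ℤ :+ x₀) :* x₂) :+ (con 0ℤ :+ con 0ℤ))))

    -- A rational ξ with denominator b would violate the separation of fractions at the stages b and
    -- b + 1, where Q exceeds b, unless it equals both centres; but these are distinct.
    ξ∉Rational : ξ ∉ Rational
    ξ∉Rational ξ-rational = go (toFraction ξ-rational)
      where
      go : (∃[ s ] ⟦ s ⟧ ≋ ξ) → ⊥
      go (s , s≋ξ) = case em {P = ⟦ s ⟧ ≋ P b} of λ where
          (no s≉)   → apart b ℕP.≤-refl s≉
          (yes s≋P) → apart (suc b) (ℕP.n≤1+n b) λ s≋P′ → distinct (ℕP.n<1+n b)
              (≋-trans {y = ⟦ s ⟧} (≋-sym {y = P b} s≋P) s≋P′)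
        where
        b : ℕ
        b = den s
        apart : ∀ n → b ℕ.≤ n → ¬ ⟦ s ⟧ ≋ P n → ⊥
        apart n b≤n s≉P = <⇒≱ (close n) (≤-trans (separation s (r n) s≉P)
            (*-mono-≤ (0≤dist ⟦ s ⟧ (P n)) (≤-reflexive (dist-cong {x = ⟦ s ⟧} {y = P n} {y′ = P n} s≋ξ ≋-refl))
              (0≤x*y (0≤fromℕ b) (0≤fromℕ (q n)))
                  (le (fromℕ (q n)) (0≤fromℕ b) (0≤fromℕ (q n))
                    (fromℕ-mono-≤ (ℕP.≤-trans b≤n (ℕP.<⇒≤ (n<Q n (q n))))))))
          where
          le : ∀ a {b c} → 0# ≤ b → 0# ≤ a → b ≤ c → b * a ≤ fromℕ 2 * (1# + a) * c
          le a {b} {c} 0≤b 0≤a b≤c = ≤-by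
              (0≤a *≤ b≤c +≤ 0≤a *≤ (≤-trans 0≤b b≤c) +≤ ≤-trans 0≤b b≤c +≤ ≤-trans 0≤b b≤c)
                (solve (a ∷ c ∷ b ∷ []) (con (+ 2) :* (con 1ℤ :+ x₀) :* x₁ :- x₂ :* x₀)
                  (x₀ :* x₁ :+ x₀ :* x₁ :+ x₁ :+ x₁ :- (x₀ :* x₂ :+ x₀ :* con 0ℤ :+ con 0ℤ :+ con 0ℤ)))

  extrinsic : (Φ : ℕ → ℝ) → (∀ n → 1 ℕ.≤ n → 0# < Φ n) → Φ ⟶ 0# →
       ∃[ ξ ] ξ ∈ C × ξ ∉ Rational ×
         (∀ N → ∃[ Q ] N ℕ.< Q ×
            (∀ r → ⟦ r ⟧ ∉ C → den r ℕ.≤ Q →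
               Φ Q ÷ fromℕ Q < ‖ ξ ⊖ ⟦ r ⟧ ‖))
  extrinsic Φ 0<Φ Φ→0 = E.ξ , proj₁ (proj₂ E.lim) , E.ξ∉Rational , λ N → E.Qₙ N , E.n<Q N (E.q N) ,
      λ r r∉C r≤Q → ≡.subst (Φ (E.Qₙ N) ÷ fromℕ (E.Qₙ N) <_) (dist≡‖⊖‖ E.ξ ⟦ r ⟧) (E.far N r r∉C r≤Q)
    where module E = Extrinsic Φ 0<Φ Φ→0

  -- For denominators below N₀ an integer vector far away from C serves.
  Avoidable : Set
  Avoidable = ∃[ K ] 0# ≤ K × ∃[ N₀ ] (∀ {ξ} → ξ ∈ C → ∀ N → N₀ ℕ.≤ N → 1 ℕ.≤ N →
    ∃[ r ] ⟦ r ⟧ ∉ C × den r ℕ.≤ N × dist ξ ⟦ r ⟧ * fromℕ N ≤ K)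

  -- A coordinate in which two given points of C differ.
  dimension>0 : Fin d
  dimension>0 = proj₁ (¬∀⇒∃¬ (proj₂ (proj₂ (proj₂ (proj₂ two-points)))))

  opaque
    outside-point : ∃[ r ] ⟦ r ⟧ ∉ C × den r ≡ 1 × ∃[ M ] 0# ≤ M × (∀ {ξ} → ξ ∈ C → dist ξ ⟦ r ⟧ ≤ M)
    outside-point = go (bounded o)
      where
      o : ℝ^ d
      o _ = 0#
      go : (∃[ M ] 0# ≤ M × (∀ {x} → x ∈ C → dist o x ≤ M)) → ∃[ r ] ⟦ r ⟧ ∉ C × den r ≡ 1 × ∃[ M ] 0# ≤ M ×
          (∀ {ξ} → ξ ∈ C → dist ξ ⟦ r ⟧ ≤ M)
      go (M , 0≤M , ≤M) = go′ (archimedean M)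
        where
        go′ : (∃[ L ] M < fromℕ L) → ∃[ r ] ⟦ r ⟧ ∉ C × den r ≡ 1 × ∃[ M ] 0# ≤ M × (∀ {ξ} → ξ ∈ C → dist ξ ⟦ r ⟧ ≤ M)
        go′ (L , M<L) = p , p∉C , ≡.refl , M + fromℕ L , ≤-by (0≤M +≤ 0≤fromℕ L) (solve (M ∷ (fromℕ L) ∷ []) (x₀ :+ x₁ :- con 0ℤ) (x₀ :+ x₁ :- (con 0ℤ :+ con 0ℤ))) , λ {ξ} ξ∈C →
            ≤-trans (dist-triangle ξ o ⟦ p ⟧)
                (≤-respˡ-≈ (dist-sym o ξ) (≤M ξ∈C) +≤ dist≤ o ⟦ p ⟧ (0≤fromℕ L) λ i → ≤-reflexive (∣o-p∣ i))
          where
          p : Fraction d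
          p = (λ _ → + L) / 1
          p≈L : ∀ i → ⟦ p ⟧ i ≈ fromℕ L
          p≈L i = *-cancelʳ-≈ (0<fromℕ 1) (trans (⟦⟧*den p i) (solve ((fromℕ L) ∷ []) x₀ (x₀ :* (con 1ℤ :+ con 0ℤ))))
          ∣o-p∣ : ∀ i → ∣ o i - ⟦ p ⟧ i ∣ ≈ fromℕ L
          ∣o-p∣ i = trans (sym (∣-x∣≈∣x∣ _)) (trans (∣∣-cong (trans (lem (⟦ p ⟧ i)) (p≈L i))) (0≤x⇒∣x∣≈x (0≤fromℕ L)))
            where
            lem : ∀ a → - (0# - a) ≈ a
            lem a = solve (a ∷ []) (:- (con 0ℤ :- x₀)) x₀
          p∉C : ⟦ p ⟧ ∉ C
          p∉C p∈C = <⇒≱ M<L (≤-respˡ-≈ (∣o-p∣ dimension>0) (≤-trans (∣-∣≤dist o ⟦ p ⟧ dimension>0) (≤M p∈C)))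

  avoid : Avoidable → ∃[ K ] 0# < K ×
       (∀ ξ → ξ ∈ C → ∀ Q → 1# < Q →
          ∃[ r ] ⟦ r ⟧ ∉ C × fromℕ (den r) ≤ Q × ‖ ξ ⊖ ⟦ r ⟧ ‖ ≤ K ÷ Q)
  avoid (K , 0≤K , N₀ , near) = with-point outside-point
    where
    Goal : Set
    Goal = ∃[ K ] 0# < K × (∀ ξ → ξ ∈ C → ∀ Q → 1# < Q →
          ∃[ r ] ⟦ r ⟧ ∉ C × fromℕ (den r) ≤ Q × ‖ ξ ⊖ ⟦ r ⟧ ‖ ≤ K ÷ Q)
    with-point : (∃[ r ] ⟦ r ⟧ ∉ C × den r ≡ 1 × ∃[ M ] 0# ≤ M × (∀ {ξ} → ξ ∈ C → dist ξ ⟦ r ⟧ ≤ M)) → Goal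
    with-point (p , p∉C , den≡1 , M , 0≤M , ≤M) = K′ , 0<K′ , λ ξ ξ∈C Q 1<Q → at ξ ξ∈C Q 1<Q
        (floorℕ Q (<⇒≤ (<-trans 0<1 1<Q)))
      where
      0≤MN₀ : 0# ≤ M * fromℕ N₀
      0≤MN₀ = 0≤x*y 0≤M (0≤fromℕ N₀)
      -- For N the integer part of Q, Q < N + 1 ≤ 2 N doubles K. The term `M * fromℕ N₀` serves Q
      -- below N₀, and 1 makes the constant positive.
      K′ : ℝ
      K′ = K + K + M * fromℕ N₀ + 1#
      0<K′ : 0# < K′
      0<K′ = <-by (0≤K +≤ 0≤K +≤ 0≤MN₀ ≤+ 0<1)
          (solve (K ∷ M ∷ (fromℕ N₀) ∷ []) (x₀ :+ x₀ :+ x₁ :* x₂ :+ con 1ℤ :- con 0ℤ)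
            (x₀ :+ x₀ :+ x₁ :* x₂ :+ con 1ℤ :- (con 0ℤ :+ con 0ℤ :+ con 0ℤ :+ con 0ℤ)))
      Solution : ℝ^ d → ℝ → Set
      Solution ξ Q = ∃[ r ] ⟦ r ⟧ ∉ C × fromℕ (den r) ≤ Q × ‖ ξ ⊖ ⟦ r ⟧ ‖ ≤ K′ ÷ Q
      solution : ∀ ξ Q → 0# < Q → ∀ r → ⟦ r ⟧ ∉ C → fromℕ (den r) ≤ Q → dist ξ ⟦ r ⟧ * Q ≤ K′ → Solution ξ Q
      solution ξ Q 0<Q r r∉C r≤Q le = r , r∉C , r≤Q , ≡.subst (_≤ K′ ÷ Q) (dist≡‖⊖‖ ξ ⟦ r ⟧) (≤÷ 0<Q le)
      at : ∀ ξ → ξ ∈ C → ∀ Q → 1# < Q → (∃[ N ] fromℕ N ≤ Q × Q < fromℕ (suc N)) → Solution ξ Q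
      at ξ ξ∈C Q 1<Q (N , N≤Q , Q<N+1) = case N₀ ℕ.≤? N of λ where
          (yes N₀≤N) → large (near ξ∈C N N₀≤N 1≤N)
          (no  N₀≰N) → solution ξ Q 0<Q p p∉C
              (≤-respˡ-≈ (reflexive (≡.cong fromℕ (≡.sym den≡1))) (≤-respˡ-≈ (sym (+-identityʳ 1#)) (<⇒≤ 1<Q)))
            (≤-trans (*-mono-≤ (0≤dist ξ ⟦ p ⟧) (≤M ξ∈C) (<⇒≤ 0<Q) (≤-trans (<⇒≤ Q<N+1) (fromℕ-mono-≤ (ℕP.≰⇒> N₀≰N))))
              (≤-by (0≤K +≤ 0≤K +≤ 0≤1) (solve (K ∷ M ∷ (fromℕ N₀) ∷ [])
                  (x₀ :+ x₀ :+ x₁ :* x₂ :+ con 1ℤ :- x₁ :* x₂) (x₀ :+ x₀ :+ con 1ℤ :- (con 0ℤ :+ con 0ℤ :+ con 0ℤ)))))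
        where
        0<Q : 0# < Q
        0<Q = <-trans 0<1 1<Q
        1≤N : 1 ℕ.≤ N
        1≤N = ℕP.≤-pred (fromℕ-cancel-< {1} {suc N} (<-trans (<-respˡ-≈ (sym (+-identityʳ 1#)) 1<Q) Q<N+1))
        large : (∃[ r ] ⟦ r ⟧ ∉ C × den r ℕ.≤ N × dist ξ ⟦ r ⟧ * fromℕ N ≤ K) → Solution ξ Q
        large (r , r∉C , r≤N , le) = solution ξ Q 0<Q r r∉C (≤-trans (fromℕ-mono-≤ r≤N) N≤Q)
          (≤-trans (0≤dist ξ ⟦ r ⟧ *≤ Q≤2N)
              (≤-by (le +≤ le +≤ 0≤MN₀ +≤ 0≤1)
                (solve (K ∷ M ∷ (fromℕ N₀) ∷ (dist ξ ⟦ r ⟧) ∷ (fromℕ N) ∷ [])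
                  (x₀ :+ x₀ :+ x₁ :* x₂ :+ con 1ℤ :- x₃ :* (x₄ :+ x₄))
                    (x₀ :+ x₀ :+ x₁ :* x₂ :+ con 1ℤ :- (x₃ :* x₄ :+ x₃ :* x₄ :+ con 0ℤ :+ con 0ℤ)))))
          where
          Q≤2N : Q ≤ fromℕ N + fromℕ N
          Q≤2N = ≤-by (<⇒≤ Q<N+1 +≤ fromℕ-mono-≤ 1≤N)
              (solve ((fromℕ N) ∷ Q ∷ []) (x₀ :+ x₀ :- x₁) (con 1ℤ :+ x₀ :+ x₀ :- (x₁ :+ (con 1ℤ :+ con 0ℤ))))

-- Packing of points in cubes, and rounding to a given denominator.

module Packing (em : ∀ {ℓ} → ExcludedMiddle ℓ) (𝓡 : RealNumbers) where

  open Real 𝓡 hiding (zero)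
  open Solver 𝓡
  open OrderedField em 𝓡
  open Space em 𝓡
  open Fractions em 𝓡
  private
    module ≈R where open import Relation.Binary.Reasoning.Setoid setoid public

  opaque
    lower-bound : ∀ {n} (x : Vector ℝ n) → (∀ i → 0# < x i) → ∃[ μ ] 0# < μ × (∀ i → μ ≤ x i)
    lower-bound {zero}  x 0<x = 1# , 0<1 , λ ()
    lower-bound {suc n} x 0<x = go (lower-bound (x ∘ suc) (0<x ∘ suc))
      where
      go : (∃[ μ ] 0# < μ × (∀ i → μ ≤ x (suc i))) → ∃[ μ ] 0# < μ × (∀ i → μ ≤ x i)
      go (μ , 0<μ , μ≤) with <-or-≥ μ (x zero)
      ... | inj₁ μ<x₀ = μ , 0<μ , λ { zero → <⇒≤ μ<x₀ ; (suc i) → μ≤ i }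
      ... | inj₂ x₀≤μ = x zero , 0<x zero , λ { zero → ≤-refl ; (suc i) → ≤-trans x₀≤μ (μ≤ i) }

    -- Two of the points lie in the same cell of a grid of L^d cubes of side h.
    packing : ∀ {d} (ξ : ℝ^ d) {B h} (L : ℕ) → 0# < h → B + B < fromℕ L * h →
              (p : Fin (suc (L ℕ.^ d)) → ℝ^ d) → (∀ a → dist ξ (p a) ≤ B) →
              ∃₂ λ a b → a ≢ b × dist (p a) (p b) < h
    packing {d} ξ {B} {h} L 0<h 2B<Lh p near = same-cell
        (FinP.pigeonhole (ℕP.n<1+n (L ℕ.^ d)) (λ a → Fin.funToFin (cell a)))
      where
      u : Fin (suc (L ℕ.^ d)) → Fin d → ℝ
      u a i = (p a i - ξ i + B) * h ⁻¹
      uh : ∀ a i → u a i * h ≈ p a i - ξ i + B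
      uh a i = x÷y*y≈x (p a i - ξ i + B) 0<h
      0≤u : ∀ a i → 0# ≤ u a i
      0≤u a i = ≤÷ 0<h (≤-by (≤-trans (x≤∣x∣ (ξ i - p a i)) (≤-trans (∣-∣≤dist ξ (p a) i) (near a)))
          (solve ((p a i) ∷ (ξ i) ∷ B ∷ h ∷ []) (x₀ :- x₁ :+ x₂ :- con 0ℤ :* x₃) (x₂ :- (x₁ :- x₀))))
      u<L : ∀ a i → u a i < fromℕ L
      u<L a i = ÷< 0<h (<-by (≤-trans (-x≤∣x∣ (ξ i - p a i)) (≤-trans (∣-∣≤dist ξ (p a) i) (near a)) ≤+ 2B<Lh)
          (solve ((fromℕ L) ∷ h ∷ (p a i) ∷ (ξ i) ∷ B ∷ []) (x₀ :* x₁ :- (x₂ :- x₃ :+ x₄))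
            (x₄ :+ x₀ :* x₁ :- ((:- (x₃ :- x₂)) :+ (x₄ :+ x₄)))))
      floored : ∀ a i → ∃[ m ] fromℕ m ≤ u a i × u a i < fromℕ (suc m)
      floored a i = floorℕ (u a i) (0≤u a i)
      m : Fin (suc (L ℕ.^ d)) → Fin d → ℕ
      m a i = proj₁ (floored a i)
      m<L : ∀ a i → m a i ℕ.< L
      m<L a i = fromℕ-cancel-< {m a i} {L} (≤-<-trans (proj₁ (proj₂ (floored a i))) (u<L a i))
      cell : Fin (suc (L ℕ.^ d)) → Fin d → Fin L
      cell a i = Fin.fromℕ< (m<L a i)
      same-cell : (∃₂ λ a b → a Fin.< b × Fin.funToFin (cell a) ≡ Fin.funToFin (cell b)) → ∃₂ λ a b → a ≢ b ×
          dist (p a) (p b) < h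
      same-cell (a , b , a<b , eq) = a , b , FinP.<⇒≢ a<b , dist< (p a) (p b) 0<h λ i → ∣x∣< (lt a b i (m≡ i))
          (<-respˡ-≈ (neg (p a i) (p b i)) (lt b a i (≡.sym (m≡ i))))
        where
        neg : ∀ a b → b - a ≈ - (a - b)
        neg a b = solve (b ∷ a ∷ []) (x₀ :- x₁) (:- (x₁ :- x₀))
        m≡ : ∀ i → m a i ≡ m b i
        m≡ i = FinP.fromℕ<-injective _ _ (m<L a i) (m<L b i)
          (≡.trans (≡.sym (FinP.finToFun-funToFin (cell a) i))
              (≡.trans (≡.cong (λ c → Fin.finToFun c i) eq) (FinP.finToFun-funToFin (cell b) i)))
        cell-width : ∀ x y ξ {u v} → u * h ≈ x - ξ + B → v * h ≈ y - ξ + B → u < 1# + v → x - y < h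
        cell-width x y ξ {u} {v} uh vh u<1+v = <-by (0<h *< u<1+v) (begin
          h - (x - y)                                  ≈⟨ lem x y ξ B h ⟩
          h + ((y - ξ + B) - (x - ξ + B))              ≈⟨ +-congˡ (+-cong vh (-‿cong uh)) ⟨
          h + (v * h - u * h)                          ≈⟨ lem′ u v h ⟩
          h * (1# + v) - h * u                         ∎)
          where
          open ≈R
          lem : ∀ x y ξ B h → h - (x - y) ≈ h + ((y - ξ + B) - (x - ξ + B))
          lem x y ξ B h = (solve (h ∷ x ∷ y ∷ ξ ∷ B ∷ []) (x₀ :- (x₁ :- x₂))
              (x₀ :+ (x₂ :- x₃ :+ x₄ :- (x₁ :- x₃ :+ x₄))))
          lem′ : ∀ a b h → h + (b * h - a * h) ≈ h * (1# + b) - h * a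
          lem′ a b h = solve (h ∷ b ∷ a ∷ []) (x₀ :+ (x₁ :* x₀ :- x₂ :* x₀)) (x₀ :* (con 1ℤ :+ x₁) :- x₀ :* x₂)
        ub : (a b : Fin (suc (L ℕ.^ d))) (i : Fin d) → m a i ≡ m b i → u a i < 1# + u b i
        ub a b i eq = <-≤-trans (proj₂ (proj₂ (floored a i)))
            (≤-refl +≤ ≤-respˡ-≈ (reflexive (≡.cong fromℕ (≡.sym eq))) (proj₁ (proj₂ (floored b i))))
        lt : (a b : Fin (suc (L ℕ.^ d))) (i : Fin d) → m a i ≡ m b i → p a i - p b i < h
        lt a b i eq = cell-width (p a i) (p b i) (ξ i) {u a i} {u b i} (uh a i) (uh b i) (ub a b i eq)

    round : ∀ {d} (y : ℝ^ d) N .{{_ : NonZero N}} → ∃[ r ] den r ≡ N × dist y ⟦ r ⟧ * fromℕ N < 1#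
    round {d} y N = r , ≡.refl , <-respˡ-≈ (*-comm _ _)
        (<-respʳ-≈ (trans (*-comm _ _) (x÷y*y≈x 1# 0<N)) (0<N *< dist< y ⟦ r ⟧ (0<x÷y 0<1 0<N) λ i →
        <÷ 0<N (<-respˡ-≈ (trans (∣∣-cong (eq i)) (trans (∣x*y∣ _ _) (*-congˡ (0≤x⇒∣x∣≈x (<⇒≤ 0<N))))) (frac i))))
      where
      0<N : 0# < fromℕ N
      0<N = 0<fromℕ N
      p : Fin d → ℤ
      p i = proj₁ (floor (y i * fromℕ N))
      r : Fraction d
      r = p / N
      eq : ∀ i → y i * fromℕ N - fromℤ (p i) ≈ (y i - ⟦ r ⟧ i) * fromℕ N
      eq i = trans (+-congˡ (-‿cong (sym (⟦⟧*den r i)))) (lem (y i) (⟦ r ⟧ i) (fromℕ N))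
        where
        lem : ∀ a b c → a * c - b * c ≈ (a - b) * c
        lem a b c = solve (a ∷ c ∷ b ∷ []) (x₀ :* x₁ :- x₂ :* x₁) ((x₀ :- x₂) :* x₁)
      frac : ∀ i → ∣ y i * fromℕ N - fromℤ (p i) ∣ < 1#
      frac i = ∣x∣< (upper (y i * fromℕ N) (fromℤ (p i)) (proj₂ (proj₂ (floor (y i * fromℕ N)))))
                    (lower (y i * fromℕ N) (fromℤ (p i)) (proj₁ (proj₂ (floor (y i * fromℕ N)))))
        where
        upper : ∀ a b → a < b + 1# → a - b < 1#
        upper a b lt = <-by lt (solve (a ∷ b ∷ []) (con 1ℤ :- (x₀ :- x₁)) (x₁ :+ con 1ℤ :- x₀))
        lower : ∀ a b → b ≤ a → - (a - b) < 1#
        lower a b le = <-by (le ≤+ 0<1)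
            (solve (a ∷ b ∷ []) (con 1ℤ :- (:- (x₀ :- x₁))) (x₀ :+ con 1ℤ :- (x₁ :+ con 0ℤ)))

-- Holes of uniform size in an attractor without segments in direction v.

module Porosity
  (em : ∀ {ℓ} → ExcludedMiddle ℓ) (𝓡 : RealNumbers)
  {d J : ℕ} (2≤J : 2 ℕ.≤ J) (f : Fin J → Real.ℝ^_ 𝓡 d → Real.ℝ^_ 𝓡 d) (τ : Fin J → Real.ℝ 𝓡)
  (contracting : ∀ j → Real.IsContractingSimilarity 𝓡 (τ j) (f j))
  (f-rational : ∀ j x → x ∈ Real.Rational 𝓡 → f j x ∈ Real.Rational 𝓡)
  (C : Pred (Real.ℝ^_ 𝓡 d) 0ℓ) (attractor : Real.IsAttractor 𝓡 f C) (two-points : Real.HasTwoPoints 𝓡 C) where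

  open Real 𝓡 hiding (zero)
  open Solver 𝓡
  open OrderedField em 𝓡
  open Classical em
  open Space em 𝓡
  open Fractions em 𝓡
  open IteratedFunctionSystem em 𝓡 2≤J f τ contracting f-rational C attractor two-points

  open Approximation em 𝓡 2≤J f τ contracting f-rational C attractor two-points
  open Packing em 𝓡
  private
    module ≈R where open import Relation.Binary.Reasoning.Setoid setoid public

  dist-self : ∀ (x : ℝ^ d) → dist x x ≈ 0#
  dist-self x = ≋⇒dist≈0 {x = x} {y = x} ≋-refl

  module Holes (v : Vector ℤ d) (v≢0 : ¬ (∀ i → v i ≡ 0ℤ)) (no-segment : ¬ ContainsSegmentParallelTo C v) where

    Outside : ℝ^ d → ℝ → Set
    Outside x ε = ∃[ y ] dist x y < ε × y ∉ C

    private
      V : ℝ^ d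
      V i = fromℤ (v i)
      o : ℝ^ d
      o _ = 0#
      ∣V∣≤ : ∀ i → ∣ V i ∣ ≤ dist V o
      ∣V∣≤ i = ≤-respˡ-≈ (∣∣-cong (lem (V i))) (∣-∣≤dist V o i)
        where
        lem : ∀ a → a - 0# ≈ a
        lem a = solve (a ∷ []) (x₀ :- con 0ℤ) x₀

      shift : ℝ^ d → ℝ → ℝ^ d
      shift x δ i = x i + δ * V i

      shift-⊖ : ∀ x δ i → shift x δ i - x i ≈ δ * V i
      shift-⊖ x δ i = lem (x i) (δ * V i)
        where
        lem : ∀ a b → a + b - a ≈ b
        lem a b = solve (a ∷ b ∷ []) (x₀ :+ x₁ :- x₀) x₁

      shift-≉ : ∀ x {δ} → 0# < δ → ¬ x ≋ shift x δ
      shift-≉ x {δ} 0<δ x≋y = v≢0 λ i → fromℤ-injective {v i} {0ℤ} (*-cancelʳ-≈ 0<δ (begin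
        V i * δ                        ≈⟨ *-comm (V i) δ ⟩
        δ * V i                        ≈⟨ shift-⊖ x δ i ⟨
        shift x δ i - x i              ≈⟨ +-congˡ (-‿cong (x≋y i)) ⟩
        shift x δ i - shift x δ i      ≈⟨ -‿inverseʳ (shift x δ i) ⟩
        0#                             ≈⟨ zeroˡ δ ⟨
        0# * δ                         ∎))
        where open ≈R

      segment-near : ∀ x δ p → 0# < δ → p ∈ Segment x (shift x δ) → ∀ i → ∣ x i - p i ∣ ≤ δ * dist V o
      segment-near x δ p 0<δ (s , 0≤s , s≤1 , p≋) i = ≤-respˡ-≈ (sym abs) (*-mono-≤ 0≤sδ sδ≤δ (0≤∣x∣ (V i)) (∣V∣≤ i))
        where
        0≤sδ : 0# ≤ s * δ
        0≤sδ = 0≤x*y 0≤s (<⇒≤ 0<δ)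
        sδ≤δ : s * δ ≤ δ
        sδ≤δ = ≤-respˡ-≈ (*-comm δ s) (≤-respʳ-≈ (*-identityʳ δ) (<⇒≤ 0<δ *≤ s≤1))
        lem : ∀ x s d V → x - (x + s * (x + d * V - x)) ≈ - (s * d * V)
        lem x s d V = solve (x ∷ s ∷ d ∷ V ∷ []) (x₀ :- (x₀ :+ x₁ :* (x₀ :+ x₂ :* x₃ :- x₀))) (:- (x₁ :* x₂ :* x₃))
        abs : ∣ x i - p i ∣ ≈ s * δ * ∣ V i ∣
        abs = trans (∣∣-cong (trans (+-congˡ (-‿cong (p≋ i))) (lem (x i) s δ (V i))))
          (trans (∣-x∣≈∣x∣ (s * δ * V i)) (trans (∣x*y∣ (s * δ) (V i)) (*-congʳ (0≤x⇒∣x∣≈x 0≤sδ))))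

      near⇒∈ : ∀ {x ε p} → ¬ Outside x ε → dist x p < ε → p ∈ C
      near⇒∈ {p = p} inside xp<ε = by-contradiction λ p∉C → inside (p , xp<ε , p∉C)

      interior⇒segment : ∀ x ε δ → 0# < ε → 0# < δ → δ * dist V o < ε → ¬ Outside x ε → ContainsSegmentParallelTo C v
      interior⇒segment x ε δ 0<ε 0<δ δV<ε inside = x , shift x δ , shift-≉ x 0<δ , (δ , shift-⊖ x δ) , segment⊆C
        where
        segment⊆C : ∀ {p} → p ∈ Segment x (shift x δ) → p ∈ C
        segment⊆C {p} seg = near⇒∈ {x} {ε} {p} inside
            (dist< x p 0<ε (λ i → ≤-<-trans (segment-near x δ p 0<δ seg i) δV<ε))

      outside-near : ∀ x ε δ → 0# < ε → 0# < δ → δ * dist V o < ε → Outside x ε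
      outside-near x ε δ 0<ε 0<δ δV<ε = by-contradiction λ inside → no-segment
          (interior⇒segment x ε δ 0<ε 0<δ δV<ε inside)

    -- A ball inside C would contain a segment from its centre x to x + δ v. The value δ = ε / (‖v‖
    -- + 1) is short enough.
    empty-interior : ∀ x {ε} → 0# < ε → Outside x ε
    empty-interior x {ε} 0<ε = outside-near x ε (ε ÷ W) 0<ε (0<x÷y 0<ε 0<W)
        (<-respʳ-≈ (x÷y*y≈x ε 0<W) (0<x÷y 0<ε 0<W *< V<W))
      where
      W : ℝ
      W = dist V o + 1#
      V<W : dist V o < W
      V<W = <-by 0<1 (solve ((dist (V) (o)) ∷ []) (x₀ :+ con 1ℤ :- x₀) (con 1ℤ :- con 0ℤ))
      0<W : 0# < W
      0<W = ≤-<-trans (0≤dist V o) V<W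

    Hole : ℝ^ d → ℝ → ℝ → Set
    Hole x η ε = ∃[ y ] dist x y + ε ≤ η × (∀ {c} → c ∈ C → ε ≤ dist y c)

    private
      UniformHoles : ℝ → Set
      UniformHoles η = ∃[ ε ] 0# < ε × (∀ {x} → x ∈ C → Hole x η ε)

      NoHole : ℝ → ℝ → Set
      NoHole η ε = ∃[ x ] x ∈ C × ¬ Hole x η ε

      hole-in-C : ∀ {η ε x} → ¬ NoHole η ε → x ∈ C → Hole x η ε
      hole-in-C {x = x} all x∈C = by-contradiction λ ¬hole → all (x , x∈C , ¬hole)

      no-hole : ∀ {η} → ¬ UniformHoles η → ∀ n → NoHole η (1/1+ n)
      no-hole {η} none n = by-contradiction λ all → none (1/1+ n , 0<1/1+n n , hole-in-C all)

    opaque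
      -- Points of C without holes of size 1 / (n + 1) would cluster at some z. Near z there is a
      -- point outside the closed set C, and the hole around it serves all points close to z.
      holes-in-C : ∀ {η} → 0# < η → UniformHoles η
      holes-in-C {η} 0<η = by-contradiction λ none → absurd (no-hole none)
        where
        absurd : (∀ n → NoHole η (1/1+ n)) → ⊥
        absurd bad = at (cluster (proj₁ ∘ bad) (λ n → proj₁ (proj₂ (bad n)))) (halve 0<η)
          where
          at : (∃[ z ] z ∈ C × IsClusterPoint (proj₁ ∘ bad) z) → (∃[ δ ] 0# < δ × δ + δ ≈ η) → ⊥
          -- A quarter γ of η leaves room for the way from x to z, from z to y and for the radius of
          -- the hole.
          at (z , _ , close) (δ , 0<δ , 2δ≈η) = at′ (halve 0<δ)
            where
            at′ : (∃[ γ ] 0# < γ × γ + γ ≈ δ) → ⊥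
            at′ (γ , 0<γ , 2γ≈δ) = at″ (empty-interior z 0<γ)
              where
              at″ : (∃[ y ] dist z y < γ × y ∉ C) → ⊥
              at″ (y , zy<γ , y∉C) = at‴ (closed y∉C)
                where
                at‴ : (∃[ ε ] 0# < ε × (∀ {c} → c ∈ C → ε ≤ dist y c)) → ⊥
                at‴ (ε , 0<ε , far) = final (1/1+n-small 0<ε) (1/1+n-small 0<γ)
                  where
                  final : (∃[ N ] ∀ n → N ℕ.≤ n → 1/1+ n < ε) → (∃[ N ] ∀ n → N ℕ.≤ n → 1/1+ n < γ) → ⊥
                  final (N , small) (M , small′) = pick (close γ 0<γ (N ℕ.+ M))
                    where
                    pick : (∃[ n ] N ℕ.+ M ℕ.≤ n × dist z (proj₁ (bad n)) < γ) → ⊥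
                    pick (n , N+M≤n , zx<γ) = proj₂ (proj₂ (bad n))
                        (y , le , λ c∈C → ≤-trans (<⇒≤ (small n (ℕP.≤-trans (ℕP.m≤m+n N M) N+M≤n))) (far c∈C))
                      where
                      x : ℝ^ d
                      x = proj₁ (bad n)
                      1/n<γ : 1/1+ n < γ
                      1/n<γ = small′ n (ℕP.≤-trans (ℕP.m≤n+m M N) N+M≤n)
                      4γ≈η : (γ + γ) + (γ + γ) ≈ η
                      4γ≈η = trans (+-cong 2γ≈δ 2γ≈δ) 2δ≈η
                      le : dist x y + 1/1+ n ≤ η
                      le = ≤-respʳ-≈ 4γ≈η (bound (≤-trans (dist-triangle x z y)
                          (≤-reflexive (dist-sym x z) +≤ ≤-refl)) (<⇒≤ zx<γ) (<⇒≤ zy<γ) (<⇒≤ 1/n<γ) (<⇒≤ 0<γ))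
                        where
                        bound : ∀ {a b c e} → a ≤ b + c → b ≤ γ → c ≤ γ → e ≤ γ → 0# ≤ γ → a + e ≤ (γ + γ) + (γ + γ)
                        bound {a} {b} {c} {e} p q r s g = ≤-by (p +≤ q +≤ r +≤ s +≤ g)
                            (solve (γ ∷ a ∷ e ∷ b ∷ c ∷ []) (x₀ :+ x₀ :+ (x₀ :+ x₀) :- (x₁ :+ x₂))
                              (x₃ :+ x₄ :+ x₀ :+ x₀ :+ x₀ :+ x₀ :- (x₁ :+ x₃ :+ x₄ :+ x₂ :+ con 0ℤ)))

      -- Needed for arbitrary x, since the centres pulled back by cylinder maps need not lie in C.
      -- Either x is at least η / 2 away from C and is its own hole, or a hole near some point of C
      -- within η / 2 serves.
      holes : ∀ {η} → 0# < η → ∃[ ε ] 0# < ε × (∀ x → Hole x η ε)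
      holes {η} 0<η = at (halve 0<η)
        where
        at : (∃[ δ ] 0# < δ × δ + δ ≈ η) → ∃[ ε ] 0# < ε × (∀ x → Hole x η ε)
        at (δ , 0<δ , 2δ≈η) = at′ (holes-in-C 0<δ)
          where
          at′ : (∃[ ε ] 0# < ε × (∀ {x} → x ∈ C → Hole x δ ε)) → ∃[ ε ] 0# < ε × (∀ x → Hole x η ε)
          at′ (ε′ , 0<ε′ , hole) = at″ (smaller 0<ε′ 0<δ 0<δ)
            where
            at″ : (∃[ ε ] 0# < ε × ε < ε′ × ε < δ × ε < δ) → ∃[ ε ] 0# < ε × (∀ x → Hole x η ε)
            at″ (ε , 0<ε , ε<ε′ , ε<δ , _) = ε , 0<ε , λ x → case em {P = ∃[ c ] c ∈ C × dist x c ≤ δ} of λ where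
                (yes (c , c∈C , xc≤δ)) → near x c xc≤δ (hole c∈C)
                (no none)              → x , empty x , λ {c} c∈C → ≤-trans (<⇒≤ ε<δ) (≮⇒≥ λ lt → none (c , c∈C , <⇒≤ lt))
              where
              empty : (x : ℝ^ d) → dist x x + ε ≤ η
              empty x = ≤-trans (≤-reflexive (dist-self x) +≤ <⇒≤ ε<δ) (≤-respʳ-≈ 2δ≈η (≤-by (<⇒≤ 0<δ) lem))
                where
                lem : δ + δ - (0# + δ) ≈ δ - 0#
                lem = solve (δ ∷ []) (x₀ :+ x₀ :- (con 0ℤ :+ x₀)) (x₀ :- con 0ℤ)
              near : (x c : ℝ^ d) → dist x c ≤ δ → Hole c δ ε′ → Hole x η ε
              near x c xc≤δ (y , cy+ε′≤δ , far) = y , ≤-respʳ-≈ 2δ≈η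
                  (bound (dist-triangle x c y) xc≤δ cy+ε′≤δ (<⇒≤ ε<ε′)) , λ c∈C → ≤-trans (<⇒≤ ε<ε′) (far c∈C)
                where
                bound : ∀ {a b c} → a ≤ b + c → b ≤ δ → c + ε′ ≤ δ → ε ≤ ε′ → a + ε ≤ δ + δ
                bound {a} {b} {c} p q r s = ≤-by (p +≤ q +≤ r +≤ s)
                    (solve (δ ∷ a ∷ ε ∷ b ∷ c ∷ ε′ ∷ []) (x₀ :+ x₀ :- (x₁ :+ x₂))
                      (x₃ :+ x₄ :+ x₀ :+ x₀ :+ x₅ :- (x₁ :+ x₃ :+ (x₄ :+ x₅) :+ x₂)))

-- Statement (1) under the open set condition.

module OpenSet
  (em : ∀ {ℓ} → ExcludedMiddle ℓ) (𝓡 : RealNumbers)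
  {d J : ℕ} (2≤J : 2 ℕ.≤ J) (f : Fin J → Real.ℝ^_ 𝓡 d → Real.ℝ^_ 𝓡 d) (τ : Fin J → Real.ℝ 𝓡)
  (contracting : ∀ j → Real.IsContractingSimilarity 𝓡 (τ j) (f j))
  (f-rational : ∀ j x → x ∈ Real.Rational 𝓡 → f j x ∈ Real.Rational 𝓡)
  (C : Pred (Real.ℝ^_ 𝓡 d) 0ℓ) (attractor : Real.IsAttractor 𝓡 f C) (two-points : Real.HasTwoPoints 𝓡 C) where

  open Real 𝓡 hiding (zero)
  open Solver 𝓡
  open OrderedField em 𝓡
  open Space em 𝓡
  open Fractions em 𝓡
  open IteratedFunctionSystem em 𝓡 2≤J f τ contracting f-rational C attractor two-points

  open Approximation em 𝓡 2≤J f τ contracting f-rational C attractor two-points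
  open Packing em 𝓡

  Word : Set
  Word = List (Fin J)

  fʷ : Word → ℝ^ d → ℝ^ d
  fʷ []      x = x
  fʷ (j ∷ w) x = f j (fʷ w x)

  τʷ : Word → ℝ
  τʷ []      = 1#
  τʷ (j ∷ w) = τ j * τʷ w

  0<τʷ : ∀ w → 0# < τʷ w
  0<τʷ []      = 0<1
  0<τʷ (j ∷ w) = *-pos (0<τ j) (0<τʷ w)

  similarʷ : ∀ w x y → dist (fʷ w x) (fʷ w y) ≈ τʷ w * dist x y
  similarʷ []      x y = sym (*-identityˡ _)
  similarʷ (j ∷ w) x y = trans (similar j (fʷ w x) (fʷ w y)) (trans (*-congˡ (similarʷ w x y)) (sym (*-assoc _ _ _)))

  fʷ-cong : ∀ w {x y} → x ≋ y → fʷ w x ≋ fʷ w y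
  fʷ-cong []      x≋y = x≋y
  fʷ-cong (j ∷ w) x≋y = F.f-cong j (fʷ-cong w x≋y)

  fʷ-C : ∀ w {x} → x ∈ C → fʷ w x ∈ C
  fʷ-C []      x∈C = x∈C
  fʷ-C (j ∷ w) x∈C = C-image j (fʷ-C w x∈C)

  fʷ-surjective : ∀ w y → ∃[ x ] fʷ w x ≋ y
  fʷ-surjective []      y = y , ≋-refl
  fʷ-surjective (j ∷ w) y = go (F.surjective j y)
    where
    go : (∃[ x ] f j x ≋ y) → ∃[ x ] f j (fʷ w x) ≋ y
    go (x , fx≋y) = go′ (fʷ-surjective w x)
      where
      go′ : (∃[ z ] fʷ w z ≋ x) → ∃[ x ] f j (fʷ w x) ≋ y
      go′ (z , fz≋x) = z , ≋-trans {y = f j x} (F.f-cong j fz≋x) fx≋y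

  -- The words w with s τʷ w ≤ r that are minimal with this property, s being the factor accumulated so far.
  data Cut (r : ℝ) : ℝ → Word → Set where
    stop : ∀ {s} → s ≤ r → Cut r s []
    step : ∀ {s j w} → r < s → Cut r (s * τ j) w → Cut r s (j ∷ w)

  cut-upper : ∀ {r s w} → Cut r s w → s * τʷ w ≤ r
  cut-upper {s = s} (stop s≤r) = ≤-respˡ-≈ (sym (*-identityʳ s)) s≤r
  cut-upper (step r<s c) = ≤-respˡ-≈ (*-assoc _ _ _) (cut-upper c)

  Decomposition : ℝ → ℝ → ℝ^ d → Set
  Decomposition r s x = ∃₂ λ w c → Cut r s w × c ∈ C × fʷ w c ≋ x

  -- The number n bounds the depth: after n letters the accumulated factor is at most s tⁿ ≤ r, and
  -- the word must have ended.
  decompose : ∀ n {r s} → 0# < s → s * t ^ n ≤ r → ∀ {x} → x ∈ C → Decomposition r s x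
  decompose n {r} {s} 0<s le {x} x∈C = [ (λ r<s → deep n le r<s) , (λ s≤r → [] , x , stop s≤r , x∈C , ≋-refl) ]′
      (<-or-≥ r s)
    where
    deep : ∀ n → s * t ^ n ≤ r → r < s → Decomposition r s x
    deep zero    le r<s = ⊥-elim (<⇒≱ r<s (≤-respˡ-≈ (*-identityʳ s) le))
    deep (suc n) le r<s = go (C-preimage x∈C)
      where
      go : (∃[ j ] ∃[ y ] y ∈ C × f j y ≋ x) → Decomposition r s x
      go (j , y , y∈C , fy≋x) = go′ (decompose n (*-pos 0<s (0<τ j)) (≤-trans le′ le) y∈C)
        where
        le′ : s * τ j * t ^ n ≤ s * t ^ suc n
        le′ = ≤-respʳ-≈ (*-assoc _ _ _)
            (*-mono-≤ (<⇒≤ (*-pos 0<s (0<τ j))) (<⇒≤ 0<s *≤ τ≤t j) (0≤x^n n (<⇒≤ 0<t)) ≤-refl)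
        go′ : Decomposition r (s * τ j) y → Decomposition r s x
        go′ (w , c , cut , c∈C , eq) = j ∷ w , c , step r<s cut , c∈C , ≋-trans {y = f j y} (F.f-cong j eq) fy≋x

  μ-bound : ∃[ μ ] 0# < μ × (∀ j → μ ≤ τ j)
  μ-bound = lower-bound τ 0<τ

  μ : ℝ
  μ = proj₁ μ-bound

  0<μ : 0# < μ
  0<μ = proj₁ (proj₂ μ-bound)

  μ≤τ : ∀ j → μ ≤ τ j
  μ≤τ = proj₂ (proj₂ μ-bound)

  -- The factor before the last letter still exceeds r, and one letter costs at most the factor μ.
  -- The assumption on s covers the empty word.
  cut-lower : ∀ {r s w} → 0# < r → μ * r ≤ s → Cut r s w → μ * r ≤ s * τʷ w
  cut-lower {s = s} 0<r le (stop _) = ≤-respʳ-≈ (sym (*-identityʳ s)) le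
  cut-lower {r} {s} 0<r le (step {j = j} r<s c) = ≤-respʳ-≈ (*-assoc _ _ _) (cut-lower 0<r
    (≤-trans (*-mono-≤ (<⇒≤ 0<μ) (μ≤τ j) (<⇒≤ 0<r) (<⇒≤ r<s)) (≤-reflexive (*-comm (τ j) s))) c)

  module Separated (osc : OpenSetCondition f) where

    O : Pred (ℝ^ d) 0ℓ
    O = proj₁ osc

    o : ℝ^ d
    o = proj₁ (proj₁ (proj₂ osc))

    o∈O : o ∈ O
    o∈O = proj₂ (proj₁ (proj₂ osc))

    O-open : IsOpen O
    O-open = proj₁ (proj₂ (proj₂ (proj₂ osc)))

    O-image : ∀ j {x} → x ∈ O → f j x ∈ O
    O-image j {x} x∈O = proj₁ (proj₂ (proj₂ (proj₂ (proj₂ osc)))) j (x , x∈O , ≋-refl)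

    O-disjoint : ∀ i j → i ≢ j → ∀ {x y} → x ∈ O → y ∈ O → ¬ f i x ≋ f j y
    O-disjoint i j i≢j {x} {y} x∈O y∈O eq = proj₂ (proj₂ (proj₂ (proj₂ (proj₂ osc)))) i j i≢j (f j y)
        ((x , x∈O , eq) , (y , y∈O , ≋-refl))

    O-imageʷ : ∀ w {x} → x ∈ O → fʷ w x ∈ O
    O-imageʷ []      x∈O = x∈O
    O-imageʷ (j ∷ w) x∈O = O-image j (O-imageʷ w x∈O)

    -- Neither of two words of one cut extends the other, so they part at some letter; once the
    -- common prefix is cancelled by injectivity, the open set condition separates them there.
    disjoint : ∀ {r s w w′} → Cut r s w → Cut r s w′ → w ≢ w′ → ∀ {x y} → x ∈ O → y ∈ O → ¬ fʷ w x ≋ fʷ w′ y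
    disjoint (stop _)   (stop _)     w≢w′ x∈O y∈O eq = w≢w′ ≡.refl
    disjoint (stop s≤r) (step r<s _) w≢w′ x∈O y∈O eq = <⇒≱ r<s s≤r
    disjoint (step r<s _) (stop s≤r) w≢w′ x∈O y∈O eq = <⇒≱ r<s s≤r
    disjoint {w = j ∷ w} {j′ ∷ w′} (step _ c) (step _ c′) w≢w′ x∈O y∈O eq = case j FinP.≟ j′ of λ where
      (yes ≡.refl) → disjoint c c′ (λ e → w≢w′ (≡.cong (j ∷_) e)) x∈O y∈O (F.f-injective j eq)
      (no  j≢j′)   → O-disjoint j j′ j≢j′ (O-imageʷ w x∈O) (O-imageʷ w′ y∈O) eq

    ball : ∃[ ε ] 0# < ε × (∀ {y} → ‖ o ⊖ y ‖ < ε → y ∈ O)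
    ball = O-open o∈O

    κ : ℝ
    κ = proj₁ ball

    0<κ : 0# < κ
    0<κ = proj₁ (proj₂ ball)

    ball⊆O : ∀ {y} → dist o y < κ → y ∈ O
    ball⊆O {y} lt = proj₂ (proj₂ ball) (≡.subst (_< κ) (dist≡‖⊖‖ o y) lt)

    -- The ball of radius τʷ w κ about fʷ w o lies in fʷ w O.
    separated : ∀ {r w w′} → 0# < r → r ≤ 1# → Cut r 1# w → Cut r 1# w′ → w ≢ w′ → μ * r * κ ≤ dist (fʷ w o) (fʷ w′ o)
    separated {r} {w} {w′} 0<r r≤1 cut cut′ w≢w′ = ≮⇒≥ λ lt → close lt (fʷ-surjective w (fʷ w′ o))
      where
      μ≤1 : μ ≤ 1#
      μ≤1 = ≤-trans (μ≤τ j₀) (<⇒≤ (τ<1 j₀))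
      μr≤τʷ : μ * r ≤ τʷ w
      μr≤τʷ = ≤-respʳ-≈ (*-identityˡ _)
          (cut-lower 0<r (≤-respʳ-≈ (*-identityˡ 1#) (*-mono-≤ (<⇒≤ 0<μ) μ≤1 (<⇒≤ 0<r) r≤1)) cut)
      close : dist (fʷ w o) (fʷ w′ o) < μ * r * κ → (∃[ y ] fʷ w y ≋ fʷ w′ o) → ⊥
      close lt (y , eq) = disjoint cut cut′ w≢w′
          (ball⊆O (*-cancelˡ-< (<⇒≤ (0<τʷ w)) (≤-<-trans (≤-reflexive e) (<-≤-trans lt
          (*-mono-≤ (<⇒≤ (*-pos 0<μ 0<r)) μr≤τʷ (<⇒≤ 0<κ) ≤-refl))))) o∈O eq
        where
        e : τʷ w * dist o y ≈ dist (fʷ w o) (fʷ w′ o)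
        e = trans (sym (similarʷ w o y)) (dist-cong {x = fʷ w o} {x′ = fʷ w o} {y = fʷ w y} {y′ = fʷ w′ o} ≋-refl eq)

    module Porous (v : Vector ℤ d) (v≢0 : ¬ (∀ i → v i ≡ 0ℤ)) (no-segment : ¬ ContainsSegmentParallelTo C v) where

      open Porosity.Holes em 𝓡 2≤J f τ contracting f-rational C attractor two-points v v≢0 no-segment

      -- η k is the radius, relative to r, of a ball that misses k given cylinders of size about r.
      record Radius : Set where
        constructor radius
        field
          η   : ℝ
          0<η : 0# < η
      open Radius

      ε : Radius → ℝ
      ε ρ = proj₁ (holes (0<η ρ))

      0<ε : ∀ ρ → 0# < ε ρ
      0<ε ρ = proj₁ (proj₂ (holes (0<η ρ)))

      hole : ∀ ρ x → Hole x (η ρ) (ε ρ)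
      hole ρ = proj₂ (proj₂ (holes (0<η ρ)))

      -- Each cylinder avoided replaces the relative radius η by the size ε of a hole in a ball of
      -- radius η, times μ because the cylinder may be smaller than r by that factor.
      radii : ℕ → Radius
      radii zero    = radius 1# 0<1
      radii (suc k) = radius (μ * ε (radii k)) (*-pos 0<μ (0<ε (radii k)))

      o-bound : ∃[ M ] 0# ≤ M × (∀ {x} → x ∈ C → dist o x ≤ M)
      o-bound = bounded o

      module Scale (ξ : ℝ^ d) (r : ℝ) (0<r : 0# < r) (r≤1 : r ≤ 1#) where

        HoleAt : ℕ → Set
        HoleAt k = ∃[ y ] dist ξ y + r * η (radii k) ≤ r × (∀ {c} → c ∈ C → r * η (radii k) ≤ dist y c)

        Meets : Word → Set
        Meets w = ∃[ c ] c ∈ C × dist ξ (fʷ w c) < r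

        -- The cylinders found so far and a ball about `y` that misses them. `meets` keeps them all
        -- near ξ, which is what bounds their number.
        record Chain (k : ℕ) : Set where
          field
            words     : Fin k → Word
            distinct  : ∀ {a b} → words a ≡ words b → a ≡ b
            cuts      : ∀ a → Cut r 1# (words a)
            meets     : ∀ a → Meets (words a)
            y         : ℝ^ d
            inside    : dist ξ y + r * η (radii k) ≤ r
            misses    : ∀ a {c} → c ∈ C → r * η (radii k) ≤ dist y (fʷ (words a) c)
        open Chain

        initial : Chain 0
        initial = record
          { words = λ () ; distinct = λ { {()} } ; cuts = λ () ; meets = λ () ; y = ξ
          ; inside = ≤-reflexive (trans (+-cong (≋⇒dist≈0 {x = ξ} {y = ξ} ≋-refl) (*-identityʳ r)) (+-identityˡ r))
          ; misses = λ () }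

        Near : ∀ {k} → Chain k → Set
        Near {k} ch = ∃[ c ] c ∈ C × dist (y ch) c < r * η (radii k)

        no-near⇒hole : ∀ {k} (ch : Chain k) → ¬ Near ch → HoleAt k
        no-near⇒hole ch none = y ch , inside ch , λ {c} c∈C → ≮⇒≥ λ lt → none (c , c∈C , lt)

        deepest : ∃[ n ] 1# * t ^ n ≤ r
        deepest = go (^-small 0<t t<1 0<r)
          where
          go : (∃[ n ] t ^ n < r) → ∃[ n ] 1# * t ^ n ≤ r
          go (n , lt) = n , ≤-respˡ-≈ (sym (*-identityˡ _)) (<⇒≤ lt)

        -- The cylinder of a point of C in the current ball is a new one, as the ball misses the old
        -- ones. Pulling the centre back along its word w turns the cylinder into C, which leaves a
        -- hole near the preimage; pushing the hole forward scales it by `τʷ w`, a number between μ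
        -- r and r.
        extend : ∀ {k} (ch : Chain k) → Near ch → Chain (suc k)
        extend {k} ch (c , c∈C , yc<) = with-word (decompose (proj₁ deepest) 0<1 (proj₂ deepest) c∈C)
          where
          ρ : Radius
          ρ = radii k
          with-word : Decomposition r 1# c → Chain (suc k)
          with-word (w , c′ , cut , c′∈C , fc′≋c) = with-preimage (fʷ-surjective w (y ch))
            where
            θ : ℝ
            θ = τʷ w
            0≤θ : 0# ≤ θ
            0≤θ = <⇒≤ (0<τʷ w)
            θ≤r : θ ≤ r
            θ≤r = ≤-respˡ-≈ (*-identityˡ θ) (cut-upper cut)
            μr≤θ : μ * r ≤ θ
            μr≤θ = ≤-respʳ-≈ (*-identityˡ θ) (cut-lower 0<r (≤-respʳ-≈ (*-identityˡ 1#)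
              (*-mono-≤ (<⇒≤ 0<μ) (≤-trans (μ≤τ j₀) (<⇒≤ (τ<1 j₀))) (<⇒≤ 0<r) r≤1)) cut)
            dist-c : ∀ z → dist z (fʷ w c′) ≈ dist z c
            dist-c z = dist-cong {x = z} {x′ = z} {y = fʷ w c′} {y′ = c} ≋-refl fc′≋c
            w-meets : Meets w
            w-meets = c′ , c′∈C , ≤-<-trans (≤-reflexive (dist-c ξ))
                (≤-<-trans (dist-triangle ξ (y ch) c) (lem yc< (inside ch)))
              where
              lem : ∀ {a b e} → a < e → b + e ≤ r → b + a < r
              lem {a} {b} {e} p q = <-by (p <+ q)
                  (solve (r ∷ b ∷ a ∷ e ∷ []) (x₀ :- (x₁ :+ x₂)) (x₃ :+ x₀ :- (x₂ :+ (x₁ :+ x₃))))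
            w-new : ∀ a → w ≢ words ch a
            w-new a ≡.refl = <⇒≱ yc< (≤-trans (misses ch a c′∈C) (≤-reflexive (dist-c (y ch))))
            words′ : Fin (suc k) → Word
            words′ zero    = w
            words′ (suc a) = words ch a
            distinct′ : ∀ {a b} → words′ a ≡ words′ b → a ≡ b
            distinct′ {zero}  {zero}  eq = ≡.refl
            distinct′ {zero}  {suc b} eq = ⊥-elim (w-new b eq)
            distinct′ {suc a} {zero}  eq = ⊥-elim (w-new a (≡.sym eq))
            distinct′ {suc a} {suc b} eq = ≡.cong suc (distinct ch eq)
            cuts′ : ∀ a → Cut r 1# (words′ a)
            cuts′ zero    = cut
            cuts′ (suc a) = cuts ch a
            meets′ : ∀ a → Meets (words′ a)
            meets′ zero    = w-meets
            meets′ (suc a) = meets ch a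
            with-preimage : (∃[ x ] fʷ w x ≋ y ch) → Chain (suc k)
            with-preimage (x , fx≋y) = with-hole (hole ρ x)
              where
              with-hole : Hole x (η ρ) (ε ρ) → Chain (suc k)
              with-hole (x′ , xx′+ε≤η , far) = record
                { words = words′ ; distinct = distinct′ ; cuts = cuts′ ; meets = meets′
                ; y = y′ ; inside = inside′ ; misses = misses′ }
                where
                E : ℝ
                E = ε ρ
                0≤E : 0# ≤ E
                0≤E = <⇒≤ (0<ε ρ)
                y′ : ℝ^ d
                y′ = fʷ w x′
                yy′ : dist (y ch) y′ ≈ θ * dist x x′
                yy′ = trans (dist-cong {x = y ch} {x′ = fʷ w x} {y = y′} {y′ = y′} (≋-sym {y = y ch} fx≋y)
                    ≋-refl) (similarʷ w x x′)
                rE≤θE : r * (μ * E) ≤ θ * E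
                rE≤θE = ≤-respˡ-≈ (lem μ r E) (*-mono-≤ (<⇒≤ (*-pos 0<μ 0<r)) μr≤θ 0≤E ≤-refl)
                  where
                  lem : ∀ a b c → a * b * c ≈ b * (a * c)
                  lem a b c = solve (a ∷ b ∷ c ∷ []) (x₀ :* x₁ :* x₂) (x₁ :* (x₀ :* x₂))
                moved≤ : dist (y ch) y′ + r * (μ * E) ≤ r * η ρ
                moved≤ = ≤-trans (≤-reflexive yy′ +≤ rE≤θE) (≤-trans (≤-reflexive (sym (distribˡ θ (dist x x′) E)))
                  (*-mono-≤ 0≤θ θ≤r (≤-by (0≤dist x x′ +≤ 0≤E) (lem (dist x x′) E)) xx′+ε≤η))
                  where
                  lem : ∀ a b → a + b - 0# ≈ a + b - (0# + 0#)
                  lem a b = solve (a ∷ b ∷ []) (x₀ :+ x₁ :- con 0ℤ) (x₀ :+ x₁ :- (con 0ℤ :+ con 0ℤ))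
                inside′ : dist ξ y′ + r * (μ * E) ≤ r
                inside′ = from (dist-triangle ξ (y ch) y′) moved≤ (inside ch)
                  where
                  from : ∀ {a b c e g} → a ≤ b + c → c + e ≤ g → b + g ≤ r → a + e ≤ r
                  from {a} {b} {c} {e} {g} p q s = ≤-by (p +≤ q +≤ s)
                      (solve (r ∷ a ∷ e ∷ b ∷ c ∷ g ∷ []) (x₀ :- (x₁ :+ x₂))
                        (x₃ :+ x₄ :+ x₅ :+ x₀ :- (x₁ :+ (x₄ :+ x₂) :+ (x₃ :+ x₅))))
                misses′ : ∀ a {c} → c ∈ C → r * (μ * E) ≤ dist y′ (fʷ (words′ a) c)
                misses′ zero    {c} c∈C = ≤-trans rE≤θE
                    (≤-trans (0≤θ *≤ far c∈C) (≤-reflexive (sym (similarʷ w x′ c))))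
                misses′ (suc a) {c} c∈C = from (misses ch a c∈C) (dist-triangle (y ch) y′ z) moved≤
                  where
                  z : ℝ^ d
                  z = fʷ (words ch a) c
                  from : ∀ {a b c e g} → g ≤ a → a ≤ b + c → b + e ≤ g → e ≤ c
                  from {a} {b} {c} {e} {g} p q s = ≤-by (p +≤ q +≤ s)
                      (solve (c ∷ e ∷ a ∷ b ∷ g ∷ []) (x₀ :- x₁) (x₂ :+ (x₃ :+ x₀) :+ x₄ :- (x₄ :+ x₂ :+ (x₃ :+ x₁))))

        Outcome : ℕ → Set
        Outcome k = (∃[ k′ ] k′ ℕ.< k × HoleAt k′) ⊎ Chain k

        outcome : ∀ k → Outcome k
        outcome zero    = inj₂ initial
        outcome (suc k) = advance (outcome k)
          where
          advance : Outcome k → Outcome (suc k)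
          advance (inj₁ (k′ , k′<k , h)) = inj₁ (k′ , ℕP.m≤n⇒m≤1+n k′<k , h)
          advance (inj₂ ch) = case em {P = Near ch} of λ where
            (yes near) → inj₂ (extend ch near)
            (no  none) → inj₁ (k , ℕP.n<1+n k , no-near⇒hole ch none)

        D : ℝ
        D = proj₁ o-bound

        centres-near : ∀ {w} → Cut r 1# w → Meets w → dist ξ (fʷ w o) ≤ r * (1# + D)
        centres-near {w} cut (c , c∈C , lt) = from (dist-triangle ξ (fʷ w c) (fʷ w o)) (<⇒≤ lt)
            (≤-respˡ-≈ (sym (trans (similarʷ w c o) (*-congˡ (dist-sym c o))))
              (*-mono-≤ (<⇒≤ (0<τʷ w)) (≤-respˡ-≈ (*-identityˡ _) (cut-upper cut)) (0≤dist o c)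
                  (proj₂ (proj₂ o-bound) c∈C)))
          where
          from : ∀ {a b c} → a ≤ b + c → b ≤ r → c ≤ r * D → a ≤ r * (1# + D)
          from {a} {b} {c} p q s = ≤-by (p +≤ q +≤ s)
              (solve (r ∷ D ∷ a ∷ b ∷ c ∷ []) (x₀ :* (con 1ℤ :+ x₁) :- x₂)
                (x₃ :+ x₄ :+ x₀ :+ x₀ :* x₁ :- (x₂ :+ x₃ :+ x₄)))

        -- The points `fʷ w o` lie within r (1 + D) of ξ, where D bounds the distance from o to
        -- points of C, and are at least μ r κ apart. The scale r cancels, so the same L works for
        -- all r and ξ.
        too-long : ∀ L → (1# + D) + (1# + D) < fromℕ L * (μ * κ) → Chain (suc (L ℕ.^ d)) → ⊥
        too-long L L-large ch = clash (packing ξ {r * (1# + D)} {μ * r * κ} L (*-pos (*-pos 0<μ 0<r) 0<κ) wide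
            (λ a → fʷ (words ch a) o) (λ a → centres-near (cuts ch a) (meets ch a)))
          where
          wide : r * (1# + D) + r * (1# + D) < fromℕ L * (μ * r * κ)
          wide = <-by (0<r *< L-large) (solve ((fromℕ L) ∷ μ ∷ r ∷ κ ∷ D ∷ [])
              (x₀ :* (x₁ :* x₂ :* x₃) :- (x₂ :* (con 1ℤ :+ x₄) :+ x₂ :* (con 1ℤ :+ x₄)))
                (x₂ :* (x₀ :* (x₁ :* x₃)) :- x₂ :* (con 1ℤ :+ x₄ :+ (con 1ℤ :+ x₄))))
          clash : (∃₂ λ a b → a ≢ b × dist (fʷ (words ch a) o) (fʷ (words ch b) o) < μ * r * κ) → ⊥
          clash (a , b , a≢b , lt) = <⇒≱ lt (separated 0<r r≤1 (cuts ch a) (cuts ch b) (λ eq → a≢b (distinct ch eq)))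

        hole-found : ∀ L → (1# + D) + (1# + D) < fromℕ L * (μ * κ) → ∃[ k ] k ℕ.< suc (L ℕ.^ d) × HoleAt k
        hole-found L L-large = [ (λ h → h) , (λ ch → ⊥-elim (too-long L L-large ch)) ]′ (outcome (suc (L ℕ.^ d)))

      Porous : ℝ → Set
      Porous e = ∀ ξ {r} → 0# < r → r ≤ 1# → ∃[ y ] dist ξ y + r * e ≤ r × (∀ {c} → c ∈ C → r * e ≤ dist y c)

      opaque
        porous : ∃[ e ] 0# < e × Porous e
        porous = from-L (archimedean (W ÷ (μ * κ)))
          where
          D W : ℝ
          D = proj₁ o-bound
          W = (1# + D) + (1# + D)
          from-L : (∃[ L ] W ÷ (μ * κ) < fromℕ L) → ∃[ e ] 0# < e × Porous e
          -- The step at which a hole appears varies with ξ and r but is one of finitely many, so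
          -- the least of their radii is a uniform constant.
          from-L (L , lt) = from-e (lower-bound {suc (L ℕ.^ d)} (λ k → η (radii (Fin.toℕ k)))
              (λ k → 0<η (radii (Fin.toℕ k))))
            where
            L-large : W < fromℕ L * (μ * κ)
            L-large = <-respˡ-≈ (trans (*-comm _ _) (x÷y*y≈x W (*-pos 0<μ 0<κ)))
                (<-respʳ-≈ (*-comm _ _) (*-pos 0<μ 0<κ *< lt))
            from-e : (∃[ e ] 0# < e × (∀ (k : Fin (suc (L ℕ.^ d))) → e ≤ η (radii (Fin.toℕ k)))) → ∃[ e ] 0# < e
                × Porous e
            from-e (e , 0<e , e≤) = e , 0<e , at
              where
              at : Porous e
              at ξ {r} 0<r r≤1 = shrink (Scale.hole-found ξ r 0<r r≤1 L L-large)
                where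
                shrink : (∃[ k ] k ℕ.< suc (L ℕ.^ d) × Scale.HoleAt ξ r 0<r r≤1 k) → ∃[ y ] dist ξ y + r * e ≤ r
                    × (∀ {c} → c ∈ C → r * e ≤ dist y c)
                shrink (k , k< , y , in-ball , far) = y , ≤-trans (≤-refl +≤ re≤) in-ball , λ c∈C → ≤-trans re≤ (far c∈C)
                  where
                  re≤ : r * e ≤ r * η (radii k)
                  re≤ = <⇒≤ 0<r *≤ ≡.subst (λ k → e ≤ η (radii k)) (FinP.toℕ-fromℕ< k<) (e≤ (Fin.fromℕ< k<))

      -- A ball of radius 1/N contains a vector with denominator N, and the hole at scale K/N has that radius if K = 1/e.
      avoidable : Avoidable
      avoidable = from-e porous
        where
        from-e : (∃[ e ] 0# < e × Porous e) → Avoidable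
        from-e (e , 0<e , por) = K , <⇒≤ 0<K , proj₁ (archimedean K) , λ {ξ} ξ∈C N N₀≤N 1≤N → at ξ N 1≤N
            (<⇒≤ (<-≤-trans (proj₂ (archimedean K)) (fromℕ-mono-≤ N₀≤N)))
          where
          K : ℝ
          K = e ⁻¹
          0<K : 0# < K
          0<K = 0<x⁻¹ 0<e
          Solution : ℝ^ d → ℕ → Set
          Solution ξ N = ∃[ r ] ⟦ r ⟧ ∉ C × den r ℕ.≤ N × dist ξ ⟦ r ⟧ * fromℕ N ≤ K
          at : ∀ ξ N → 1 ℕ.≤ N → K ≤ fromℕ N → Solution ξ N
          at ξ N@(suc _) _ K≤N = with-hole (por ξ (0<x÷y 0<K 0<N) (÷≤ 0<N (≤-respʳ-≈ (sym (*-identityˡ _)) K≤N)))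
            where
            0<N : 0# < fromℕ N
            0<N = 0<fromℕ N
            ρ : ℝ
            ρ = K ÷ fromℕ N
            ρN≈K : ρ * fromℕ N ≈ K
            ρN≈K = x÷y*y≈x K 0<N
            ρeN≈1 : ρ * e * fromℕ N ≈ 1#
            ρeN≈1 = trans (lem ρ e (fromℕ N)) (trans (*-congˡ ρN≈K) (x*x⁻¹≈1 0<e))
              where
              lem : ∀ a b c → a * b * c ≈ b * (a * c)
              lem a b c = solve (a ∷ b ∷ c ∷ []) (x₀ :* x₁ :* x₂) (x₁ :* (x₀ :* x₂))
            with-hole : (∃[ y ] dist ξ y + ρ * e ≤ ρ × (∀ {c} → c ∈ C → ρ * e ≤ dist y c)) → Solution ξ N
            with-hole (y , in-ball , far) = with-fraction (round y N)
              where
              with-fraction : (∃[ r ] den r ≡ N × dist y ⟦ r ⟧ * fromℕ N < 1#) → Solution ξ N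
              with-fraction (r , den≡N , lt) = r , r∉C , ℕP.≤-reflexive den≡N , bound
                where
                r∉C : ⟦ r ⟧ ∉ C
                r∉C r∈C = <⇒≱ lt (≤-respˡ-≈ ρeN≈1
                    (≤-respˡ-≈ (*-comm _ _) (≤-respʳ-≈ (*-comm _ _) (<⇒≤ 0<N *≤ far r∈C))))
                bound : dist ξ ⟦ r ⟧ * fromℕ N ≤ K
                bound = from (<⇒≤ 0<N) (dist-triangle ξ y ⟦ r ⟧) in-ball (<⇒≤ lt) ρN≈K ρeN≈1
                  where
                  from : ∀ {a b c g h M} → 0# ≤ M → a ≤ b + c → b + g ≤ h → c * M ≤ 1# → h * M ≈ K → g * M ≈ 1#
                      → a * M ≤ K
                  from {a} {b} {c} {g} {h} {M} 0≤M p q s e₁ e₂ = ≤-by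
                      (0≤M *≤ p +≤ 0≤M *≤ q +≤ s +≤ ≤-reflexive e₁ +≤ ≤-reflexive (sym e₂))
                        (solve (K ∷ a ∷ M ∷ b ∷ c ∷ h ∷ g ∷ []) (x₀ :- x₁ :* x₂)
                          (x₂ :* (x₃ :+ x₄) :+ x₂ :* x₅ :+ con 1ℤ :+ x₀ :+ x₆ :* x₂ :-
                            (x₂ :* x₁ :+ x₂ :* (x₃ :+ x₆) :+ x₄ :* x₂ :+ x₅ :* x₂ :+ con 1ℤ)))

-- Products of partial sums of the exponential series.

module Exponential (em : ∀ {ℓ} → ExcludedMiddle ℓ) (𝓡 : RealNumbers) where

  open Real 𝓡 hiding (zero)
  open Solver 𝓡
  open OrderedField em 𝓡
  private
    module ≈R where open import Relation.Binary.Reasoning.Setoid setoid public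

  sum : (ℕ → ℝ) → ℕ → ℝ
  sum u zero    = 0#
  sum u (suc n) = sum u n + u n

  sum-cong : ∀ {u v} n → (∀ i → i ℕ.< n → u i ≈ v i) → sum u n ≈ sum v n
  sum-cong zero    eq = refl
  sum-cong (suc n) eq = +-cong (sum-cong n λ i i<n → eq i (ℕP.m≤n⇒m≤1+n i<n)) (eq n (ℕP.n<1+n n))

  sum-+ : ∀ u v n → sum (λ i → u i + v i) n ≈ sum u n + sum v n
  sum-+ u v zero    = sym (+-identityˡ 0#)
  sum-+ u v (suc n) = trans (+-congʳ (sum-+ u v n)) (lem (sum u n) (sum v n) (u n) (v n))
    where
    lem : ∀ a b c d → a + b + (c + d) ≈ a + c + (b + d)
    lem a b c d = solve (a ∷ b ∷ c ∷ d ∷ []) (x₀ :+ x₁ :+ (x₂ :+ x₃)) (x₀ :+ x₂ :+ (x₁ :+ x₃))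

  sum-* : ∀ c u n → sum (λ i → c * u i) n ≈ c * sum u n
  sum-* c u zero    = sym (zeroʳ c)
  sum-* c u (suc n) = trans (+-congʳ (sum-* c u n)) (sym (distribˡ c _ _))

  sum-head : ∀ u n → sum u (suc n) ≈ u 0 + sum (u ∘ suc) n
  sum-head u zero    = +-comm 0# (u 0)
  sum-head u (suc n) = trans (+-congʳ (sum-head u n)) (+-assoc _ _ _)

  ∣sum∣≤ : ∀ {u v} n → (∀ i → i ℕ.< n → ∣ u i ∣ ≤ v i) → ∣ sum u n ∣ ≤ sum v n
  ∣sum∣≤ zero    le = ≤-reflexive (0≤x⇒∣x∣≈x ≤-refl)
  ∣sum∣≤ {u} (suc n) le = ≤-trans (∣x+y∣≤ (sum u n) (u n))
      (∣sum∣≤ n (λ i i<n → le i (ℕP.m≤n⇒m≤1+n i<n)) +≤ le n (ℕP.n<1+n n))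

  term : ℝ → ℕ → ℝ
  term x n = (x ^ n) ÷ fromℕ (n !)

  0<! : ∀ n → 0# < fromℕ (n !)
  0<! n = 0<fromℕ (n !) {{ℕP._!≢0 n}}

  term-zero : ∀ x → term x 0 ≈ 1#
  term-zero x = *-cancelʳ-≈ (0<! 0) (trans (x÷y*y≈x 1# (0<! 0)) lem)
    where
    lem : 1# ≈ 1# * fromℕ 1
    lem = solve [] (con 1ℤ) (con 1ℤ :* (con 1ℤ :+ con 0ℤ))

  term-suc : ∀ x n → fromℕ (suc n) * term x (suc n) ≈ x * term x n
  term-suc x n = *-cancelʳ-≈ (0<! n) (begin
    N * term x (suc n) * F                    ≈⟨ lem N (term x (suc n)) F ⟩
    term x (suc n) * (N * F)                  ≈⟨ *-congˡ (fromℕ-* (suc n) (n !)) ⟨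
    term x (suc n) * fromℕ (suc n !)          ≈⟨ x÷y*y≈x (x ^ suc n) (0<! (suc n)) ⟩
    x * x ^ n                                 ≈⟨ *-congˡ (x÷y*y≈x (x ^ n) (0<! n)) ⟨
    x * (term x n * F)                        ≈⟨ *-assoc _ _ _ ⟨
    x * term x n * F                          ∎)
    where
    open ≈R
    N F : ℝ
    N = fromℕ (suc n)
    F = fromℕ (n !)
    lem : ∀ a b c → a * b * c ≈ b * (a * c)
    lem a b c = solve (a ∷ b ∷ c ∷ []) (x₀ :* x₁ :* x₂) (x₁ :* (x₀ :* x₂))

  expPartialSum≈sum : ∀ x n → expPartialSum x n ≈ sum (term x) n
  expPartialSum≈sum x zero    = refl
  expPartialSum≈sum x (suc n) = +-congʳ (expPartialSum≈sum x n)

  module Convolution (x y : ℝ) where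

    a b : ℕ → ℝ
    a = term x
    b = term y

    conv : ℕ → ℝ
    conv n = sum (λ i → a i * b (n ℕ.∸ i)) (suc n)

    -- The terms for x + y obey the same recursion, so this yields the binomial theorem without
    -- binomial coefficients. The factor n + 1 is split as i + (n + 1 - i), one part for each of the
    -- two series.
    conv-suc : ∀ n → fromℕ (suc n) * conv (suc n) ≈ (x + y) * conv n
    conv-suc n = begin
      fromℕ (suc n) * conv (suc n)                       ≈⟨ sum-* (fromℕ (suc n)) _ (suc (suc n)) ⟨
      sum (λ i → fromℕ (suc n) * w i) (suc (suc n))      ≈⟨ sum-cong (suc (suc n)) split ⟩
      sum (λ i → p i + q i) (suc (suc n))                ≈⟨ sum-+ p q (suc (suc n)) ⟩
      sum p (suc (suc n)) + sum q (suc (suc n))          ≈⟨ +-cong first second ⟩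
      x * conv n + y * conv n                            ≈⟨ distribʳ (conv n) x y ⟨
      (x + y) * conv n                                   ∎
      where
      open ≈R
      w p q : ℕ → ℝ
      w i = a i * b (suc n ℕ.∸ i)
      p i = fromℕ i * w i
      q i = fromℕ (suc n ℕ.∸ i) * w i
      split : ∀ i → i ℕ.< suc (suc n) → fromℕ (suc n) * w i ≈ p i + q i
      split i i< = trans (*-congʳ (trans (reflexive (≡.cong fromℕ (≡.sym (ℕP.m+[n∸m]≡n (ℕP.≤-pred i<)))))
          (fromℕ-+ i (suc n ℕ.∸ i)))) (distribʳ (w i) _ _)
      first : sum p (suc (suc n)) ≈ x * conv n
      first = begin
        sum p (suc (suc n))                                ≈⟨ sum-head p (suc n) ⟩
        0# * w 0 + sum (p ∘ suc) (suc n)                   ≈⟨ trans (+-congʳ (zeroˡ _)) (+-identityˡ _) ⟩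
        sum (p ∘ suc) (suc n)
            ≈⟨ sum-cong (suc n) (λ i _ → trans (sym (*-assoc _ _ _))
              (trans (*-congʳ (term-suc x i)) (*-assoc _ _ _))) ⟩
        sum (λ i → x * (a i * b (n ℕ.∸ i))) (suc n)        ≈⟨ sum-* x _ (suc n) ⟩
        x * conv n                                         ∎
      second : sum q (suc (suc n)) ≈ y * conv n
      second = begin
        sum q (suc n) + q (suc n)
            ≈⟨ +-cong (sum-cong (suc n) shift)
              (trans (*-congʳ (reflexive (≡.cong fromℕ (ℕP.n∸n≡0 (suc n))))) (zeroˡ _)) ⟩
        sum (λ i → y * (a i * b (n ℕ.∸ i))) (suc n) + 0#   ≈⟨ +-identityʳ _ ⟩
        sum (λ i → y * (a i * b (n ℕ.∸ i))) (suc n)        ≈⟨ sum-* y _ (suc n) ⟩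
        y * conv n                                         ∎
        where
        swap : ∀ N A B → N * (A * B) ≈ A * (N * B)
        swap N A B = solve (N ∷ A ∷ B ∷ []) (x₀ :* (x₁ :* x₂)) (x₁ :* (x₀ :* x₂))
        swap′ : ∀ A Y B → A * (Y * B) ≈ Y * (A * B)
        swap′ A Y B = solve (A ∷ Y ∷ B ∷ []) (x₀ :* (x₁ :* x₂)) (x₁ :* (x₀ :* x₂))
        shift : ∀ i → i ℕ.< suc n → q i ≈ y * (a i * b (n ℕ.∸ i))
        shift i i< = begin
          fromℕ (suc n ℕ.∸ i) * (a i * b (suc n ℕ.∸ i))
              ≡⟨ ≡.cong (λ m → fromℕ m * (a i * b m)) (ℕP.+-∸-assoc 1 (ℕP.≤-pred i<)) ⟩
          fromℕ (suc (n ℕ.∸ i)) * (a i * b (suc (n ℕ.∸ i)))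
              ≈⟨ swap (fromℕ (suc (n ℕ.∸ i))) (a i) (b (suc (n ℕ.∸ i))) ⟩
          a i * (fromℕ (suc (n ℕ.∸ i)) * b (suc (n ℕ.∸ i)))       ≈⟨ *-congˡ (term-suc y (n ℕ.∸ i)) ⟩
          a i * (y * b (n ℕ.∸ i))                                 ≈⟨ swap′ (a i) y (b (n ℕ.∸ i)) ⟩
          y * (a i * b (n ℕ.∸ i))                                 ∎

    conv≈term : ∀ n → conv n ≈ term (x + y) n
    conv≈term zero    = begin
      0# + a 0 * b 0       ≈⟨ +-identityˡ _ ⟩
      a 0 * b 0            ≈⟨ *-cong (term-zero x) (term-zero y) ⟩
      1# * 1#              ≈⟨ *-identityˡ 1# ⟩
      1#                   ≈⟨ term-zero (x + y) ⟨
      term (x + y) 0       ∎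
      where open ≈R
    conv≈term (suc n) = *-cancelʳ-≈ (0<fromℕ (suc n))
        (trans (*-comm _ _) (trans (conv-suc n) (trans (*-congˡ (conv≈term n))
      (trans (sym (term-suc (x + y) n)) (*-comm _ _)))))

    B : ℕ → ℝ
    B = sum b

    -- The products aᵢ bⱼ with i + j < n, summed by rows; summation by diagonals gives the partial
    -- sum for x + y.
    triangle : ℕ → ℝ
    triangle n = sum (λ i → a i * B (n ℕ.∸ i)) n

    triangle≈sum : ∀ n → triangle n ≈ sum (term (x + y)) n
    triangle≈sum zero    = refl
    triangle≈sum (suc n) = begin
      sum (λ i → a i * B (suc n ℕ.∸ i)) (suc n)                                        ≈⟨ sum-cong (suc n) split ⟩
      sum (λ i → a i * B (n ℕ.∸ i) + a i * b (n ℕ.∸ i)) (suc n)                        ≈⟨ sum-+ _ _ (suc n) ⟩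
      triangle n + a n * B (n ℕ.∸ n) + conv n
          ≈⟨ +-cong (+-congˡ (trans (*-congˡ (reflexive (≡.cong B (ℕP.n∸n≡0 n)))) (zeroʳ (a n)))) (conv≈term n) ⟩
      triangle n + 0# + term (x + y) n
          ≈⟨ +-congʳ (trans (+-identityʳ _) (triangle≈sum n)) ⟩
      sum (term (x + y)) n + term (x + y) n                                            ∎
      where
      open ≈R
      split : ∀ i → i ℕ.< suc n → a i * B (suc n ℕ.∸ i) ≈ a i * B (n ℕ.∸ i) + a i * b (n ℕ.∸ i)
      split i i< = trans (*-congˡ (reflexive (≡.cong B (ℕP.+-∸-assoc 1 (ℕP.≤-pred i<))))) (distribˡ (a i) _ _)

  opaque
    eventually-decreasing⇒bounded : ∀ (u : ℕ → ℝ) m → (∀ i → m ℕ.≤ i → u (suc i) ≤ u i) → ∃[ K ] 0# ≤ K ×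
        (∀ i → u i ≤ K)
    eventually-decreasing⇒bounded u zero    dec = ∣ u 0 ∣ , 0≤∣x∣ (u 0) , below
      where
      below : ∀ i → u i ≤ ∣ u 0 ∣
      below zero    = x≤∣x∣ (u 0)
      below (suc i) = ≤-trans (dec i z≤n) (below i)
    eventually-decreasing⇒bounded u (suc m) dec = go
        (eventually-decreasing⇒bounded (u ∘ suc) m λ i m≤i → dec (suc i) (s≤s m≤i))
      where
      go : (∃[ K ] 0# ≤ K × (∀ i → u (suc i) ≤ K)) → ∃[ K ] 0# ≤ K × (∀ i → u i ≤ K)
      go (K , 0≤K , ≤K) = K + ∣ u 0 ∣ , ≤-by (0≤K +≤ 0≤∣x∣ (u 0))
          (solve (K ∷ (∣ (u (0)) ∣) ∷ []) (x₀ :+ x₁ :- con 0ℤ) (x₀ :+ x₁ :- (con 0ℤ :+ con 0ℤ))) , below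
        where
        below : ∀ i → u i ≤ K + ∣ u 0 ∣
        below zero    = weaken (x≤∣x∣ (u 0))
          where
          weaken : ∀ {a b} → a ≤ b → a ≤ K + b
          weaken {a} {b} a≤b = ≤-by (0≤K +≤ a≤b)
              (solve (K ∷ b ∷ a ∷ []) (x₀ :+ x₁ :- x₂) (x₀ :+ x₁ :- (con 0ℤ :+ x₂)))
        below (suc i) = ≤-by (≤K i +≤ 0≤∣x∣ (u 0))
            (solve (K ∷ (∣ (u (0)) ∣) ∷ (u (suc i)) ∷ []) (x₀ :+ x₁ :- x₂) (x₀ :+ x₁ :- (x₂ :+ con 0ℤ)))

    -- The ratio ∣z∣ / (i + 1) of consecutive terms is at most 1 as soon as i exceeds ∣z∣.
    term-bounded : ∀ z → ∃[ K ] 0# ≤ K × (∀ i → ∣ term z i ∣ ≤ K)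
    term-bounded z = go (archimedean ∣ z ∣)
      where
      go : (∃[ m ] ∣ z ∣ < fromℕ m) → ∃[ K ] 0# ≤ K × (∀ i → ∣ term z i ∣ ≤ K)
      go (m , z<m) = eventually-decreasing⇒bounded (λ i → ∣ term z i ∣) m λ i m≤i →
          *-cancelˡ-≤ (0<fromℕ (suc i)) (≤-respˡ-≈ (sym (eq i))
              (*-mono-≤ (0≤∣x∣ z) (<⇒≤ (<-≤-trans z<m (fromℕ-mono-≤ (ℕP.m≤n⇒m≤1+n m≤i)))) (0≤∣x∣ (term z i)) ≤-refl))
        where
        eq : ∀ i → fromℕ (suc i) * ∣ term z (suc i) ∣ ≈ ∣ z ∣ * ∣ term z i ∣
        eq i = trans (*-congʳ (sym (0≤x⇒∣x∣≈x (0≤fromℕ (suc i)))))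
            (trans (sym (∣x*y∣ _ _)) (trans (∣∣-cong (term-suc z i)) (∣x*y∣ _ _)))

    -- The terms for x / q are those for x divided by the powers of q.
    term-geometric : ∀ x {q} → 0# < q → ∃[ K ] 0# ≤ K × (∀ i → ∣ term x i ∣ ≤ K * q ^ i)
    term-geometric x {q} 0<q = go (term-bounded (x ÷ q))
      where
      go : (∃[ K ] 0# ≤ K × (∀ i → ∣ term (x ÷ q) i ∣ ≤ K)) → ∃[ K ] 0# ≤ K × (∀ i → ∣ term x i ∣ ≤ K * q ^ i)
      go (K , 0≤K , ≤K) = K , 0≤K , λ i → ≤-respˡ-≈
          (trans (*-congˡ (sym (0≤x⇒∣x∣≈x (0≤x^n i (<⇒≤ 0<q))))) (trans (sym (∣x*y∣ _ _)) (∣∣-cong (eq i))))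
          (≤-respˡ-≈ (*-comm _ _) (≤-respʳ-≈ (*-comm _ _) (0≤x^n i (<⇒≤ 0<q) *≤ ≤K i)))
        where
        eq : ∀ i → term (x ÷ q) i * q ^ i ≈ term x i
        eq i = trans (lem ((x ÷ q) ^ i) (fromℕ (i !) ⁻¹) (q ^ i))
            (*-congʳ (trans (sym (*-^ (x ÷ q) q i)) (^-cong i (x÷y*y≈x x 0<q))))
          where
          lem : ∀ a b c → a * b * c ≈ a * c * b
          lem a b c = solve (a ∷ b ∷ c ∷ []) (x₀ :* x₁ :* x₂) (x₀ :* x₂ :* x₁)

  h : ℝ
  h = fromℕ 2 ⁻¹

  0<h : 0# < h
  0<h = 0<x⁻¹ (0<fromℕ 2)

  h+h≈1 : h + h ≈ 1#
  h+h≈1 = trans (lem h) (x*x⁻¹≈1 (0<fromℕ 2))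
    where
    lem : ∀ h → h + h ≈ fromℕ 2 * h
    lem h = solve (h ∷ []) (x₀ :+ x₀) (con (+ 2) :* x₀)

  h<1 : h < 1#
  h<1 = <-respʳ-≈ h+h≈1 h<h+h
    where
    h<h+h : h < h + h
    h<h+h = <-by 0<h (lem h)
      where
      lem : ∀ h → h + h - h ≈ h - 0#
      lem h = solve (h ∷ []) (x₀ :+ x₀ :- x₀) (x₀ :- con 0ℤ)

  hⁱ+hⁱ : ∀ i → h ^ suc i + h ^ suc i ≈ h ^ i
  hⁱ+hⁱ i = trans (sym (distribʳ (h ^ i) h h)) (trans (*-congʳ h+h≈1) (*-identityˡ _))

  sum-h : ∀ n → sum (h ^_) n ≤ fromℕ 2
  sum-h n = ≤-by (0≤x^n n (<⇒≤ 0<h) +≤ 0≤x^n n (<⇒≤ 0<h)) (trans (+-congˡ (-‿cong (exact n))) (lem (h ^ n)))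
    where
    exact : ∀ n → sum (h ^_) n ≈ fromℕ 2 - (h ^ n + h ^ n)
    exact zero    = base
      where
      base : 0# ≈ fromℕ 2 - (1# + 1#)
      base = solve [] (con 0ℤ) (con (+ 2) :- (con 1ℤ :+ con 1ℤ))
    exact (suc n) = trans (+-congʳ (exact n)) (trans (lem (h ^ n)) (+-congˡ (-‿cong (sym (hⁱ+hⁱ n)))))
      where
      lem : ∀ a → fromℕ 2 - (a + a) + a ≈ fromℕ 2 - a
      lem a = solve (a ∷ []) (con (+ 2) :- (x₀ :+ x₀) :+ x₀) (con (+ 2) :- x₀)
    lem : ∀ a → fromℕ 2 - (fromℕ 2 - (a + a)) ≈ a + a - (0# + 0#)
    lem a = solve (a ∷ []) (con (+ 2) :- (con (+ 2) :- (x₀ :+ x₀))) (x₀ :+ x₀ :- (con 0ℤ :+ con 0ℤ))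

  module Product (x y : ℝ) where

    open Convolution x y

    Bounded : ℝ → Set
    Bounded K = ∀ n → ∣ sum a n * sum b n - sum (term (x + y)) n ∣ ≤ K * h ^ n

    -- The bound is the exact value of the geometric sum of K hʲ over m ≤ j < i + m, which lets the
    -- induction close.
    tail : ∀ {K} → 0# ≤ K → (∀ j → ∣ b j ∣ ≤ K * h ^ j) → ∀ m i → ∣ B (i ℕ.+ m) - B m ∣ ≤ (K + K) *
        (h ^ m - h ^ (i ℕ.+ m))
    tail {K} 0≤K b≤ m zero    = ≤-reflexive
        (trans (∣∣-cong (-‿inverseʳ (B m)))
          (trans (0≤x⇒∣x∣≈x ≤-refl) (sym (trans (*-congˡ (-‿inverseʳ (h ^ m))) (zeroʳ _)))))
    tail {K} 0≤K b≤ m (suc i) = ≤-respˡ-≈ (∣∣-cong (lem (B (i ℕ.+ m)) (B m) (b (i ℕ.+ m))))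
        (≤-trans (∣x+y∣≤ _ _) (≤-trans (tail 0≤K b≤ m i +≤ b≤ (i ℕ.+ m))
      (≤-reflexive (trans (+-congˡ (*-congˡ (sym (hⁱ+hⁱ (i ℕ.+ m)))))
          (trans (+-congʳ (*-congˡ (+-congˡ (-‿cong (sym (hⁱ+hⁱ (i ℕ.+ m)))))))
            (lem′ K (h ^ m) (h ^ suc (i ℕ.+ m))))))))
      where
      lem : ∀ u v w → (u - v) + w ≈ u + w - v
      lem u v w = solve (u ∷ v ∷ w ∷ []) (x₀ :- x₁ :+ x₂) (x₀ :+ x₂ :- x₁)
      lem′ : ∀ K u v → (K + K) * (u - (v + v)) + K * (v + v) ≈ (K + K) * (u - v)
      lem′ K u v = (solve (K ∷ u ∷ v ∷ []) ((x₀ :+ x₀) :* (x₁ :- (x₂ :+ x₂)) :+ x₀ :* (x₂ :+ x₂))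
          ((x₀ :+ x₀) :* (x₁ :- x₂)))

    opaque
      -- Beyond the triangle, the product of the partial sums consists of aᵢ (B n - B (n - i)).
      -- Bounding a at the rate h², twice as fast as b, makes each of these at most a constant times
      -- hⁿ hⁱ, and the spare hⁱ can be summed.
      product-bound : ∃[ K ] 0# ≤ K × Bounded K
      product-bound = go (term-geometric x (*-pos 0<h 0<h)) (term-geometric y 0<h)
        where
        go : (∃[ K ] 0# ≤ K × (∀ i → ∣ a i ∣ ≤ K * (h * h) ^ i)) → (∃[ K ] 0# ≤ K × (∀ i → ∣ b i ∣ ≤ K * h ^ i))
            → ∃[ K ] 0# ≤ K × Bounded K
        go (L , 0≤L , a≤) (K , 0≤K , b≤) = M * fromℕ 2 , 0≤x*y 0≤M (0≤fromℕ 2) , bound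
          where
          M : ℝ
          M = L * (K + K)
          0≤M : 0# ≤ M
          0≤M = 0≤x*y 0≤L (≤-by (0≤K +≤ 0≤K) (solve (K ∷ []) (x₀ :+ x₀ :- con 0ℤ) (x₀ :+ x₀ :- (con 0ℤ :+ con 0ℤ))))
          bound : Bounded (M * fromℕ 2)
          bound n = ≤-respˡ-≈ (∣∣-cong difference)
              (≤-trans (∣sum∣≤ n each) (≤-trans (≤-reflexive (sum-* (M * h ^ n) (h ^_) n))
              (≤-trans (0≤x*y 0≤M (0≤x^n n (<⇒≤ 0<h)) *≤ sum-h n) (≤-reflexive (lem M (h ^ n))))))
            where
            lem : ∀ a b → a * b * fromℕ 2 ≈ a * fromℕ 2 * b
            lem a b = solve (a ∷ b ∷ []) (x₀ :* x₁ :* con (+ 2)) (x₀ :* con (+ 2) :* x₁)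
            r : ℕ → ℝ
            r i = a i * (B n - B (n ℕ.∸ i))
            difference : sum r n ≈ sum a n * sum b n - sum (term (x + y)) n
            difference = begin
              sum r n
                  ≈⟨ sum-cong n (λ i _ → expand (a i) (B n) (B (n ℕ.∸ i))) ⟩
              sum (λ i → B n * a i + - 1# * (a i * B (n ℕ.∸ i))) n          ≈⟨ sum-+ _ _ n ⟩
              sum (λ i → B n * a i) n + sum (λ i → - 1# * (a i * B (n ℕ.∸ i))) n
                  ≈⟨ +-cong (sum-* (B n) a n) (sum-* (- 1#) _ n) ⟩
              B n * sum a n + - 1# * triangle n                             ≈⟨ +-congˡ (*-congˡ (triangle≈sum n)) ⟩
              B n * sum a n + - 1# * sum (term (x + y)) n                   ≈⟨ collect (B n) (sum a n) _ ⟩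
              sum a n * B n - sum (term (x + y)) n                          ∎
              where
              open ≈R
              expand : ∀ a u v → a * (u - v) ≈ u * a + - 1# * (a * v)
              expand a u v = solve (a ∷ u ∷ v ∷ []) (x₀ :* (x₁ :- x₂)) (x₁ :* x₀ :+ (:- con 1ℤ) :* (x₀ :* x₂))
              collect : ∀ u v w → u * v + - 1# * w ≈ v * u - w
              collect u v w = solve (u ∷ v ∷ w ∷ []) (x₀ :* x₁ :+ (:- con 1ℤ) :* x₂) (x₁ :* x₀ :- x₂)
            each : ∀ i → i ℕ.< n → ∣ r i ∣ ≤ M * h ^ n * h ^ i
            each i i<n = ≤-respˡ-≈ (sym (∣x*y∣ _ _))
                (≤-trans (*-mono-≤ (0≤∣x∣ (a i)) (a≤ i) (0≤∣x∣ _) gap) (≤-reflexive (begin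
                L * (h * h) ^ i * ((K + K) * h ^ (n ℕ.∸ i))              ≈⟨ *-congʳ (*-congˡ (*-^ h h i)) ⟩
                L * (h ^ i * h ^ i) * ((K + K) * h ^ (n ℕ.∸ i))
                    ≈⟨ regroup L (h ^ i) (K + K) (h ^ (n ℕ.∸ i)) ⟩
                M * (h ^ i * h ^ (n ℕ.∸ i)) * h ^ i                      ≈⟨ *-congʳ (*-congˡ (^-+ h i (n ℕ.∸ i))) ⟨
                M * h ^ (i ℕ.+ (n ℕ.∸ i)) * h ^ i
                    ≡⟨ ≡.cong (λ m → M * h ^ m * h ^ i) i+[n∸i]≡n ⟩
                M * h ^ n * h ^ i                                        ∎)))
              where
              open ≈R
              i+[n∸i]≡n : i ℕ.+ (n ℕ.∸ i) ≡ n
              i+[n∸i]≡n = ℕP.m+[n∸m]≡n (ℕP.<⇒≤ i<n)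
              regroup : ∀ L u K v → L * (u * u) * (K * v) ≈ L * K * (u * v) * u
              regroup L u K v = (solve (L ∷ u ∷ K ∷ v ∷ []) (x₀ :* (x₁ :* x₁) :* (x₂ :* x₃))
                  (x₀ :* x₂ :* (x₁ :* x₃) :* x₁))
              gap : ∣ B n - B (n ℕ.∸ i) ∣ ≤ (K + K) * h ^ (n ℕ.∸ i)
              gap = ≤-trans (≡.subst (λ m → ∣ B m - B (n ℕ.∸ i) ∣ ≤ (K + K) * (h ^ (n ℕ.∸ i) - h ^ m)) i+[n∸i]≡n
                  (tail 0≤K b≤ (n ℕ.∸ i) i))
                (≤-by (0≤x*y (≤-by (0≤K +≤ 0≤K) (lem′ K)) (0≤x^n n (<⇒≤ 0<h))) (lem″ (K + K) (h ^ (n ℕ.∸ i)) (h ^ n)))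
                where
                lem′ : ∀ K → K + K - 0# ≈ K + K - (0# + 0#)
                lem′ K = solve (K ∷ []) (x₀ :+ x₀ :- con 0ℤ) (x₀ :+ x₀ :- (con 0ℤ :+ con 0ℤ))
                lem″ : ∀ k u v → k * u - k * (u - v) ≈ k * v - 0#
                lem″ k u v = solve (k ∷ u ∷ v ∷ []) (x₀ :* x₁ :- x₀ :* (x₁ :- x₂)) (x₀ :* x₂ :- con 0ℤ)

-- Limits, the functional equation of exp, and the condition on D.

module Logarithm (em : ∀ {ℓ} → ExcludedMiddle ℓ) (𝓡 : RealNumbers) where

  open Real 𝓡 hiding (zero)
  open Solver 𝓡
  open OrderedField em 𝓡
  open Space em 𝓡
  open Packing em 𝓡
  open Exponential em 𝓡
  private
    module ≈R where open import Relation.Binary.Reasoning.Setoid setoid public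

  ∃δ : ∀ {ε W} → 0# < ε → 0# ≤ W → ∃[ δ ] 0# < δ × δ < 1# × δ * W < ε
  ∃δ {ε} {W} 0<ε 0≤W = go (halve 0<1) (lower-bound bounds 0<bounds)
    where
    0<W+1 : 0# < W + 1#
    0<W+1 = <-by (0≤W ≤+ 0<1) (solve (W ∷ []) (x₀ :+ con 1ℤ :- con 0ℤ) (x₀ :+ con 1ℤ :- (con 0ℤ :+ con 0ℤ)))
    bounds : Vector ℝ 2
    bounds zero    = h
    bounds (suc _) = ε ÷ (W + 1#)
    0<bounds : ∀ i → 0# < bounds i
    0<bounds zero    = 0<h
    0<bounds (suc _) = 0<x÷y 0<ε 0<W+1
    go : (∃[ δ ] 0# < δ × δ + δ ≈ 1#) → (∃[ μ ] 0# < μ × (∀ i → μ ≤ bounds i)) → ∃[ δ ] 0# < δ × δ < 1# × δ * W < ε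
    go _ (δ , 0<δ , δ≤) = δ , 0<δ , ≤-<-trans (δ≤ zero) h<1 ,
        <-≤-trans (0<δ *< W<W+1) (≤-trans (*-mono-≤ (<⇒≤ 0<δ) (δ≤ (suc zero)) (<⇒≤ 0<W+1) ≤-refl)
            (≤-reflexive (x÷y*y≈x ε 0<W+1)))
      where
      W<W+1 : W < W + 1#
      W<W+1 = <-by 0<1 (solve (W ∷ []) (x₀ :+ con 1ℤ :- x₀) (con 1ℤ :- con 0ℤ))

  eventually : ∀ {P R : ℕ → Set} → (∃[ N ] ∀ n → N ℕ.≤ n → P n) → (∃[ N ] ∀ n → N ℕ.≤ n → R n) → ∃[ N ] ∀ n → N
      ℕ.≤ n → P n × R n
  eventually (N , p) (M , q) = N ℕ.+ M , λ n le → p n (ℕP.≤-trans (ℕP.m≤m+n N M) le) , q n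
      (ℕP.≤-trans (ℕP.m≤n+m M N) le)

  ⟶-* : ∀ {u v l m} → u ⟶ l → v ⟶ m → (λ n → u n * v n) ⟶ (l * m)
  ⟶-* {u} {v} {l} {m} u→l v→m ε 0<ε = with-δ (∃δ 0<ε 0≤W)
    where
    W : ℝ
    W = 1# + ∣ l ∣ + ∣ m ∣
    0≤W : 0# ≤ W
    0≤W = ≤-by (0≤1 +≤ 0≤∣x∣ l +≤ 0≤∣x∣ m)
        (solve ((∣ l ∣) ∷ (∣ m ∣) ∷ []) (con 1ℤ :+ x₀ :+ x₁ :- con 0ℤ)
          (con 1ℤ :+ x₀ :+ x₁ :- (con 0ℤ :+ con 0ℤ :+ con 0ℤ)))
    with-δ : (∃[ δ ] 0# < δ × δ < 1# × δ * W < ε) → ∃[ N ] ∀ n → N ℕ.≤ n → ∣ u n * v n - l * m ∣ < ε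
    with-δ (δ , 0<δ , δ<1 , δW<ε) = with-N (eventually (u→l δ 0<δ) (v→m δ 0<δ))
      where
      with-N : (∃[ N ] ∀ n → N ℕ.≤ n → ∣ u n - l ∣ < δ × ∣ v n - m ∣ < δ) → ∃[ N ] ∀ n → N ℕ.≤ n → ∣ u n * v n -
          l * m ∣ < ε
      with-N (N , near) = N , λ n le → bound (u n) (v n) (proj₁ (near n le)) (proj₂ (near n le))
        where
        bound : ∀ a b → ∣ a - l ∣ < δ → ∣ b - m ∣ < δ → ∣ a * b - l * m ∣ < ε
        bound a b p q = ≤-<-trans (≤-respˡ-≈ (∣∣-cong (lem a b l m))
            (≤-trans (∣x+y∣≤ _ _) (≤-trans (∣x+y∣≤ _ _ +≤ ≤-refl)
            (≤-trans (≤-reflexive (+-cong (+-cong (∣x*y∣ (a - l) (b - m)) (∣x*y∣ l (b - m))) (∣x*y∣ m (a - l))))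
              (≤-trans (*-mono-≤ (0≤∣x∣ (a - l)) (<⇒≤ p) (0≤∣x∣ (b - m)) (<⇒≤ (<-trans q δ<1)) +≤ 0≤∣x∣ l *≤ <⇒≤
                  q +≤ 0≤∣x∣ m *≤ <⇒≤ p)
                (≤-reflexive (lem′ δ ∣ l ∣ ∣ m ∣))))))) δW<ε
          where
          lem : ∀ a b l m → (a - l) * (b - m) + l * (b - m) + m * (a - l) ≈ a * b - l * m
          lem a b l m = (solve (a ∷ l ∷ b ∷ m ∷ [])
              ((x₀ :- x₁) :* (x₂ :- x₃) :+ x₁ :* (x₂ :- x₃) :+ x₃ :* (x₀ :- x₁)) (x₀ :* x₂ :- x₁ :* x₃))
          lem′ : ∀ d l m → d * 1# + l * d + m * d ≈ d * (1# + l + m)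
          lem′ d l m = solve (d ∷ l ∷ m ∷ []) (x₀ :* con 1ℤ :+ x₁ :* x₀ :+ x₂ :* x₀) (x₀ :* (con 1ℤ :+ x₁ :+ x₂))

  ⟶-close : ∀ {u v l} → u ⟶ l → (∀ ε → 0# < ε → ∃[ N ] ∀ n → N ℕ.≤ n → ∣ u n - v n ∣ < ε) → v ⟶ l
  ⟶-close {u} {v} {l} u→l close ε 0<ε = with-δ (halve 0<ε)
    where
    with-δ : (∃[ δ ] 0# < δ × δ + δ ≈ ε) → ∃[ N ] ∀ n → N ℕ.≤ n → ∣ v n - l ∣ < ε
    with-δ (δ , 0<δ , δ+δ≈ε) = with-N (eventually (u→l δ 0<δ) (close δ 0<δ))
      where
      with-N : (∃[ N ] ∀ n → N ℕ.≤ n → ∣ u n - l ∣ < δ × ∣ u n - v n ∣ < δ) → ∃[ N ] ∀ n → N ℕ.≤ n → ∣ v n - l ∣ < ε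
      with-N (N , near) = N , λ n le → bound (u n) (v n) (proj₁ (near n le)) (proj₂ (near n le))
        where
        bound : ∀ a b → ∣ a - l ∣ < δ → ∣ a - b ∣ < δ → ∣ b - l ∣ < ε
        bound a b p q = ≤-<-trans (≤-respˡ-≈ (∣∣-cong (lem a b l)) (∣x+y∣≤ _ _))
            (<-respʳ-≈ δ+δ≈ε (p +< ≤-<-trans (≤-reflexive (∣-x∣≈∣x∣ _)) q))
          where
          lem : ∀ a b l → (a - l) + (- (a - b)) ≈ b - l
          lem a b l = solve (a ∷ l ∷ b ∷ []) (x₀ :- x₁ :+ (:- (x₀ :- x₂))) (x₂ :- x₁)

  ⟶-unique-≤ : ∀ {u v l m} → u ⟶ l → v ⟶ m → (∃[ N ] ∀ n → N ℕ.≤ n → u n ≤ v n) → l ≤ m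
  ⟶-unique-≤ {u} {v} {l} {m} u→l v→m u≤v = ≤-by (≤-ε⇒≤0 {l - m} λ ε 0<ε → with-δ ε (halve 0<ε))
      (solve (m ∷ l ∷ []) (x₀ :- x₁) (con 0ℤ :- (x₁ :- x₀)))
    where
    with-δ : ∀ ε → (∃[ δ ] 0# < δ × δ + δ ≈ ε) → l - m ≤ ε
    with-δ ε (δ , 0<δ , δ+δ≈ε) = with-N (eventually (eventually (u→l δ 0<δ) (v→m δ 0<δ)) u≤v)
      where
      with-N : (∃[ N ] ∀ n → N ℕ.≤ n → (∣ u n - l ∣ < δ × ∣ v n - m ∣ < δ) × u n ≤ v n) → l - m ≤ ε
      with-N (N , near) = bound (proj₁ (proj₁ at-N)) (proj₂ (proj₁ at-N)) (proj₂ at-N)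
        where
        at-N : (∣ u N - l ∣ < δ × ∣ v N - m ∣ < δ) × u N ≤ v N
        at-N = near N ℕP.≤-refl
        bound : ∀ {a b} → ∣ a - l ∣ < δ → ∣ b - m ∣ < δ → a ≤ b → l - m ≤ ε
        bound {a} {b} p q r = ≤-respʳ-≈ δ+δ≈ε
            (≤-by (≤-trans (-x≤∣x∣ (a - l)) (<⇒≤ p) +≤ ≤-trans (x≤∣x∣ (b - m)) (<⇒≤ q) +≤ r)
              (solve (δ ∷ l ∷ m ∷ b ∷ a ∷ []) (x₀ :+ x₀ :- (x₁ :- x₂))
                (x₀ :+ x₀ :+ x₃ :- ((:- (x₄ :- x₁)) :+ (x₃ :- x₂) :+ x₄))))

  exp-* : ∀ {x y a b} → x IsLogOf a → y IsLogOf b → (x + y) IsLogOf (a * b)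
  exp-* {x} {y} {a} {b} x→a y→b = ⟶-close (⟶-* x→a y→b) close
    where
    open Product x y
    close : ∀ ε → 0# < ε → ∃[ N ] ∀ n → N ℕ.≤ n → ∣ expPartialSum x n * expPartialSum y n - expPartialSum
        (x + y) n ∣ < ε
    close ε 0<ε = go product-bound
      where
      go : (∃[ K ] 0# ≤ K × Bounded K) → ∃[ N ] ∀ n → N ℕ.≤ n → ∣ expPartialSum x n * expPartialSum y n -
          expPartialSum (x + y) n ∣ < ε
      go (K , 0≤K , bounded) = with-δ (∃δ 0<ε 0≤K)
        where
        with-δ : (∃[ δ ] 0# < δ × δ < 1# × δ * K < ε) → ∃[ N ] ∀ n → N ℕ.≤ n → ∣ expPartialSum x n *
            expPartialSum y n - expPartialSum (x + y) n ∣ < ε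
        with-δ (δ , 0<δ , _ , δK<ε) = with-N (^-small 0<h h<1 0<δ)
          where
          with-N : (∃[ N ] h ^ N < δ) → ∃[ N ] ∀ n → N ℕ.≤ n → ∣ expPartialSum x n * expPartialSum y n -
              expPartialSum (x + y) n ∣ < ε
          with-N (N , hN<δ) = N , λ n N≤n → ≤-<-trans
              (≤-trans (≤-reflexive (∣∣-cong
                (+-cong (*-cong (expPartialSum≈sum x n) (expPartialSum≈sum y n))
                  (-‿cong (expPartialSum≈sum (x + y) n)))))
              (≤-trans (bounded n) (0≤K *≤ ≤-trans (^-antitone (<⇒≤ 0<h) (<⇒≤ h<1) N≤n) (<⇒≤ hN<δ))))
                  (<-respˡ-≈ (*-comm δ K) δK<ε)

  0≤term : ∀ {x} → 0# ≤ x → ∀ n → 0# ≤ term x n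
  0≤term 0≤x n = 0≤x*y (0≤x^n n 0≤x) (<⇒≤ (0<x⁻¹ (0<! n)))

  1+x≤exp : ∀ {x} → 0# ≤ x → ∀ n → 1# + x ≤ expPartialSum x (2 ℕ.+ n)
  1+x≤exp {x} 0≤x zero    = ≤-reflexive (begin
      1# + x                               ≈⟨ +-congˡ (*-identityʳ x) ⟨
      1# + x * 1#                          ≈⟨ +-cong (term-zero x) (*-congˡ (term-zero x)) ⟨
      term x 0 + x * term x 0              ≈⟨ +-congˡ (term-suc x 0) ⟨
      term x 0 + fromℕ 1 * term x 1        ≈⟨ lem (term x 0) (term x 1) ⟩
      0# + term x 0 + term x 1             ∎)
    where
    open ≈R
    lem : ∀ a b → a + fromℕ 1 * b ≈ 0# + a + b
    lem a b = solve (a ∷ b ∷ []) (x₀ :+ (con 1ℤ :+ con 0ℤ) :* x₁) (con 0ℤ :+ x₀ :+ x₁)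
  1+x≤exp 0≤x (suc n) = ≤-trans (1+x≤exp 0≤x n) (step (0≤term 0≤x (2 ℕ.+ n)))
    where
    step : ∀ {a b} → 0# ≤ b → a ≤ a + b
    step {a} {b} 0≤b = ≤-by 0≤b (solve (a ∷ b ∷ []) (x₀ :+ x₁ :- x₀) (x₁ :- con 0ℤ))

  1+x≤exp′ : ∀ {x} → 0# ≤ x → ∀ n → 2 ℕ.≤ n → 1# + x ≤ expPartialSum x n
  1+x≤exp′ {x} 0≤x (suc (suc n)) _ = 1+x≤exp 0≤x n
  1+x≤exp′ {x} 0≤x (suc zero)    (s≤s ())

  -- For x ≥ 0 all partial sums from the second on are at least 1, and so is their limit.
  log<0 : ∀ {x a} → a < 1# → x IsLogOf a → x < 0#
  log<0 {x} {a} a<1 x→a with <-or-≥ x 0#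
  ... | inj₁ x<0 = x<0
  ... | inj₂ 0≤x = ⊥-elim (<⇒≱ a<1
      (⟶-unique-≤ {λ _ → 1#} const x→a (2 , λ n 2≤n → ≤-trans 1≤1+x (1+x≤exp′ 0≤x n 2≤n))))
    where
    1≤1+x : 1# ≤ 1# + x
    1≤1+x = ≤-by 0≤x (solve (x ∷ []) (con 1ℤ :+ x₀ :- con 1ℤ) (x₀ :- con 0ℤ))
    const : (λ _ → 1#) ⟶ 1#
    const ε 0<ε = 0 , λ _ _ → ≤-<-trans (≤-reflexive (trans (∣∣-cong (-‿inverseʳ 1#)) (0≤x⇒∣x∣≈x ≤-refl))) 0<ε

  -- e^x e^{-x} = 1, and the partial sums for -x are at least 1 - x > 1.
  log<0⇒<1 : ∀ {x a} → x < 0# → x IsLogOf a → a < 1#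
  log<0⇒<1 {x} {a} x<0 x→a with <-or-≥ a 1#
  ... | inj₁ a<1 = a<1
  ... | inj₂ 1≤a = ⊥-elim (absurd product-bound)
    where
    open Product x (- x)
    w : ℝ
    w = - x
    0<w : 0# < w
    0<w = <-by x<0 (solve (x ∷ []) ((:- x₀) :- con 0ℤ) (con 0ℤ :- x₀))
    e0 : ∀ n → sum (term (x + - x)) (suc n) ≈ 1#
    e0 zero    = trans (+-identityˡ _) (term-zero (x + - x))
    e0 (suc n) = trans (+-cong (e0 n)
        (*-cancelʳ-≈ (0<fromℕ (suc n))
          (trans (*-comm _ _) (trans (term-suc (x + - x) n)
            (trans (*-congʳ (-‿inverseʳ x)) (trans (zeroˡ _) (sym (zeroˡ _)))))))) (+-identityʳ 1#)
    e0′ : ∀ n → 2 ℕ.≤ n → sum (term (x + - x)) n ≈ 1#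
    e0′ (suc n) _ = e0 n
    absurd : (∃[ K ] 0# ≤ K × Bounded K) → ⊥
    absurd (K , 0≤K , bounded) = with-δ (∃δ 0<w (≤-by (0≤1 +≤ 0≤1 +≤ <⇒≤ 0<w) two))
      where
      two : fromℕ 2 + w - 0# ≈ 1# + 1# + w - (0# + 0# + 0#)
      two = (solve (x ∷ []) (con (+ 2) :+ (:- x₀) :- con 0ℤ)
          (con 1ℤ :+ con 1ℤ :+ (:- x₀) :- (con 0ℤ :+ con 0ℤ :+ con 0ℤ)))
      -- The partial sums p for x and q for w = - x will satisfy p ≥ 1 - δ, q ≥ 1 + w and p q ≤ 1 +
      -- δ. Then (1 - δ)(1 + w) ≤ 1 + δ, that is w ≤ δ (2 + w), against this choice of δ.
      with-δ : (∃[ δ ] 0# < δ × δ < 1# × δ * (fromℕ 2 + w) < w) → ⊥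
      with-δ (δ , 0<δ , δ<1 , small) = with-δ′ (∃δ 0<δ 0≤K)
        where
        with-δ′ : (∃[ γ ] 0# < γ × γ < 1# × γ * K < δ) → ⊥
        with-δ′ (γ , 0<γ , _ , γK<δ) = with-N (eventually (eventually (x→a δ 0<δ) (2 , λ n le → le)) (^-eventually))
          where
          ^-eventually : ∃[ N ] ∀ n → N ℕ.≤ n → h ^ n < γ
          ^-eventually = go (^-small 0<h h<1 0<γ)
            where
            go : (∃[ N ] h ^ N < γ) → ∃[ N ] ∀ n → N ℕ.≤ n → h ^ n < γ
            go (N , lt) = N , λ n N≤n → ≤-<-trans (^-antitone (<⇒≤ 0<h) (<⇒≤ h<1) N≤n) lt
          with-N : (∃[ N ] ∀ n → N ℕ.≤ n → (∣ expPartialSum x n - a ∣ < δ × 2 ℕ.≤ n) × h ^ n < γ) → ⊥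
          with-N (n , near) = final (proj₁ (proj₁ at-n)) (1+x≤exp′ (<⇒≤ 0<w) n 2≤n) product
            where
            at-n : (∣ expPartialSum x n - a ∣ < δ × 2 ℕ.≤ n) × h ^ n < γ
            at-n = near n ℕP.≤-refl
            2≤n : 2 ℕ.≤ n
            2≤n = proj₂ (proj₁ at-n)
            product : ∣ expPartialSum x n * expPartialSum w n - 1# ∣ < δ
            product = ≤-<-trans (≤-trans (≤-reflexive
                (∣∣-cong (+-cong (*-cong (expPartialSum≈sum x n) (expPartialSum≈sum w n))
                  (-‿cong (sym (e0′ n 2≤n))))))
              (≤-trans (bounded n) (0≤K *≤ <⇒≤ (proj₂ at-n)))) (<-respˡ-≈ (*-comm γ K) γK<δ)
            final : ∀ {p q} → ∣ p - a ∣ < δ → 1# + w ≤ q → ∣ p * q - 1# ∣ < δ → ⊥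
            final {p} {q} pa q≥ pq = <⇒≱ small (from 1-δ≤p q≥ (≤-trans (x≤∣x∣ (p * q - 1#)) (<⇒≤ pq)))
              where
              1-δ≤p : 1# - δ ≤ p
              1-δ≤p = ≤-by (≤-trans (-x≤∣x∣ (p - a)) (<⇒≤ pa) +≤ 1≤a)
                  (solve (p ∷ δ ∷ a ∷ []) (x₀ :- (con 1ℤ :- x₁)) (x₁ :+ x₂ :- ((:- (x₀ :- x₂)) :+ con 1ℤ)))
              0≤p : 0# ≤ p
              0≤p = ≤-trans (≤-by (<⇒≤ δ<1) (solve (δ ∷ []) (con 1ℤ :- x₀ :- con 0ℤ) (con 1ℤ :- x₀))) 1-δ≤p
              from : 1# - δ ≤ p → 1# + w ≤ q → p * q - 1# ≤ δ → w ≤ δ * (fromℕ 2 + w)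
              from r₁ r₂ r₃ = ≤-by (r₃ +≤ 0≤p *≤ r₂ +≤ (≤-trans (<⇒≤ 0<w) w≤) *≤ r₁)
                  (solve (δ ∷ x ∷ p ∷ q ∷ []) (x₀ :* (con (+ 2) :+ (:- x₁)) :- (:- x₁))
                    (x₀ :+ x₂ :* x₃ :+ (con 1ℤ :+ (:- x₁)) :* x₂ :-
                      (x₂ :* x₃ :- con 1ℤ :+ x₂ :* (con 1ℤ :+ (:- x₁)) :+ (con 1ℤ :+ (:- x₁)) :* (con 1ℤ :- x₀))))
                where
                w≤ : w ≤ 1# + w
                w≤ = ≤-by 0≤1 (solve (x ∷ []) (con 1ℤ :+ (:- x₀) :- (:- x₀)) (con 1ℤ :- con 0ℤ))

  -- As log t is negative, D < 1/2 amounts to 2 log J + log t < 0. By the functional equation this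
  -- sum is a logarithm of J² t, and only its sign matters.
  dimension<½ : ∀ {J t D} → t < 1# → IsDimension J t D → D < ½ → fromℕ J * fromℕ J * t < 1#
  dimension<½ {J} {t} {D} t<1 (j , s , j→J , s→t , D≈) D<½ = log<0⇒<1 j+j+s<0 (exp-* (exp-* j→J j→J) s→t)
    where
    s<0 : s < 0#
    s<0 = log<0 t<1 s→t
    0<-s : 0# < - s
    0<-s = <-by s<0 (solve (s ∷ []) ((:- x₀) :- con 0ℤ) (con 0ℤ :- x₀))
    Ds≈-j : D * s ≈ - j
    Ds≈-j = trans (*-congʳ D≈) (trans (lem (- j) (s ⁻¹) s)
        (trans (*-congˡ (⁻¹-inverseʳ λ s≈0 → <-irrefl s≈0 s<0)) (*-identityʳ _)))
      where
      lem : ∀ a b c → a * b * c ≈ a * (c * b)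
      lem a b c = solve (a ∷ b ∷ c ∷ []) (x₀ :* x₁ :* x₂) (x₀ :* (x₂ :* x₁))
    ½+½≈1 : ½ + ½ ≈ 1#
    ½+½≈1 = trans (lem (fromℕ 2 ⁻¹)) (x*x⁻¹≈1 (0<fromℕ 2))
      where
      lem : ∀ a → 1# * a + 1# * a ≈ fromℕ 2 * a
      lem a = solve (a ∷ []) (con 1ℤ :* x₀ :+ con 1ℤ :* x₀) (con (+ 2) :* x₀)
    j+j+s<0 : j + j + s < 0#
    j+j+s<0 = from ½ ½+½≈1 (0<-s *< D<½) Ds≈-j
      where
      from : ∀ e → e + e ≈ 1# → - s * D < - s * e → D * s ≈ - j → j + j + s < 0#
      from e e+e≈1 lt eq = <-by (lt +< lt <+ ≤-reflexive eq <+ ≤-reflexive eq <+ ≤-reflexive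
          (*-congˡ {s} (sym e+e≈1))) (solve (j ∷ s ∷ e ∷ D ∷ []) (con 0ℤ :- (x₀ :+ x₀ :+ x₁))
            ((:- x₁) :* x₂ :+ (:- x₁) :* x₂ :+ (:- x₀) :+ (:- x₀) :+ x₁ :* (x₂ :+ x₂) :-
              ((:- x₁) :* x₃ :+ (:- x₁) :* x₃ :+ x₃ :* x₁ :+ x₃ :* x₁ :+ x₁ :* con 1ℤ)))

-- Consecutive numerators and their gcds with a denominator.

module NumberTheory where

  open import Data.Nat using (_+_; _*_; _∸_; _^_; _≤_; _<_)
  open ℕD using (_∣_)
  open ℕGCD using (gcd)

  prod : (ℕ → ℕ) → ℕ → ℕ
  prod u zero    = 1
  prod u (suc n) = prod u n * u n

  -- The case in mind is g s = gcd (P + s, q): a common divisor of P + j and P + k divides k - j.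
  HasGaps : (ℕ → ℕ) → Set
  HasGaps g = ∀ {j k e} → j < k → e ∣ g j → e ∣ g k → e ∣ k ∸ j

  -- d divides both b a and b d, hence their gcd.
  ∣-reduce : ∀ b {a d} → d ∣ b * a → d ∣ b * gcd a d
  ∣-reduce b {a} {d} d∣ba = ≡.subst (d ∣_) (≡.sym (ℕGCD.c*gcd[m,n]≡gcd[cm,cn] b a d))
      (ℕGCD.gcd-greatest d∣ba (ℕD.∣n⇒∣m*n b ℕD.∣-refl))

  -- One factor `g j` after the other is cut down to its gcd with d, which divides the gap k - j
  -- because d divides `g k`. X collects the gaps already substituted.
  ∣-prod-gaps : ∀ {g} → HasGaps g → ∀ {k d} → d ∣ g k → ∀ j → j ≤ k → ∀ X → d ∣ X * prod g j → d ∣ X * prod (k ∸_) j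
  ∣-prod-gaps gaps d∣gk zero    j≤k X d∣ = d∣
  ∣-prod-gaps {g} gaps {k} {d} d∣gk (suc j) j<k X d∣ =
      ≡.subst (d ∣_) (rearrange X (k ∸ j) (prod (k ∸_) j)) (∣-prod-gaps gaps d∣gk j (ℕP.<⇒≤ j<k) (X * (k ∸ j))
        (≡.subst (d ∣_) (rearrange′ X (prod g j) (k ∸ j))
            (ℕD.∣-trans (∣-reduce (X * prod g j) (≡.subst (d ∣_) (≡.sym (ℕP.*-assoc X (prod g j) (g j))) d∣))
          (ℕD.*-monoʳ-∣ (X * prod g j) (gaps j<k (ℕGCD.gcd[m,n]∣m (g j) d)
              (ℕD.∣-trans (ℕGCD.gcd[m,n]∣n (g j) d) d∣gk))))))
    where
    rearrange : ∀ X y P → X * y * P ≡ X * (P * y)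
    rearrange = ℕSolver.solve-∀
    rearrange′ : ∀ X P y → X * P * y ≡ X * y * P
    rearrange′ = ℕSolver.solve-∀

  -- The product of j! over j < k, bounding what is lost between a product and an lcm. It depends on
  -- k alone.
  excess : ℕ → ℕ
  excess zero    = 1
  excess (suc k) = prod (k ∸_) k * excess k

  -- The product is gcd times lcm: the lcm divides q times the previous excess, and the gcd a product of gaps.
  prod∣ : ∀ {g q} → HasGaps g → (∀ s → g s ∣ q) → ∀ k → prod g k ∣ q * excess k
  prod∣ {g} {q} gaps g∣q zero    = ℕD.1∣ _
  prod∣ {g} {q} gaps g∣q (suc k) = ≡.subst₂ _∣_ (ℕLCM.gcd*lcm (prod g k) (g k))
      (rearrange (prod (k ∸_) k) q (excess k)) (ℕD.*-pres-∣ gcd∣ lcm∣)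
    where
    rearrange : ∀ P q e → P * (q * e) ≡ q * (P * e)
    rearrange = ℕSolver.solve-∀
    G : ℕ
    G = gcd (prod g k) (g k)
    gcd∣ : G ∣ prod (k ∸_) k
    gcd∣ = ≡.subst (G ∣_) (ℕP.*-identityˡ (prod (k ∸_) k))
        (∣-prod-gaps gaps {k} {G} (ℕGCD.gcd[m,n]∣n (prod g k) (g k)) k ℕP.≤-refl 1
      (≡.subst (G ∣_) (≡.sym (ℕP.*-identityˡ (prod g k))) (ℕGCD.gcd[m,n]∣m (prod g k) (g k))))
    lcm∣ : ℕLCM.lcm (prod g k) (g k) ∣ q * excess k
    lcm∣ = ℕLCM.lcm-least (prod∣ gaps g∣q k) (ℕD.∣m⇒∣m*n (excess k) (g∣q k))

  gcd-gaps : ∀ P q → HasGaps (λ s → gcd (P + s) q)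
  gcd-gaps P q {j} {k} {e} j<k e∣j e∣k = ℕD.∣m+n∣m⇒∣n
      (≡.subst (e ∣_) split (ℕD.∣-trans e∣k (ℕGCD.gcd[m,n]∣m (P + k) q))) (ℕD.∣-trans e∣j (ℕGCD.gcd[m,n]∣m (P + j) q))
    where
    split : P + k ≡ P + j + (k ∸ j)
    split = ≡.trans (≡.cong (λ x → P + x) (≡.sym (ℕP.m+[n∸m]≡n (ℕP.<⇒≤ j<k)))) (≡.sym (ℕP.+-assoc P j (k ∸ j)))

  excess-nonZero : ∀ k → NonZero (excess k)
  excess-nonZero zero    = _
  excess-nonZero (suc k) = ℕP.m*n≢0 (prod (k ∸_) k) (excess k) {{positive k ℕP.≤-refl}} {{excess-nonZero k}}
    where
    positive : ∀ j → j ≤ k → NonZero (prod (k ∸_) j)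
    positive zero    _   = _
    positive (suc j) j<k = ℕP.m*n≢0 (prod (k ∸_) j) (k ∸ j) {{positive j (ℕP.<⇒≤ j<k)}}
        {{ℕ.>-nonZero (ℕP.m<n⇒0<n∸m j<k)}}

  prod-≥ : ∀ (g : ℕ → ℕ) q H k → (∀ s → s < k → q ≤ g s * H) → q ^ k ≤ prod g k * H ^ k
  prod-≥ g q H zero    le = ℕP.≤-refl
  prod-≥ g q H (suc k) le = ≡.subst (q ^ suc k ≤_) (rearrange (g k) H (prod g k) (H ^ k))
      (ℕP.*-mono-≤ (le k ℕP.≤-refl) (prod-≥ g q H k λ s s<k → le s (ℕP.m≤n⇒m≤1+n s<k)))
    where
    rearrange : ∀ g H P h → g * H * (P * h) ≡ P * g * (H * h)
    rearrange = ℕSolver.solve-∀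

  -- If all k gcds were at least q / H, their product would be at least (q / H)ᵏ; but it divides q
  -- times `excess k`, which is smaller.
  small-gcd : ∀ k q P H → 1 ≤ q → q * excess k * H ^ k < q ^ k → ∃[ s ] s < k × gcd (P + s) q * H < q
  small-gcd k q P H 1≤q large with FinP.any? {k} (λ s → gcd (P + Fin.toℕ s) q * H ℕ.<? q)
  ... | yes (s , lt) = Fin.toℕ s , FinP.toℕ<n s , lt
  ... | no none = ⊥-elim (ℕP.<⇒≱ large
      (ℕP.≤-trans (prod-≥ g q H k big)
        (ℕP.*-monoˡ-≤ (H ^ k) (ℕD.∣⇒≤ {{nonZero}} (prod∣ (gcd-gaps P q) (λ s → ℕGCD.gcd[m,n]∣n (P + s) q) k)))))
    where
    g : ℕ → ℕ
    g s = gcd (P + s) q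
    nonZero : NonZero (q * excess k)
    nonZero = ℕP.m*n≢0 q (excess k) {{ℕ.>-nonZero 1≤q}} {{excess-nonZero k}}
    big : ∀ s → s < k → q ≤ g s * H
    big s s<k = ℕP.≮⇒≥ λ lt → none
        (Fin.fromℕ< s<k , ≡.subst (λ s → gcd (P + s) q * H < q) (≡.sym (FinP.toℕ-fromℕ< s<k)) lt)

  -- By the equation b divides (b - b′) a, and it divides (b - b′) b as well, hence (b - b′) gcd (a,
  -- b), which is positive.
  collision : ∀ a b a′ b′ → a * b′ ≡ a′ * b → b′ < b → b ≤ gcd a b * (b ∸ b′)
  collision a b a′ b′ eq b′<b = ≡.subst (b ≤_) (ℕP.*-comm c (gcd a b))
      (ℕD.∣⇒≤ {{nonZero}} (≡.subst (b ∣_) (≡.sym (ℕGCD.c*gcd[m,n]≡gcd[cm,cn] c a b))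
      (ℕGCD.gcd-greatest b∣ca (ℕD.∣n⇒∣m*n c ℕD.∣-refl))))
    where
    c : ℕ
    c = b ∸ b′
    b≢0 : NonZero b
    b≢0 = ℕ.>-nonZero (ℕP.≤-trans (s≤s z≤n) b′<b)
    nonZero : NonZero (c * gcd a b)
    nonZero = ℕP.m*n≢0 c (gcd a b) {{ℕ.>-nonZero (ℕP.m<n⇒0<n∸m b′<b)}}
      {{ℕ.≢-nonZero (ℕGCD.gcd[m,n]≢0 a b (inj₂ (ℕ.≢-nonZero⁻¹ b {{b≢0}})))}}
    ca≡ : c * a ≡ (a ∸ a′) * b
    ca≡ = ≡.trans (ℕP.*-comm c a) (≡.trans (ℕP.*-distribˡ-∸ a b b′)
        (≡.trans (≡.cong (a * b ∸_) eq) (≡.sym (ℕP.*-distribʳ-∸ b a a′))))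
    b∣ca : b ∣ c * a
    b∣ca = ≡.subst (b ∣_) (≡.sym ca≡) (ℕD.∣n⇒∣m*n (a ∸ a′) ℕD.∣-refl)

  ^-distribʳ-* : ∀ e a b → (a * b) ^ e ≡ a ^ e * b ^ e
  ^-distribʳ-* zero    a b = ≡.refl
  ^-distribʳ-* (suc e) a b = ≡.trans (≡.cong (a * b *_) (^-distribʳ-* e a b)) (lem a b (a ^ e) (b ^ e))
    where
    lem : ∀ a b A B → a * b * (A * B) ≡ a * A * (b * B)
    lem = ℕSolver.solve-∀

  -- With k = 2 + e, Hᵏ is at most a constant times q^(k-2), so the left-hand side is at most a
  -- constant times q^(k-1), and the spare factor q beats the constant.
  size-bound : ∀ e c H N q → 1 ≤ q → H ^ (2 + e) ≤ c * N ^ e → N ≤ 2 * q → excess (2 + e) * c * 2 ^ e < q →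
               q * excess (2 + e) * H ^ (2 + e) < q ^ (2 + e)
  size-bound e c H N q 1≤q H≤ N≤2q large = ℕP.≤-<-trans
      (ℕP.*-monoʳ-≤ (q * E) (ℕP.≤-trans H≤
          (ℕP.*-monoʳ-≤ c (ℕP.≤-trans (ℕP.^-monoˡ-≤ e N≤2q) (ℕP.≤-reflexive (^-distribʳ-* e 2 q))))))
      (≡.subst₂ _<_ (rearrange q E c (2 ^ e) (q ^ e)) ≡.refl
          (ℕP.*-monoˡ-< (q * q ^ e) {{ℕP.m*n≢0 q (q ^ e) {{q≢0}} {{ℕP.m^n≢0 q e {{q≢0}}}}}} large))
    where
    E : ℕ
    E = excess (2 + e)
    q≢0 : NonZero q
    q≢0 = ℕ.>-nonZero 1≤q
    rearrange : ∀ q E c t Q → E * c * t * (q * Q) ≡ q * E * (c * (t * Q))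
    rearrange = ℕSolver.solve-∀

  -- Keeps the denominators N, N - 1, ..., N - H at or above N / 2. Otherwise N^(2+e) would be less
  -- than (2 H)^(2+e), which is at most N · N^e for large N.
  2H≤N : ∀ e c H N → 1 ≤ N → H ^ (2 + e) ≤ c * N ^ e → 2 ^ (2 + e) * c ≤ N → 2 * H ≤ N
  2H≤N e c H N 1≤N H≤ large = ℕP.≮⇒≥ λ N<2H → ℕP.<⇒≱ (ℕP.^-monoˡ-< (2 + e) N<2H)
      (ℕP.≤-trans (ℕP.≤-reflexive (^-distribʳ-* (2 + e) 2 H))
      (ℕP.≤-trans (ℕP.*-monoʳ-≤ (2 ^ (2 + e)) H≤)
          (ℕP.≤-trans (ℕP.≤-reflexive (≡.sym (ℕP.*-assoc (2 ^ (2 + e)) c (N ^ e))))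
        (ℕP.*-mono-≤ large (ℕP.m≤n*m (N ^ e) N {{ℕ.>-nonZero 1≤N}})))))

-- Statement (1) for D < 1/2.

module Counting
  (em : ∀ {ℓ} → ExcludedMiddle ℓ) (𝓡 : RealNumbers)
  {d J : ℕ} (2≤J : 2 ℕ.≤ J) (f : Fin J → Real.ℝ^_ 𝓡 d → Real.ℝ^_ 𝓡 d) (τ : Fin J → Real.ℝ 𝓡)
  (contracting : ∀ j → Real.IsContractingSimilarity 𝓡 (τ j) (f j))
  (f-rational : ∀ j x → x ∈ Real.Rational 𝓡 → f j x ∈ Real.Rational 𝓡)
  (C : Pred (Real.ℝ^_ 𝓡 d) 0ℓ) (attractor : Real.IsAttractor 𝓡 f C) (two-points : Real.HasTwoPoints 𝓡 C) where

  open Real 𝓡 hiding (zero)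
  open Solver 𝓡
  open OrderedField em 𝓡
  open Classical em
  open Space em 𝓡
  open Fractions em 𝓡
  open IteratedFunctionSystem em 𝓡 2≤J f τ contracting f-rational C attractor two-points

  open Approximation em 𝓡 2≤J f τ contracting f-rational C attractor two-points
  open NumberTheory
  private
    module ≈R where open import Relation.Binary.Reasoning.Setoid setoid public

  -- The first n letters of an address of x, packed into one number. Cylinders may overlap; the
  -- address is the one that `C-preimage` picks.
  colour : ∀ n {x} → x ∈ C → Fin (J ℕ.^ n)
  colour zero    x∈C = zero
  colour (suc n) x∈C = Fin.combine (proj₁ (C-preimage x∈C)) (colour n (proj₁ (proj₂ (proj₂ (C-preimage x∈C)))))

  same-colour : ∀ n {x y} (x∈C : x ∈ C) (y∈C : y ∈ C) → colour n x∈C ≡ colour n y∈C → dist x y ≤ t ^ n * Δ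
  same-colour zero    x∈C y∈C eq = ≤-respʳ-≈ (sym (*-identityˡ Δ)) (dist≤Δ x∈C y∈C)
  same-colour (suc n) {x} {y} x∈C y∈C eq = go (C-preimage x∈C) (C-preimage y∈C) eq
    where
    go : (p : ∃[ j ] ∃[ x′ ] x′ ∈ C × f j x′ ≋ x) (q : ∃[ j ] ∃[ y′ ] y′ ∈ C × f j y′ ≋ y) →
         Fin.combine (proj₁ p) (colour n (proj₁ (proj₂ (proj₂ p)))) ≡ Fin.combine (proj₁ q)
             (colour n (proj₁ (proj₂ (proj₂ q)))) →
         dist x y ≤ t * t ^ n * Δ
    go (j , x′ , x′∈C , fx′≋x) (j′ , y′ , y′∈C , fy′≋y) eq = with-eq
        (FinP.combine-injective j (colour n x′∈C) j′ (colour n y′∈C) eq)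
      where
      with-eq : j ≡ j′ × colour n x′∈C ≡ colour n y′∈C → dist x y ≤ t * t ^ n * Δ
      with-eq (≡.refl , eq′) = ≤-respˡ-≈ (dist-cong {x = f j x′} {x′ = x} {y = f j y′} {y′ = y} fx′≋x fy′≋y)
          (≤-respˡ-≈ (sym (similar j x′ y′))
        (≤-respʳ-≈ (sym (*-assoc _ _ _))
            (*-mono-≤ (<⇒≤ (0<τ j)) (τ≤t j) (0≤dist x′ y′) (same-colour n x′∈C y′∈C eq′))))

  square-^ : ∀ x m → (x * x) ^ suc m ≈ x ^ (2 ℕ.+ (m ℕ.+ m))
  square-^ x m = trans (*-congˡ (trans (*-^ x x m) (sym (^-+ x m m)))) (*-assoc x x _)

  ^-comm : ∀ x m n → (x ^ m) ^ n ≈ (x ^ n) ^ m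
  ^-comm x m n = trans (sym (^-* x m n)) (trans (reflexive (≡.cong (x ^_) (ℕP.*-comm m n))) (^-* x n m))

  -- The number J^n of cylinders of diameter about N⁻² is at most a constant times N^(e/(2+e)).
  CountBound : ℕ → ℕ → Set
  CountBound e c = ∀ N → 1 ℕ.≤ N → ∃[ n ] t ^ n * Δ * (fromℕ N * fromℕ N) < 1# × (J ℕ.^ n) ℕ.^ (2 ℕ.+ e) ℕ.≤ c
      ℕ.* N ℕ.^ e

  module _ (J²t<1 : fromℕ J * fromℕ J * t < 1#) where

    0<J : 0# < fromℕ J
    0<J = <-≤-trans (0<fromℕ 2) (fromℕ-mono-≤ 2≤J)

    opaque
      -- From (J² t)^(m+1) < t follows A tᵐ ≤ 1, where A = J^(2+2m). Let n be least with tⁿ Δ N² <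
      -- 1. If n is positive, the inequality fails at n - 1, so that A^(n-1) ≤ (Δ N²)ᵐ, and one more
      -- factor A gives the bound with e = 2m; n = 0 is trivial.
      count-bound : ∃₂ CountBound
      count-bound = with-m (^-small (*-pos (*-pos 0<J 0<J) 0<t) J²t<1 0<t)
        where
        with-m : (∃[ m ] (fromℕ J * fromℕ J * t) ^ m < t) → ∃₂ CountBound
        with-m (zero  , 1<t) = ⊥-elim (<⇒≱ 1<t (<⇒≤ t<1))
        with-m (suc m , θ<t) = with-c (archimedean (A * Δ ^ m))
          where
          e : ℕ
          e = m ℕ.+ m
          A : ℝ
          A = fromℕ J ^ (2 ℕ.+ e)
          0<A : 0# < A
          0<A = 0<x^n (2 ℕ.+ e) 0<J
          At^m≤1 : A * t ^ m ≤ 1#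
          At^m≤1 = *-cancelˡ-≤ 0<t (≤-respʳ-≈ (sym (*-identityʳ t)) (≤-respˡ-≈ (begin
              (fromℕ J * fromℕ J * t) ^ suc m           ≈⟨ *-^ (fromℕ J * fromℕ J) t (suc m) ⟩
              (fromℕ J * fromℕ J) ^ suc m * (t * t ^ m) ≈⟨ *-congʳ (square-^ (fromℕ J) m) ⟩
              A * (t * t ^ m)                           ≈⟨ lem A t (t ^ m) ⟩
              t * (A * t ^ m)                           ∎) (<⇒≤ θ<t)))
            where
            open ≈R
            lem : ∀ a b c → a * (b * c) ≈ b * (a * c)
            lem a b c = solve (a ∷ b ∷ c ∷ []) (x₀ :* (x₁ :* x₂)) (x₁ :* (x₀ :* x₂))
          with-c : (∃[ c ] A * Δ ^ m < fromℕ c) → ∃₂ CountBound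
          with-c (c , lt) = e , suc c , bound
            where
            Small : ℕ → ℕ → Set
            Small N n = t ^ n * Δ * (fromℕ N * fromℕ N) < 1#
            Least : ℕ → Set
            Least N = Small N 0 ⊎ (∃[ k ] Small N (suc k) × 1# ≤ t ^ k * Δ * (fromℕ N * fromℕ N))
            least : ∀ N M → Small N M → Least N
            least N zero    small = inj₁ small
            least N (suc M) small = [ least N M , (λ 1≤ → inj₂ (M , small , 1≤)) ]′
                (<-or-≥ (t ^ M * Δ * (fromℕ N * fromℕ N)) 1#)
            1≤c*N^e : ∀ N → 1 ℕ.≤ N → 1 ℕ.≤ suc c ℕ.* N ℕ.^ e
            1≤c*N^e N 1≤N = ℕP.*-mono-≤ {1} {suc c} (s≤s z≤n) (ℕP.m^n>0 N {{ℕ.>-nonZero 1≤N}} e)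
            H^≈ : ∀ n → fromℕ ((J ℕ.^ n) ℕ.^ (2 ℕ.+ e)) ≈ A ^ n
            H^≈ n = trans (fromℕ-^ (J ℕ.^ n) (2 ℕ.+ e))
                (trans (^-cong (2 ℕ.+ e) (fromℕ-^ J n)) (^-comm (fromℕ J) n (2 ℕ.+ e)))
            powers : ∀ k → A ^ k * (t ^ k) ^ m ≤ 1#
            powers k = ≤-respˡ-≈ (trans (*-^ A (t ^ m) k) (*-congˡ (^-comm t m k)))
                (x^n≤1 k (0≤x*y (<⇒≤ 0<A) (0≤x^n m (<⇒≤ 0<t))) At^m≤1)
            A^k≤ : ∀ N k → 1# ≤ t ^ k * Δ * (fromℕ N * fromℕ N) → A ^ k ≤ Δ ^ m * fromℕ (N ℕ.^ e)
            A^k≤ N k 1≤ = ≤-trans (≤-respˡ-≈ (*-identityʳ (A ^ k)) (0≤x^n k (<⇒≤ 0<A) *≤ 1≤x^n m 1≤))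
                (≤-respˡ-≈ (sym eq)
                (≤-respʳ-≈ (*-identityˡ _) (*-mono-≤ (0≤x*y (0≤x^n k (<⇒≤ 0<A)) (0≤x^n m (0≤x^n k (<⇒≤ 0<t))))
                    (powers k)
                  (0≤x*y (0≤x^n m (<⇒≤ 0<Δ)) (0≤fromℕ (N ℕ.^ e))) ≤-refl)))
              where
              open ≈R
              lem : ∀ a b c d → a * (b * c * d) ≈ a * b * (c * d)
              lem a b c d = solve (a ∷ b ∷ c ∷ d ∷ []) (x₀ :* (x₁ :* x₂ :* x₃)) (x₀ :* x₁ :* (x₂ :* x₃))
              N² : (fromℕ N * fromℕ N) ^ m ≈ fromℕ (N ℕ.^ e)
              N² = trans (*-^ (fromℕ N) (fromℕ N) m) (trans (sym (^-+ (fromℕ N) m m)) (sym (fromℕ-^ N e)))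
              eq : A ^ k * (t ^ k * Δ * (fromℕ N * fromℕ N)) ^ m ≈ A ^ k * (t ^ k) ^ m * (Δ ^ m * fromℕ (N ℕ.^ e))
              eq = begin
                A ^ k * (t ^ k * Δ * (fromℕ N * fromℕ N)) ^ m
                    ≈⟨ *-congˡ (trans (*-^ (t ^ k * Δ) _ m) (*-cong (*-^ (t ^ k) Δ m) N²)) ⟩
                A ^ k * ((t ^ k) ^ m * Δ ^ m * fromℕ (N ℕ.^ e))
                    ≈⟨ lem (A ^ k) ((t ^ k) ^ m) (Δ ^ m) (fromℕ (N ℕ.^ e)) ⟩
                A ^ k * (t ^ k) ^ m * (Δ ^ m * fromℕ (N ℕ.^ e))           ∎
            bound : CountBound e (suc c)
            bound N 1≤N = with-small (t^nΔ-small 0<t t<1 (0<x⁻¹ 0<N²))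
              where
              0<N : 0# < fromℕ N
              0<N = 0<den′ N 1≤N
              0<N² : 0# < fromℕ N * fromℕ N
              0<N² = *-pos 0<N 0<N
              Goal : Set
              Goal = ∃[ n ] t ^ n * Δ * (fromℕ N * fromℕ N) < 1# × (J ℕ.^ n) ℕ.^ (2 ℕ.+ e) ℕ.≤ suc c ℕ.* N ℕ.^ e
              with-least : Least N → Goal
              with-least (inj₁ small) = 0 , small , ≡.subst (ℕ._≤ suc c ℕ.* N ℕ.^ e)
                  (≡.sym (ℕP.^-zeroˡ (2 ℕ.+ e))) (1≤c*N^e N 1≤N)
              with-least (inj₂ (k , small , 1≤)) = suc k , small , fromℕ-cancel-≤
                  (≤-respˡ-≈ (sym (H^≈ (suc k))) (≤-respʳ-≈ (sym (fromℕ-* (suc c) (N ℕ.^ e)))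
                (≤-trans (<⇒≤ 0<A *≤ A^k≤ N k 1≤)
                    (≤-respˡ-≈ (*-assoc _ _ _) (*-mono-≤ (0≤x*y (<⇒≤ 0<A) (0≤x^n m (<⇒≤ 0<Δ)))
                  (<⇒≤ (<-≤-trans lt (fromℕ-mono-≤ (ℕP.n≤1+n c)))) (0≤fromℕ (N ℕ.^ e)) ≤-refl)))))
              with-small : (∃[ M ] ∀ n → M ℕ.≤ n → t ^ n * Δ < (fromℕ N * fromℕ N) ⁻¹) → Goal
              with-small (M , small) = with-least
                  (least N M (<-respʳ-≈ (x*x⁻¹≈1 0<N²) (<-respˡ-≈ (*-comm _ _) (0<N² *< small M ℕP.≤-refl))))

    i₀ : Fin d
    i₀ = dimension>0

    opaque
      shift : ∃[ B ] (∀ {x} → x ∈ C → 0# ≤ x i₀ + fromℕ B)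
      shift = with-M (bounded (λ _ → 0#))
        where
        with-M : (∃[ M ] 0# ≤ M × (∀ {x} → x ∈ C → dist (λ _ → 0#) x ≤ M)) → ∃[ B ]
            (∀ {x} → x ∈ C → 0# ≤ x i₀ + fromℕ B)
        with-M (M , _ , ≤M) = with-B (archimedean M)
          where
          with-B : (∃[ B ] M < fromℕ B) → ∃[ B ] (∀ {x} → x ∈ C → 0# ≤ x i₀ + fromℕ B)
          with-B (B , M<B) = B , λ {x} x∈C → from (≤-trans (x≤∣x∣ (0# - x i₀)) (≤-trans (∣-∣≤dist (λ _ → 0#) x i₀) (≤M x∈C))) (<⇒≤ M<B)
            where
            from : ∀ {a} → 0# - a ≤ M → M ≤ fromℕ B → 0# ≤ a + fromℕ B
            from {a} p q = ≤-by (p +≤ q) (solve (a ∷ (fromℕ B) ∷ M ∷ []) (x₀ :+ x₁ :- con 0ℤ)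
                (x₂ :+ x₁ :- (con 0ℤ :- x₀ :+ x₂)))

    B : ℕ
    B = proj₁ shift

    -- Adding B to coordinate i₀ makes the numerators there natural, without changing gcds with the denominator.
    record Approximant (ξ : ℝ^ d) (K H q : ℕ) : Set where
      field
        P      : ℕ
        coprimish : ℕGCD.gcd P q ℕ.* H ℕ.< q
        r      : Fraction d
        den≡q  : den r ≡ q
        at-i₀  : ⟦ r ⟧ i₀ * fromℕ q ≈ fromℕ P - fromℕ q * fromℕ B
        close  : dist ξ ⟦ r ⟧ * fromℕ q ≤ fromℕ K

    choose : ∀ {i l : Fin d} → Dec (i ≡ l) → ℤ → ℤ → ℤ
    choose (yes _) X Y = X
    choose (no _)  X Y = Y

    choose-elim : ∀ {i l : Fin d} (D : Dec (i ≡ l)) {X Y} (Q : ℤ → Set) → (i ≡ l → Q X) → Q Y → Q (choose D X Y)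
    choose-elim (yes p) Q qX qY = qX p
    choose-elim (no _)  Q qX qY = qY

    opaque
      -- In coordinate i₀ the shifted numerator is one of k + 1 consecutive numbers from the integer
      -- part of q (ξ + B) on, among which one has a small gcd with q; this freedom costs only the
      -- constant `suc k`. The other coordinates are rounded down.
      approximant : ∀ {ξ} → ξ ∈ C → ∀ k H q → 1 ℕ.≤ q → q ℕ.* excess (suc k) ℕ.* H ℕ.^ suc k ℕ.< q ℕ.^ suc k →
          Approximant ξ (suc k) H q
      approximant {ξ} ξ∈C k H q@(suc _) 1≤q large = with-floor
          (floorℕ (fromℕ q * a) (0≤x*y (0≤fromℕ q) (proj₂ shift ξ∈C)))
        where
        a : ℝ
        a = ξ i₀ + fromℕ B
        with-floor : (∃[ F ] fromℕ F ≤ fromℕ q * a × fromℕ q * a < fromℕ (suc F)) → Approximant ξ (suc k) H q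
        with-floor (F , F≤ , <F+1) = with-s (small-gcd (suc k) q F H 1≤q large)
          where
          with-s : (∃[ s ] s ℕ.< suc k × ℕGCD.gcd (F ℕ.+ s) q ℕ.* H ℕ.< q) → Approximant ξ (suc k) H q
          with-s (s , s<k , small) = record
              { P = P ; coprimish = small ; r = r ; den≡q = ≡.refl ; at-i₀ = at-i₀ ; close = close }
            where
            0<q : 0# < fromℕ q
            0<q = 0<fromℕ q
            P : ℕ
            P = F ℕ.+ s
            X : ℤ
            X = + P ℤ.+ ℤ.- (+ (q ℕ.* B))
            X≈ : fromℤ X ≈ fromℕ P - fromℕ q * fromℕ B
            X≈ = trans (fromℤ-+ (+ P) (ℤ.- (+ (q ℕ.* B))))
                (+-congˡ (trans (fromℤ-neg (+ (q ℕ.* B))) (-‿cong (fromℕ-* q B))))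
            Y : Fin d → ℤ
            Y l = proj₁ (floor (fromℕ q * ξ l))
            r : Fraction d
            r = (λ l → choose (i₀ FinP.≟ l) X (Y l)) / q
            at-i₀ : ⟦ r ⟧ i₀ * fromℕ q ≈ fromℕ P - fromℕ q * fromℕ B
            at-i₀ = trans (⟦⟧*den r i₀) (trans (diagonal (i₀ FinP.≟ i₀)) X≈)
              where
              diagonal : (D : Dec (i₀ ≡ i₀)) → fromℤ (choose D X (Y i₀)) ≈ fromℤ X
              diagonal (yes _) = refl
              diagonal (no ¬p) = ⊥-elim (¬p ≡.refl)
            s≤k : fromℕ s ≤ fromℕ k
            s≤k = fromℕ-mono-≤ (ℕP.≤-pred s<k)
            near-X : ∣ fromℕ q * ξ i₀ - fromℤ X ∣ ≤ fromℕ (suc k)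
            near-X = ≤-respˡ-≈ (∣∣-cong (+-congˡ (-‿cong (sym (trans X≈ (+-congʳ (fromℕ-+ F s))))))) (∣x∣≤
                (from₁ (fromℕ q) (ξ i₀) (fromℕ B) (fromℕ F) (fromℕ s) (fromℕ k) <F+1 (0≤fromℕ s) (0≤fromℕ k))
                (from₂ (fromℕ q) (ξ i₀) (fromℕ B) (fromℕ F) (fromℕ s) (fromℕ k) F≤ s≤k))
              where
              from₁ : ∀ q x B F s k → q * (x + B) < 1# + F → 0# ≤ s → 0# ≤ k → q * x - (F + s - q * B) ≤ 1# + k
              from₁ q x B F s k p u v = ≤-by (<⇒≤ p +≤ u +≤ v)
                  (solve (k ∷ q ∷ x ∷ F ∷ s ∷ B ∷ []) (con 1ℤ :+ x₀ :- (x₁ :* x₂ :- (x₃ :+ x₄ :- x₁ :* x₅)))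
                    (con 1ℤ :+ x₃ :+ x₄ :+ x₀ :- (x₁ :* (x₂ :+ x₅) :+ con 0ℤ :+ con 0ℤ)))
              from₂ : ∀ q x B F s k → F ≤ q * (x + B) → s ≤ k → - (q * x - (F + s - q * B)) ≤ 1# + k
              from₂ q x B F s k p u = ≤-by (p +≤ u +≤ 0≤1)
                  (solve (k ∷ q ∷ x ∷ F ∷ s ∷ B ∷ [])
                    (con 1ℤ :+ x₀ :- (:- (x₁ :* x₂ :- (x₃ :+ x₄ :- x₁ :* x₅))))
                      (x₁ :* (x₂ :+ x₅) :+ x₀ :+ con 1ℤ :- (x₃ :+ x₄ :+ con 0ℤ)))
            near-Y : ∀ l → ∣ fromℕ q * ξ l - fromℤ (Y l) ∣ ≤ fromℕ (suc k)
            near-Y l = ∣x∣≤ (from₁ (fromℕ q * ξ l) (fromℤ (Y l)) (fromℕ k)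
                (proj₂ (proj₂ (floor (fromℕ q * ξ l)))) (0≤fromℕ k))
                            (from₂ (fromℕ q * ξ l) (fromℤ (Y l)) (fromℕ k)
                                (proj₁ (proj₂ (floor (fromℕ q * ξ l)))) (0≤fromℕ k))
              where
              from₁ : ∀ a y k → a < y + 1# → 0# ≤ k → a - y ≤ 1# + k
              from₁ a y k p u = ≤-by (<⇒≤ p +≤ u)
                  (solve (k ∷ a ∷ y ∷ []) (con 1ℤ :+ x₀ :- (x₁ :- x₂)) (x₂ :+ con 1ℤ :+ x₀ :- (x₁ :+ con 0ℤ)))
              from₂ : ∀ a y k → y ≤ a → 0# ≤ k → - (a - y) ≤ 1# + k
              from₂ a y k p u = ≤-by (p +≤ u +≤ 0≤1)
                  (solve (k ∷ a ∷ y ∷ []) (con 1ℤ :+ x₀ :- (:- (x₁ :- x₂)))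
                    (x₁ :+ x₀ :+ con 1ℤ :- (x₂ :+ con 0ℤ :+ con 0ℤ)))
            near : ∀ l → ∣ fromℕ q * ξ l - fromℤ (num r l) ∣ ≤ fromℕ (suc k)
            near l = choose-elim (i₀ FinP.≟ l) (λ z → ∣ fromℕ q * ξ l - fromℤ z ∣ ≤ fromℕ (suc k))
                (λ eq → ≡.subst (λ l → ∣ fromℕ q * ξ l - fromℤ X ∣ ≤ fromℕ (suc k)) eq near-X) (near-Y l)
            close : dist ξ ⟦ r ⟧ * fromℕ q ≤ fromℕ (suc k)
            close = ≤-respˡ-≈ (*-comm _ _)
                (≤-respʳ-≈ (trans (*-comm _ _) (x÷y*y≈x (fromℕ (suc k)) 0<q))
                  (<⇒≤ 0<q *≤ dist≤ ξ ⟦ r ⟧ (<⇒≤ (0<x÷y (0<fromℕ (suc k)) 0<q)) λ l →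
                ≤÷ 0<q (≤-respˡ-≈ (trans (∣∣-cong (eq l)) (trans (∣x*y∣ _ _) (*-congˡ (0≤x⇒∣x∣≈x (<⇒≤ 0<q)))))
                    (near l))))
              where
              lem : ∀ a b c → c * a - b * c ≈ (a - b) * c
              lem a b c = solve (c ∷ a ∷ b ∷ []) (x₀ :* x₁ :- x₂ :* x₀) ((x₁ :- x₂) :* x₀)
              eq : ∀ l → fromℕ q * ξ l - fromℤ (num r l) ≈ (ξ l - ⟦ r ⟧ l) * fromℕ q
              eq l = trans (+-congˡ (-‿cong (sym (⟦⟧*den r l)))) (lem (ξ l) (⟦ r ⟧ l) (fromℕ q))

    -- P / q is the coordinate i₀ of the fraction plus B, and B is common to both.
    same-ratio : ∀ {ξ K H q q′} (a : Approximant ξ K H q) (b : Approximant ξ K H q′) → ⟦ Approximant.r a ⟧ ≋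
        ⟦ Approximant.r b ⟧ →
                 Approximant.P a ℕ.* q′ ≡ Approximant.P b ℕ.* q
    same-ratio {q = q} {q′} a b a≋b = ℤP.+-injective (fromℤ-injective {+ (A.P ℕ.* q′)} {+ (A′.P ℕ.* q)} (begin
        fromℕ (A.P ℕ.* q′)                                  ≈⟨ fromℕ-* A.P q′ ⟩
        fromℕ A.P * Q′                                      ≈⟨ lem (fromℕ A.P) Q (fromℕ B) Q′ ⟩
        (fromℕ A.P - Q * fromℕ B) * Q′ + Q * fromℕ B * Q′   ≈⟨ +-congʳ (*-congʳ A.at-i₀) ⟨
        ⟦ A.r ⟧ i₀ * Q * Q′ + Q * fromℕ B * Q′              ≈⟨ +-congʳ (*-congʳ (*-congʳ (a≋b i₀))) ⟩
        ⟦ A′.r ⟧ i₀ * Q * Q′ + Q * fromℕ B * Q′             ≈⟨ lem′ (⟦ A′.r ⟧ i₀) Q Q′ (fromℕ B) ⟩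
        ⟦ A′.r ⟧ i₀ * Q′ * Q + Q′ * fromℕ B * Q             ≈⟨ +-congʳ (*-congʳ A′.at-i₀) ⟩
        (fromℕ A′.P - Q′ * fromℕ B) * Q + Q′ * fromℕ B * Q  ≈⟨ lem (fromℕ A′.P) Q′ (fromℕ B) Q ⟨
        fromℕ A′.P * Q                                      ≈⟨ fromℕ-* A′.P q ⟨
        fromℕ (A′.P ℕ.* q)                                  ∎))
      where
      open ≈R
      module A = Approximant a
      module A′ = Approximant b
      Q Q′ : ℝ
      Q = fromℕ q
      Q′ = fromℕ q′
      lem : ∀ p q b q′ → p * q′ ≈ (p - q * b) * q′ + q * b * q′
      lem p q b q′ = solve (p ∷ q′ ∷ q ∷ b ∷ []) (x₀ :* x₁) ((x₀ :- x₂ :* x₃) :* x₁ :+ x₂ :* x₃ :* x₁)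
      lem′ : ∀ r q q′ b → r * q * q′ + q * b * q′ ≈ r * q′ * q + q′ * b * q
      lem′ r q q′ b = (solve (r ∷ q ∷ q′ ∷ b ∷ []) (x₀ :* x₁ :* x₂ :+ x₁ :* x₃ :* x₂)
          (x₀ :* x₂ :* x₁ :+ x₂ :* x₃ :* x₁))

    module Collision (e c : ℕ) (count : CountBound e c) where

      K : ℕ
      K = 2 ℕ.+ e

      -- The first summand of N₀ ensures 2 H ≤ N; the second makes all denominators used, being at
      -- least N / 2, exceed the threshold that `size-bound` asks for.
      threshold N₀ : ℕ
      threshold = excess K ℕ.* c ℕ.* 2 ℕ.^ e
      N₀ = 2 ℕ.^ K ℕ.* c ℕ.+ 2 ℕ.* suc threshold

      Solution : ℝ^ d → ℕ → Set
      Solution ξ N = ∃[ r ] ⟦ r ⟧ ∉ C × den r ℕ.≤ N × dist ξ ⟦ r ⟧ * fromℕ N ≤ fromℕ K + fromℕ K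

      in-C : ∀ {ξ N} → ¬ Solution ξ N → ∀ r → den r ℕ.≤ N → dist ξ ⟦ r ⟧ * fromℕ N ≤ fromℕ K + fromℕ K → ⟦ r ⟧ ∈ C
      in-C none r r≤N le = by-contradiction λ r∉C → none (r , r∉C , r≤N , le)

      module _ {ξ} (ξ∈C : ξ ∈ C) {N : ℕ} (N₀≤N : N₀ ℕ.≤ N) (1≤N : 1 ℕ.≤ N) (none : ¬ Solution ξ N) where

        n H : ℕ
        n = proj₁ (count N 1≤N)
        H = J ℕ.^ n

        H≤ : H ℕ.^ K ℕ.≤ c ℕ.* N ℕ.^ e
        H≤ = proj₂ (proj₂ (count N 1≤N))

        2H≤ : H ℕ.+ H ℕ.≤ N
        2H≤ = ≡.subst (ℕ._≤ N) (≡.cong (H ℕ.+_) (ℕP.+-identityʳ H))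
            (2H≤N e c H N 1≤N H≤ (ℕP.≤-trans (ℕP.m≤m+n _ _) N₀≤N))

        q : Fin (suc H) → ℕ
        q i = N ℕ.∸ Fin.toℕ i

        i≤H : ∀ (i : Fin (suc H)) → Fin.toℕ i ℕ.≤ H
        i≤H i = ℕP.≤-pred (FinP.toℕ<n i)

        i≤N : ∀ (i : Fin (suc H)) → Fin.toℕ i ℕ.≤ N
        i≤N i = ℕP.≤-trans (i≤H i) (ℕP.≤-trans (ℕP.m≤m+n H H) 2H≤)

        q+i≡N : ∀ i → q i ℕ.+ Fin.toℕ i ≡ N
        q+i≡N i = ℕP.m∸n+n≡m (i≤N i)

        i≤q : ∀ i → Fin.toℕ i ℕ.≤ q i
        i≤q i = ℕP.m+n≤o⇒m≤o∸n (Fin.toℕ i) (ℕP.≤-trans (ℕP.+-mono-≤ (i≤H i) (i≤H i)) 2H≤)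

        N≤2q : ∀ i → N ℕ.≤ 2 ℕ.* q i
        N≤2q i = ≡.subst₂ ℕ._≤_ (q+i≡N i) (≡.cong (q i ℕ.+_) (≡.sym (ℕP.+-identityʳ (q i))))
            (ℕP.+-monoʳ-≤ (q i) (i≤q i))

        threshold<q : ∀ i → threshold ℕ.< q i
        threshold<q i = ℕP.*-cancelˡ-≤ 2 (ℕP.≤-trans (ℕP.≤-trans (ℕP.m≤n+m _ (2 ℕ.^ K ℕ.* c)) N₀≤N) (N≤2q i))

        1≤q : ∀ i → 1 ℕ.≤ q i
        1≤q i = ℕP.≤-trans (s≤s z≤n) (threshold<q i)

        approx : ∀ i → Approximant ξ K H (q i)
        approx i = approximant ξ∈C (suc e) H (q i) (1≤q i)
            (size-bound e c H N (q i) (1≤q i) H≤ (N≤2q i) (threshold<q i))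

        module A (i : Fin (suc H)) = Approximant (approx i)

        den≤N : ∀ i → den (A.r i) ℕ.≤ N
        den≤N i = ≡.subst (ℕ._≤ N) (≡.sym (A.den≡q i)) (ℕP.m∸n≤m N (Fin.toℕ i))

        near : ∀ i → dist ξ ⟦ A.r i ⟧ * fromℕ N ≤ fromℕ K + fromℕ K
        near i = ≤-trans (0≤dist ξ ⟦ A.r i ⟧ *≤ ≤-respʳ-≈ (fromℕ-* 2 (q i)) (fromℕ-mono-≤ (N≤2q i)))
            (≤-respˡ-≈ (lem (dist ξ ⟦ A.r i ⟧) (fromℕ (q i))) (A.close i +≤ A.close i))
          where
          lem : ∀ a b → a * b + a * b ≈ a * (fromℕ 2 * b)
          lem a b = solve (a ∷ b ∷ []) (x₀ :* x₁ :+ x₀ :* x₁) (x₀ :* (con (+ 2) :* x₁))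

        r∈C : ∀ i → ⟦ A.r i ⟧ ∈ C
        r∈C i = in-C none (A.r i) (den≤N i) (near i)

        -- Distinct fractions are at distance at least N⁻², more than the diameter of a cylinder.
        same : ∀ i j → colour n (r∈C i) ≡ colour n (r∈C j) → ⟦ A.r i ⟧ ≋ ⟦ A.r j ⟧
        same i j eq = by-contradiction λ ≉ → <⇒≱ (proj₁ (proj₂ (count N 1≤N))) (≤-trans (separation (A.r i) (A.r j) ≉)
          (*-mono-≤ (0≤dist ⟦ A.r i ⟧ ⟦ A.r j ⟧) (same-colour n (r∈C i) (r∈C j) eq)
              (0≤x*y (0≤fromℕ (den (A.r i))) (0≤fromℕ (den (A.r j))))
            (*-mono-≤ (0≤fromℕ (den (A.r i))) (fromℕ-mono-≤ (den≤N i)) (0≤fromℕ (den (A.r j)))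
                (fromℕ-mono-≤ (den≤N j)))))

        -- The two denominators differ by at most H, so equal values would force q ≤ gcd (P, q) H,
        -- which the choice of the numerator excludes.
        clash : ∀ i j → i Fin.< j → ⟦ A.r i ⟧ ≋ ⟦ A.r j ⟧ → ⊥
        clash i j i<j eq = ℕP.<⇒≱ (A.coprimish i) (ℕP.≤-trans
            (collision (A.P i) (q i) (A.P j) (q j) (same-ratio (approx i) (approx j) eq) (ℕP.∸-monoʳ-< i<j (i≤N j)))
            (ℕP.*-monoʳ-≤ (ℕGCD.gcd (A.P i) (q i)) (ℕP.m≤n+o⇒m∸n≤o (q i) (q j) (ℕP.≤-trans (ℕP.m∸n≤m N (Fin.toℕ i))
              (≡.subst (ℕ._≤ q j ℕ.+ H) (q+i≡N j) (ℕP.+-monoʳ-≤ (q j) (i≤H j)))))))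

        absurd : ⊥
        absurd = go (FinP.pigeonhole (ℕP.n<1+n H) (λ i → colour n (r∈C i)))
          where
          go : (∃₂ λ i j → i Fin.< j × colour n (r∈C i) ≡ colour n (r∈C j)) → ⊥
          go (i , j , i<j , eq) = clash i j i<j (same i j eq)

      avoidable′ : Avoidable
      avoidable′ = fromℕ K + fromℕ K , ≤-by (0≤fromℕ K +≤ 0≤fromℕ K) (lem (fromℕ K)) , N₀ ,
          λ ξ∈C N N₀≤N 1≤N → by-contradiction (absurd ξ∈C N₀≤N 1≤N)
        where
        lem : ∀ a → a + a - 0# ≈ a + a - (0# + 0#)
        lem a = solve (a ∷ []) (x₀ :+ x₀ :- con 0ℤ) (x₀ :+ x₀ :- (con 0ℤ :+ con 0ℤ))

    avoidable : Avoidable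
    avoidable = Collision.avoidable′ (proj₁ count-bound) (proj₁ (proj₂ count-bound)) (proj₂ (proj₂ count-bound))

theorem3p3 :
  (∀ {ℓ} → ExcludedMiddle ℓ) →
  (𝓡 : RealNumbers) → let open Real 𝓡 in
  (d J : ℕ) → 2 ℕ.≤ J →
  (f : Fin J → ℝ^ d → ℝ^ d) (τ : Fin J → ℝ) →
  (∀ j → IsContractingSimilarity (τ j) (f j)) →
  (∀ j x → x ∈ Rational → f j x ∈ Rational) →
  (C : Pred (ℝ^ d) 0ℓ) → IsAttractor f C → HasTwoPoints C →
  (OpenSetCondition f ×
     (∃[ v ] ¬ (∀ i → v i ≡ 0ℤ) × ¬ ContainsSegmentParallelTo C v))
    ⊎ (∃[ D ] IsDimension J (maximum τ) D × D < ½) →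
  (∃[ K ] 0# < K ×
     (∀ ξ → ξ ∈ C → ∀ Q → 1# < Q →
        ∃[ r ] ⟦ r ⟧ ∉ C × fromℕ (den r) ≤ Q × ‖ ξ ⊖ ⟦ r ⟧ ‖ ≤ K ÷ Q))
  ×
  ((Φ : ℕ → ℝ) → (∀ n → 1 ℕ.≤ n → 0# < Φ n) → Φ ⟶ 0# →
     ∃[ ξ ] ξ ∈ C × ξ ∉ Rational ×
       (∀ N → ∃[ Q ] N ℕ.< Q ×
          (∀ r → ⟦ r ⟧ ∉ C → den r ℕ.≤ Q →
             Φ Q ÷ fromℕ Q < ‖ ξ ⊖ ⟦ r ⟧ ‖)))
  ×
  (((Ψ : ℕ → ℝ) → (∀ n → 1 ℕ.≤ n → 0# < Ψ n) →
      ∃[ ξ ] ξ ∈ IntrinsicallyApproximable Ψ C)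
   × (∃[ ξ ] ξ ∈ C × ξ ∈ Liouville))
theorem3p3 em 𝓡 d J 2≤J f τ contracting f-rational C attractor two-points hypothesis =
  avoid ([ by-open-set , by-dimension ]′ hypothesis) , extrinsic , intrinsic , liouville
  where
  open Real 𝓡
  open IteratedFunctionSystem em 𝓡 2≤J f τ contracting f-rational C attractor two-points
  open Approximation em 𝓡 2≤J f τ contracting f-rational C attractor two-points
  module OpenSet′ = OpenSet em 𝓡 2≤J f τ contracting f-rational C attractor two-points
  module Counting′ = Counting em 𝓡 2≤J f τ contracting f-rational C attractor two-points
  by-open-set : (OpenSetCondition f × (∃[ v ] ¬ (∀ i → v i ≡ 0ℤ) × ¬ ContainsSegmentParallelTo C v)) → Avoidable
  by-open-set (osc , v , v≢0 , no-segment) = OpenSet′.Separated.Porous.avoidable osc v v≢0 no-segment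
  by-dimension : (∃[ D ] IsDimension J (maximum τ) D × D < ½) → Avoidable
  by-dimension (D , isDimension , D<½) = Counting′.avoidable (Logarithm.dimension<½ em 𝓡 {J} t<1 isDimension D<½)
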